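{- Every first-order formula $p$ over $S$ is equivalent in $T$ either to $\mathit{true}$, or to $\mathit{false}$, or to a formula $\phi$ such that: every free variable of $\phi$ is a free variable of $p$; $\phi$ has at least one free variable; $\phi$ is equivalent in $T$ neither to $\mathit{true}$ nor to $\mathit{false}$; and the solutions of the free variables are expressed in $\phi$ in a clear and explicit way, i.e. $\phi$ is a finite disjunction of formulas each of which is written in an explicit solved form.
   Context: Let $F$ be a set of function symbols, each with an arity, containing infinitely many non-constant function symbols and at least one constant. Let $\mathrm{finite}$ be a unary relation symbol and $S=F\cup\{\mathrm{finite}\}$. The theory $T$ (in first-order logic with equality over $S$) has as axioms all propositions of the forms: [1] $\forall\bar x\forall\bar y\ \neg(f(\bar x)=g(\bar y))$; [2] $\forall\bar x\forall\bar y\ f(\bar x)=f(\bar y)\rightarrow\bigwedge_i x_i=y_i$; [3] $\forall\bar x\exists!\bar z\ \bigwedge_i z_i=t_i[\bar x\bar z]$; [4] $\forall\bar x\forall u\ \neg(u=t[u,\bar x]\wedge\mathrm{finite}(u))$; [5] $\forall\bar x\forall u\ (u=f(\bar x)\wedge\mathrm{finite}(u))\leftrightarrow(u=f(\bar x)\wedge\bigwedge_i\mathrm{finite}(x_i))$; where $f,g$ are distinct symbols of $F$, $\bar x,\bar y$ are vectors of (possibly non-distinct) variables, $\bar z$ is a vector of distinct variables, $t_i[\bar x\bar z]$ is one symbol of $F$ applied to variables from $\bar x$ or $\bar z$, and $t[u,\bar x]$ is a term containing at least one symbol of $F$ and the variable $u$, and possibly variables of $\bar x$. Formulas $\varphi,\psi$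 are equivalent in $T$ if $T\models\varphi\leftrightarrow\psi$. Discipline. The countably infinite set $V$ of variables is ordered by a strict linear dense order without endpoints $\succ$. A formula satisfies the discipline of formulas in $T$ if (i) its quantified variables have distinct names, different from those of its free variables, and (ii) for all variables $x,y$ and every sub-formula $\psi$, if $y$ has a free occurrence in $\psi$ and $x$ a bound occurrence in $\psi$ then $x\succ y$. Every formula can be made to satisfy the discipline by renaming its quantified variables, and all formulas considered are assumed to satisfy it. Formulas are identified modulo associativity, commutativity and idempotence of $\wedge$, and modulo $\varphi\wedge\mathit{true}=\varphi$, $\varphi\vee\mathit{false}=\varphi$. $\exists\bar x\,\varphi\wedge\psi$ means $\exists\bar x(\varphi\wedge\psi)$. Basic formulas. A flat equation is $x_0=x_1$ or $x_0=f(x_1,\dots,x_n)$ with $x_i\in V$ (possibly non-distinct), $f\in F$. A basic formula is $(\bigwedge_{i=1}^n v_i=t_i)\wedge(\bigwedge_{i=1}^m\mathrm{finite}(u_i))$ with all $v_i,u_i$ variables and all equations flat; for $n=m=0$ it is $\mathit{true}$. It is solved if the variables $v_1,\dots,v_n,u_1,\dots,u_m$ are distinct and $x\succ y$ for each equation of the form $x=y$ between variables. Reachability. The variables of a basic formula $\alpha$ reachable from $x_0$ are those which occur in a sub-formula of $\alpha$ of the form $x_0=t_0(x_1)\wedge x_1=t_1(x_2)\wedge\dots\wedge x_{n-1}=t_{n-1}(x_n)$ where $x_{i+1}$ occurs in $t_i(x_{i+1})$. The reachable variables of $\exists\bar x\,\alpha$ are those reachable in $\alpha$ from the free variables of $\exists\bar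 x\,\alpha$. General solved formula: a formula (satisfying the discipline) of the form $\neg(\exists\bar x\,\alpha\wedge\bigwedge_{i=1}^n\neg(\exists\bar y_i\,\beta_i))$, $n\ge 0$, such that 1. $\alpha$ and all $\beta_i$, $i\in\{1,\dots,n\}$, are solved basic formulas; 2. if $\alpha'$ is the conjunction of the equations of $\alpha$, then all the conjunctions $\alpha'\wedge\beta_i$ are solved basic formulas; 3. all variables of $\bar x$ are reachable in $\exists\bar x\,\alpha$; 4. for all $i$, all variables of $\bar y_i$ are reachable in $\exists\bar y_i\,\beta_i$; 5. if $\mathrm{finite}(u)$ is a sub-formula of $\alpha$ then for all $i$ the formula $\beta_i$ contains either $\mathrm{finite}(u)$, or $\mathrm{finite}(v)$ where $v$ is a variable reachable from $u$ in $\alpha\wedge\beta_i$ which does not occur as a left hand side of an equation of $\alpha\wedge\beta_i$; 6. for all $i$, $\beta_i$ contains at least one atomic formula which does not occur in $\alpha$. A formula $\exists\bar x\,\alpha\wedge\bigwedge_{i=1}^n\neg(\exists\bar y_i\,\beta_i)$ (with $n\ge 0$ and $\alpha,\beta_i$ basic formulas) is written in an explicit solved form iff its negation $\neg(\exists\bar x\,\alpha\wedge\bigwedge_{i=1}^n\neg(\exists\bar y_i\,\beta_i))$ is a general solved formula.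
   Formalization: Condition 5 is read as: β_i contains finite(u), or finite(v) for every (not just some) v reachable from u that is no left-hand side; with "some", finite(u)∧¬(u=c) has no such φ. Models are small sets (no loss, by Löwenheim–Skolem). -}

module Defs where

open import Level using (0ℓ)
open import Data.Empty using (⊥)
open import Data.Fin.Base using (Fin)
open import Data.List.Base as List using (List; []; _∷_; _++_; foldr)
open import Data.List.Membership.Propositional using (_∈_; _∉_)
open import Data.List.Relation.Unary.Unique.Propositional using (Unique)
open import Data.Nat.Base using (ℕ)
open import Data.Product.Base using (Σ; ∃; ∃-syntax; _×_; _,_; proj₁; proj₂)
open import Data.Sum.Base using (_⊎_; [_,_]′)
open import Data.Unit.Base using (⊤)
open import Data.Vec.Base as Vec using (Vec; []; _∷_; toList; lookup)
open import Data.Vec.Relation.Unary.Any using (Any)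
open import Function.Base using (_∘_)
open import Function.Bundles using (_↔_)
open import Relation.Binary.Construct.Closure.ReflexiveTransitive using (Star)
open import Relation.Binary.Core using (Rel)
open import Relation.Binary.PropositionalEquality.Core using (_≡_; _≢_)
open import Relation.Binary.Structures using (IsDenseLinearOrder)
open import Relation.Nullary.Decidable.Core using (does)
open import Relation.Nullary.Negation.Core using (¬_)
open import Data.Bool.Base using (if_then_else_)

record Signature : Set₁ where
  field
    Sym   : Set
    arity : Sym → ℕ
    infinitelyManyNonConstants : ∀ (fs : List Sym) → ∃[ f ] f ∉ fs × arity f ≢ 0
    someConstant               : ∃[ c ] arity c ≡ 0

record Variables : Set₁ where
  infix 4 _≻_
  field
    Var                : Set
    countablyInfinite  : Var ↔ ℕ
    _≻_                : Rel Var 0ℓ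
    isDenseLinearOrder : IsDenseLinearOrder _≡_ _≻_
    unboundedAbove     : ∀ x → ∃[ y ] y ≻ x
    unboundedBelow     : ∀ x → ∃[ y ] x ≻ y

  open IsDenseLinearOrder isDenseLinearOrder public using (_≟_)

module FirstOrder (𝓕 : Signature) (𝓥 : Variables) where

  open Signature 𝓕
  open Variables 𝓥

  infix  8 _≐_
  infix  8 _≈_
  infixr 6 _∧_
  infixr 5 _∨_
  infixr 4 _⇒_
  infix  3 _⇔_

  data Term : Set where
    var : Var → Term
    app : (f : Sym) → Vec Term (arity f) → Term

  data Connective : Set where
    and or implies iff : Connective

  data Quantifier : Set where
    all some : Quantifier

  data Formula : Set where
    true false : Formula
    _≐_        : Term → Term → Formula
    finite     : Term → Formula
    neg        : Formula → Formula
    binary     : Connective → Formula → Formula → Formula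
    quantify   : Quantifier → Var → Formula → Formula

  pattern _∧_ φ ψ = binary and φ ψ
  pattern _∨_ φ ψ = binary or φ ψ
  pattern _⇒_ φ ψ = binary implies φ ψ
  pattern _⇔_ φ ψ = binary iff φ ψ

  ∀* ∃* : List Var → Formula → Formula
  ∀* x̄ φ = foldr (quantify all) φ x̄
  ∃* x̄ φ = foldr (quantify some) φ x̄

  -- The units ending these chains are harmless: formulas are identified
  -- modulo φ ∧ true = φ and φ ∨ false = φ.
  ⋀ ⋁ : List Formula → Formula
  ⋀ = foldr _∧_ true
  ⋁ = foldr _∨_ false

  data _∈ᵗ_ (x : Var) : Term → Set where
    here  : x ∈ᵗ var x
    there : ∀ {f ts} → Any (x ∈ᵗ_) ts → x ∈ᵗ app f ts

  infix 4 _∈ᵗ_ _∈FV_ _⊑_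

  _∈FV_ : Var → Formula → Set
  x ∈FV true           = ⊥
  x ∈FV false          = ⊥
  x ∈FV (s ≐ t)        = x ∈ᵗ s ⊎ x ∈ᵗ t
  x ∈FV finite t       = x ∈ᵗ t
  x ∈FV neg φ          = x ∈FV φ
  x ∈FV binary _ φ ψ   = x ∈FV φ ⊎ x ∈FV ψ
  x ∈FV quantify _ y φ = x ≢ y × x ∈FV φ

  -- One entry per quantifier occurrence.
  quantified : Formula → List Var
  quantified true             = []
  quantified false            = []
  quantified (_ ≐ _)          = []
  quantified (finite _)       = []
  quantified (neg φ)          = quantified φ
  quantified (binary _ φ ψ)   = quantified φ ++ quantified ψ
  quantified (quantify _ x φ) = x ∷ quantified φ

  data _⊑_ (ψ : Formula) : Formula → Set where
    self  : ψ ⊑ ψ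
    neg   : ∀ {φ} → ψ ⊑ φ → ψ ⊑ neg φ
    left  : ∀ {⊙ φ χ} → ψ ⊑ φ → ψ ⊑ binary ⊙ φ χ
    right : ∀ {⊙ φ χ} → ψ ⊑ χ → ψ ⊑ binary ⊙ φ χ
    body  : ∀ {Q x φ} → ψ ⊑ φ → ψ ⊑ quantify Q x φ

  record Discipline (φ : Formula) : Set where
    field
      distinct     : Unique (quantified φ)
      bound≢free   : ∀ {x} → x ∈ quantified φ → ¬ (x ∈FV φ)
      bound≻free   : ∀ {ψ x y} → ψ ⊑ φ → y ∈FV ψ → x ∈ quantified ψ → x ≻ y

  record Structure : Set₁ where
    field
      Carrier : Set
      fun     : (f : Sym) → Vec Carrier (arity f) → Carrier
      Finite  : Carrier → Set

  module _ (𝓜 : Structure) where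
    open Structure 𝓜

    Valuation : Set
    Valuation = Var → Carrier

    _[_↦_] : Valuation → Var → Carrier → Valuation
    (ρ [ x ↦ a ]) y = if does (y ≟ x) then a else ρ y

    mutual
      eval : Valuation → Term → Carrier
      eval ρ (var x)    = ρ x
      eval ρ (app f ts) = fun f (evals ρ ts)

      evals : ∀ {n} → Valuation → Vec Term n → Vec Carrier n
      evals ρ []       = []
      evals ρ (t ∷ ts) = eval ρ t ∷ evals ρ ts

    Sat : Valuation → Formula → Set
    Sat ρ true                = ⊤
    Sat ρ false               = ⊥
    Sat ρ (s ≐ t)             = eval ρ s ≡ eval ρ t
    Sat ρ (finite t)          = Finite (eval ρ t)
    Sat ρ (neg φ)             = ¬ Sat ρ φ
    Sat ρ (φ ∧ ψ)             = Sat ρ φ × Sat ρ ψ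
    Sat ρ (φ ∨ ψ)             = Sat ρ φ ⊎ Sat ρ ψ
    Sat ρ (φ ⇒ ψ)             = Sat ρ φ → Sat ρ ψ
    Sat ρ (φ ⇔ ψ)             = (Sat ρ φ → Sat ρ ψ) × (Sat ρ ψ → Sat ρ φ)
    Sat ρ (quantify all x φ)  = (a : Carrier) → Sat (ρ [ x ↦ a ]) φ
    Sat ρ (quantify some x φ) = Σ Carrier λ a → Sat (ρ [ x ↦ a ]) φ

  apply : (f : Sym) → Vec Var (arity f) → Term
  apply f x̄ = app f (Vec.map var x̄)

  -- The right-hand sides tᵢ[x̄z̄] of a system z̄ = t̄[x̄z̄]: inj₁ j is the j-th
  -- variable of x̄ and inj₂ j the j-th variable of z̄.
  System : ℕ → ℕ → Set
  System m n = Fin n → Σ Sym λ f → Vec (Fin m ⊎ Fin n) (arity f)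

  ⟪_⟫ : ∀ {m n} → System m n → Vec Var m → Vec Var n → Formula
  ⟪_⟫ {n = n} t x̄ z̄ = ⋀ (List.map equation (List.allFin n))
    where
    equation : Fin n → Formula
    equation i = var (lookup z̄ i) ≐
      apply (proj₁ (t i)) (Vec.map [ lookup x̄ , lookup z̄ ]′ (proj₂ (t i)))

  _≐*_ : ∀ {n} → Vec Var n → Vec Var n → Formula
  x̄ ≐* ȳ = ⋀ (toList (Vec.zipWith (λ x y → var x ≐ var y) x̄ ȳ))

  data Axiom : Formula → Set where

    clash : ∀ {f g} → f ≢ g →
      (x̄ : Vec Var (arity f)) (ȳ : Vec Var (arity g)) →
      Axiom (∀* (toList x̄) (∀* (toList ȳ) (neg (apply f x̄ ≐ apply g ȳ))))

    injective : ∀ {f} (x̄ ȳ : Vec Var (arity f)) →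
      Axiom (∀* (toList x̄) (∀* (toList ȳ)
        ((apply f x̄ ≐ apply f ȳ) ⇒ (x̄ ≐* ȳ))))

    -- ∃! z̄ φ[z̄] is ∃ z̄ φ[z̄] ∧ ∀ z̄ ∀ z̄′ (φ[z̄] ∧ φ[z̄′] ⇒ z̄ = z̄′), where z̄′ is
    -- a vector of fresh variables.
    uniqueSolution : ∀ {m n} (t : System m n) (x̄ : Vec Var m) (z̄ z̄′ : Vec Var n) →
      Unique (toList z̄ ++ toList z̄′) →
      (∀ {x} → x ∈ toList x̄ → x ∉ toList z̄ ++ toList z̄′) →
      Axiom (∀* (toList x̄)
        (∃* (toList z̄) (⟪ t ⟫ x̄ z̄) ∧
         ∀* (toList z̄) (∀* (toList z̄′)
           ((⟪ t ⟫ x̄ z̄ ∧ ⟪ t ⟫ x̄ z̄′) ⇒ (z̄ ≐* z̄′)))))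

    acyclic : (x̄ : List Var) (u : Var) {f : Sym} (ts : Vec Term (arity f)) →
      u ∈ᵗ app f ts →
      (∀ {y} → y ∈ᵗ app f ts → y ≡ u ⊎ y ∈ x̄) →
      Axiom (∀* x̄ (quantify all u
        (neg ((var u ≐ app f ts) ∧ finite (var u)))))

    finiteness : ∀ {f} (x̄ : Vec Var (arity f)) (u : Var) →
      Axiom (∀* (toList x̄) (quantify all u
        (((var u ≐ apply f x̄) ∧ finite (var u)) ⇔
         ((var u ≐ apply f x̄) ∧ ⋀ (List.map (finite ∘ var) (toList x̄))))))

  infix 2 T⊨_ _≡ᵀ_

  Model : Structure → Set
  Model 𝓜 = ∀ {φ} → Axiom φ → ∀ ρ → Sat 𝓜 ρ φ

  T⊨_ : Formula → Set₁
  T⊨ φ = ∀ 𝓜 → Model 𝓜 → ∀ ρ → Sat 𝓜 ρ φ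

  _≡ᵀ_ : Formula → Formula → Set₁
  φ ≡ᵀ ψ = T⊨ (φ ⇔ ψ)

  data FlatTerm : Set where
    var : Var → FlatTerm
    app : (f : Sym) → Vec Var (arity f) → FlatTerm

  data Atom : Set where
    _≈_    : Var → FlatTerm → Atom
    finite : Var → Atom

  -- Conjunction is associative, commutative and idempotent, so a list of
  -- atoms matters only through its membership relation.
  Basic : Set
  Basic = List Atom

  flatTerm : FlatTerm → Term
  flatTerm (var x)    = var x
  flatTerm (app f x̄) = apply f x̄

  atom : Atom → Formula
  atom (x ≈ t)    = var x ≐ flatTerm t
  atom (finite x) = finite (var x)

  basic : Basic → Formula
  basic α = ⋀ (List.map atom α)

  varsᶠ : FlatTerm → List Var
  varsᶠ (var x)    = x ∷ []
  varsᶠ (app f x̄) = toList x̄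

  subject : Atom → Var
  subject (x ≈ _)    = x
  subject (finite x) = x

  equations : Basic → Basic
  equations []             = []
  equations ((x ≈ t) ∷ α)  = (x ≈ t) ∷ equations α
  equations (finite _ ∷ α) = equations α

  -- `distinct` says that the variables v₁,…,vₙ,u₁,…,uₘ are distinct once
  -- repeated atoms have been merged (idempotence of ∧).
  record Solved (α : Basic) : Set where
    field
      distinct : ∀ {a b} → a ∈ α → b ∈ α → subject a ≡ subject b → a ≡ b
      oriented : ∀ {x y} → (x ≈ var y) ∈ α → x ≻ y

  _isLhsIn_ : Var → Basic → Set
  x isLhsIn α = ∃[ t ] (x ≈ t) ∈ α

  Step : Basic → Rel Var 0ℓ
  Step α x y = ∃[ t ] (x ≈ t) ∈ α × y ∈ varsᶠ t

  -- Reflexivity only adds that x is reachable from itself when no equation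
  -- has left-hand side x.
  Reach : Basic → Rel Var 0ℓ
  Reach α = Star (Step α)

  AllReachable : List Var → Basic → Set
  AllReachable x̄ α =
    ∀ {x} → x ∈ x̄ → ∃[ y ] y ∈FV ∃* x̄ (basic α) × Reach α y x

  -- In ∃ȳ β: the pair (ȳ , β).
  Block : Set
  Block = List Var × Basic

  block : Block → Formula
  block (ȳ , β) = ∃* ȳ (basic β)

  nested : List Var → Basic → List Block → Formula
  nested x̄ α bs = ∃* x̄ (basic α ∧ ⋀ (List.map (neg ∘ block) bs))

  -- In `finiteCovered`, "finite(v) where v is a variable reachable from u which
  -- is not a left-hand side" is taken to concern every such v.  It therefore
  -- entails the existence of one whenever u reaches a variable that is not a
  -- left-hand side.  Demanding existence outright would exclude ground
  -- exceptions: with c a constant, finite(u) ∧ ¬(u = c) would be equivalent to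
  -- no disjunction of explicit solved forms in the free variable u.
  record GeneralSolved (φ : Formula) : Set where
    field
      x̄          : List Var
      α           : Basic
      bs          : List Block
      shape       : φ ≡ neg (nested x̄ α bs)
      discipline  : Discipline φ
      solvedα     : Solved α
      solvedβ     : ∀ {ȳ β} → (ȳ , β) ∈ bs → Solved β
      solvedα′β   : ∀ {ȳ β} → (ȳ , β) ∈ bs → Solved (equations α ++ β)
      reachableα  : AllReachable x̄ α
      reachableβ  : ∀ {ȳ β} → (ȳ , β) ∈ bs → AllReachable ȳ β
      finiteCovered : ∀ {u ȳ β} → finite u ∈ α → (ȳ , β) ∈ bs →
        finite u ∈ β ⊎
        (∀ {v} → Reach (α ++ β) u v → ¬ (v isLhsIn (α ++ β)) → finite v ∈ β)
      properβ     : ∀ {ȳ β} → (ȳ , β) ∈ bs → ∃[ a ] a ∈ β × a ∉ α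

  ExplicitSolvedForm : Formula → Set
  ExplicitSolvedForm φ = GeneralSolved (neg φ)

{-# OPTIONS --safe #-}

-- Quantifiers are eliminated down to Boolean combinations of blocks ∃ȳ β with
-- β a conjunction of flat atoms.  The key equivalence, for a block α and
-- blocks βᵢ, is
--
--   ∃x̄ (α ∧ ⋀ᵢ ¬∃ȳᵢ βᵢ)  ⟺  ∃x̄ α ∧ ⋀_{i ∈ I} ¬∃x̄ȳᵢ (α ∧ βᵢ),
--
-- where I collects the βᵢ that say nothing about the variables of x̄ which α
-- leaves undetermined.  If i ∉ I, then βᵢ is refuted by giving each such
-- variable a value with a head symbol seen nowhere else: a finite tree if α
-- demands it, and the infinite tree x = h(x,…,x) otherwise.
--
-- All of this rests on congruence closure: a system of flat constraints without
-- clashes of symbols and without cycles through finite variables is solvable,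
-- with arbitrary values on the classes that carry no function symbol, by the
-- existence part of axiom [3]; its uniqueness part shows that these values
-- determine the rest.
--
-- A block is solved by keeping the ≻-least variable of each congruence class.
-- Solving α first and then every α ∧ βᵢ with the equations of α kept verbatim
-- yields the explicit solved form; bound variables are named upwards along ≻.

module Submission where

open import Defs
open import Axiom.ExcludedMiddle using (ExcludedMiddle)
open import Data.Empty using (⊥; ⊥-elim)
open import Data.Fin.Base using (Fin; zero; suc; toℕ; _↑ˡ_; _↑ʳ_; splitAt)
open import Data.Fin.Induction using (spo-wellFounded)
open import Data.Fin.Properties
  using (splitAt-↑ˡ; splitAt-↑ʳ; toℕ-injective; ↑ˡ-injective; ↑ʳ-injective)
open import Data.List.Base as List using (List; []; _∷_; _++_; length; filter; cartesianProductWith)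
open import Data.List.Membership.Propositional using (_∈_; _∉_)
open import Data.List.Membership.Propositional.Properties
  using (∈-map⁺; ∈-map⁻; ∈-allFin; ∈-++⁺ˡ; ∈-++⁺ʳ; ∈-++⁻
    ; ∈-concatMap⁺; ∈-filter⁺; ∈-filter⁻; ∈-lookup; ∈-cartesianProductWith⁺; ∈-cartesianProductWith⁻)
open import Data.List.Properties using (++-identityʳ)
open import Data.List.Relation.Binary.Subset.Propositional using (_⊆_)
open import Data.List.Relation.Unary.All as All using (All; []; _∷_)
open import Data.List.Relation.Unary.AllPairs as AllPairs using (AllPairs; []; _∷_)
open import Data.List.Relation.Unary.Any as Any using (here; there)
open import Data.List.Relation.Unary.Any.Properties using (lookup-index)
open import Data.List.Relation.Unary.Unique.Propositional using () renaming (Unique to Distinct)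
open import Data.Maybe.Base using (Maybe; just; nothing; maybe′)
open import Data.Maybe.Properties using (just-injective)
open import Data.Nat.Base using (ℕ; zero; suc; _+_)
open import Data.Product.Base using (Σ; ∃; _×_; _,_; proj₁; proj₂)
open import Data.Sum.Base as Sum using (_⊎_; inj₁; inj₂; [_,_]′)
open import Data.Unit.Base using (⊤; tt)
open import Data.Vec.Base as Vec using (Vec; []; _∷_; toList; lookup; tabulate)
open import Function.Base using (_∘_; id)
open import Function.Bundles using (module Inverse)
open import Induction.WellFounded using (Acc; acc)
open import Relation.Binary.Construct.Closure.ReflexiveTransitive using (ε; _◅_; _◅◅_)
open import Relation.Binary.Construct.Closure.Transitive as Plus using (TransClosure; [_]; _∷_)
open import Relation.Binary.Definitions using (tri<; tri≈; tri>)
open import Relation.Binary.PropositionalEquality hiding ([_])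
open import Relation.Binary.Structures using (IsStrictPartialOrder; IsDenseLinearOrder)
open import Relation.Nullary.Decidable.Core using (Dec; yes; no)
open import Relation.Nullary.Negation.Core using (¬_)
import Data.List.Relation.Unary.Unique.Propositional.Properties as UniqueP
import Data.Vec.Properties as Vec
import Data.Vec.Relation.Unary.Any as VecAny
import Data.Maybe.Base as Maybe
import Data.List.Relation.Unary.All.Properties as All
import Data.List.Relation.Unary.AllPairs.Properties as AllPairs

-- Equivalence in `T` ranges over all models, whereas the formula must be one and the same. Hence
-- every choice that shapes it, in particular which exceptions survive a quantifier and which atoms
-- a block emits, is made by excluded middle on relations between names; a single model enters only
-- in proofs of correctness, where witnesses are picked.
--
-- The obstacle is that these relations do not capture equality in models: cyclic equations can
-- force two variables to be equal without any derivation. Solvability tolerates this. Where two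
-- valuations must be compared, uniqueness of solutions replaces the induction on terms that
-- infinite trees do not allow.
--
-- One choice of generic values must defeat many exceptions at once. Each exception therefore states
-- finitely many demands on head symbols, and the demands are pooled before any head is picked.
--
-- The alternatives `true` and `false` come from reachability: an explicit solved form without free
-- variables can contain neither quantifiers nor atoms, so a disjunction of such forms is trivial.

module Development (em : ∀ {ℓ} → ExcludedMiddle ℓ) (𝓕 : Signature) (𝓥 : Variables) where

  open FirstOrder 𝓕 𝓥
  open Signature 𝓕
  open Variables 𝓥
  open IsDenseLinearOrder isDenseLinearOrder using (asym; irrefl; compare) renaming (trans to ≻-trans)

  -- Satisfaction and the axioms, semantically

  module Coincidence (𝓜 : Structure) where
    open Structure 𝓜

    mutual
      eval-cong : ∀ t {ρ σ : Valuation 𝓜} → (∀ {x} → x ∈ᵗ t → ρ x ≡ σ x) → eval 𝓜 ρ t ≡ eval 𝓜 σ t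
      eval-cong (var x)    ρ≗σ = ρ≗σ here
      eval-cong (app f ts) ρ≗σ = cong (fun f) (evals-cong ts (ρ≗σ ∘ there))

      evals-cong : ∀ {n} (ts : Vec Term n) {ρ σ : Valuation 𝓜} →
        (∀ {x} → VecAny.Any (x ∈ᵗ_) ts → ρ x ≡ σ x) → evals 𝓜 ρ ts ≡ evals 𝓜 σ ts
      evals-cong []       ρ≗σ = refl
      evals-cong (t ∷ ts) ρ≗σ =
        cong₂ _∷_ (eval-cong t (ρ≗σ ∘ VecAny.here)) (evals-cong ts (ρ≗σ ∘ VecAny.there))

    update-cong : ∀ {P : Var → Set} {ρ σ : Valuation 𝓜} x a →
      (∀ {y} → y ≢ x × P y → ρ y ≡ σ y) →
      ∀ {y} → P y → (_[_↦_] 𝓜 ρ x a) y ≡ (_[_↦_] 𝓜 σ x a) y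
    update-cong x a ρ≗σ {y} Py with y ≟ x
    ... | yes _  = refl
    ... | no y≢x = ρ≗σ (y≢x , Py)

    Sat-cong : ∀ φ {ρ σ : Valuation 𝓜} → (∀ {x} → x ∈FV φ → ρ x ≡ σ x) → Sat 𝓜 ρ φ → Sat 𝓜 σ φ
    Sat-cong true      ρ≗σ s = s
    Sat-cong (t ≐ u)   ρ≗σ s =
      trans (sym (eval-cong t (ρ≗σ ∘ inj₁))) (trans s (eval-cong u (ρ≗σ ∘ inj₂)))
    Sat-cong (finite t) ρ≗σ s = subst Finite (eval-cong t ρ≗σ) s
    Sat-cong (neg φ)   ρ≗σ s s′ = s (Sat-cong φ (sym ∘ ρ≗σ) s′)
    Sat-cong (φ ∧ ψ)   ρ≗σ (s , s′) = Sat-cong φ (ρ≗σ ∘ inj₁) s , Sat-cong ψ (ρ≗σ ∘ inj₂) s′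
    Sat-cong (φ ∨ ψ)   ρ≗σ = Sum.map (Sat-cong φ (ρ≗σ ∘ inj₁)) (Sat-cong ψ (ρ≗σ ∘ inj₂))
    Sat-cong (φ ⇒ ψ)   ρ≗σ s = Sat-cong ψ (ρ≗σ ∘ inj₂) ∘ s ∘ Sat-cong φ (sym ∘ ρ≗σ ∘ inj₁)
    Sat-cong (φ ⇔ ψ)   ρ≗σ (s , s′) =
      Sat-cong ψ (ρ≗σ ∘ inj₂) ∘ s ∘ Sat-cong φ (sym ∘ ρ≗σ ∘ inj₁) ,
      Sat-cong φ (ρ≗σ ∘ inj₁) ∘ s′ ∘ Sat-cong ψ (sym ∘ ρ≗σ ∘ inj₂)
    Sat-cong (quantify all x φ)  ρ≗σ s a = Sat-cong φ (update-cong {_∈FV φ} x a ρ≗σ) (s a)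
    Sat-cong (quantify some x φ) ρ≗σ (a , s) = a , Sat-cong φ (update-cong {_∈FV φ} x a ρ≗σ) s

    Sat-≗ : ∀ φ {ρ σ : Valuation 𝓜} → ρ ≗ σ → Sat 𝓜 ρ φ → Sat 𝓜 σ φ
    Sat-≗ φ ρ≗σ = Sat-cong φ (λ {x} _ → ρ≗σ x)

    ∃*-elim : ∀ x̄ {φ ρ} → Sat 𝓜 ρ (∃* x̄ φ) → Σ (Valuation 𝓜) λ σ → (∀ {z} → z ∉ x̄ → σ z ≡ ρ z) × Sat 𝓜 σ φ
    ∃*-elim []      {ρ = ρ} s = ρ , (λ _ → refl) , s
    ∃*-elim (x ∷ x̄) {ρ = ρ} (a , s) with ∃*-elim x̄ s
    ... | σ , σ≗ , t = σ , (λ {z} z∉ → trans (σ≗ (z∉ ∘ there)) (off z∉)) , t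
      where
      off : ∀ {z} → z ∉ x ∷ x̄ → (_[_↦_] 𝓜 ρ x a) z ≡ ρ z
      off {z} z∉ with z ≟ x
      ... | yes z≡x = ⊥-elim (z∉ (here z≡x))
      ... | no _    = refl

    ∃*-intro : ∀ x̄ {φ ρ} (σ : Valuation 𝓜) → (∀ {z} → z ∉ x̄ → σ z ≡ ρ z) → Sat 𝓜 σ φ → Sat 𝓜 ρ (∃* x̄ φ)
    ∃*-intro []      {φ} σ σ≗ s = Sat-≗ φ (λ x → σ≗ λ ()) s
    ∃*-intro (x ∷ x̄) {ρ = ρ} σ σ≗ s = σ x , ∃*-intro x̄ σ off s
      where
      off : ∀ {z} → z ∉ x̄ → σ z ≡ (_[_↦_] 𝓜 ρ x (σ x)) z
      off {z} z∉ with z ≟ x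
      ... | yes refl = refl
      ... | no z≢x   = σ≗ λ { (here z≡x) → z≢x z≡x ; (there z∈) → z∉ z∈ }

    -- A record rather than a bare function type: `Sat` computes on the formula, so only a wrapper
    -- lets `φ` be inferred while quantifiers are peeled off.
    record Valid (φ : Formula) : Set where
      constructor valid
      field holds : ∀ ρ → Sat 𝓜 ρ φ
    open Valid public

    ∀-elim : ∀ {x φ} → Valid (quantify all x φ) → Valid φ
    ∀-elim {x} {φ} (valid h) = valid λ ρ → Sat-≗ φ (same ρ) (h ρ (ρ x))
      where
      same : ∀ ρ → (_[_↦_] 𝓜 ρ x (ρ x)) ≗ ρ
      same ρ y with y ≟ x
      ... | yes refl = refl
      ... | no _     = refl

    ∀*-elim : ∀ x̄ {φ} → Valid (∀* x̄ φ) → Valid φ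
    ∀*-elim []      h = h
    ∀*-elim (x ∷ x̄) h = ∀*-elim x̄ (∀-elim h)

    ⋀-elim : ∀ {φs φ ρ} → Sat 𝓜 ρ (⋀ φs) → φ ∈ φs → Sat 𝓜 ρ φ
    ⋀-elim (s , _) (here refl) = s
    ⋀-elim (_ , s) (there φ∈)  = ⋀-elim s φ∈

    ⋀-intro : ∀ φs {ρ} → (∀ {φ} → φ ∈ φs → Sat 𝓜 ρ φ) → Sat 𝓜 ρ (⋀ φs)
    ⋀-intro []       h = _
    ⋀-intro (φ ∷ φs) h = h (here refl) , ⋀-intro φs (h ∘ there)

    evals-var : ∀ {n} ρ (x̄ : Vec Var n) → evals 𝓜 ρ (Vec.map var x̄) ≡ Vec.map ρ x̄
    evals-var ρ []      = refl
    evals-var ρ (x ∷ x̄) = cong (ρ x ∷_) (evals-var ρ x̄)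

    eval-apply : ∀ {f} ρ (x̄ : Vec Var (arity f)) → eval 𝓜 ρ (apply f x̄) ≡ fun f (Vec.map ρ x̄)
    eval-apply {f} ρ x̄ = cong (fun f) (evals-var ρ x̄)

    ≐*-elim : ∀ {n} ρ (x̄ ȳ : Vec Var n) → Sat 𝓜 ρ (x̄ ≐* ȳ) → Vec.map ρ x̄ ≡ Vec.map ρ ȳ
    ≐*-elim ρ []      []      s       = refl
    ≐*-elim ρ (x ∷ x̄) (y ∷ ȳ) (e , s) = cong₂ _∷_ e (≐*-elim ρ x̄ ȳ s)

  finiteVar : Var → Formula
  finiteVar x = finite (var x)

  mutual
    varsᵗ : Term → List Var
    varsᵗ (var x)    = x ∷ []
    varsᵗ (app f ts) = varsᵗ* ts

    varsᵗ* : ∀ {n} → Vec Term n → List Var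
    varsᵗ* []       = []
    varsᵗ* (t ∷ ts) = varsᵗ t ++ varsᵗ* ts

  mutual
    ∈ᵗ⇒∈varsᵗ : ∀ {x t} → x ∈ᵗ t → x ∈ varsᵗ t
    ∈ᵗ⇒∈varsᵗ here       = here refl
    ∈ᵗ⇒∈varsᵗ (there x∈) = ∈ᵗ*⇒∈varsᵗ* x∈

    ∈ᵗ*⇒∈varsᵗ* : ∀ {x n} {ts : Vec Term n} → VecAny.Any (x ∈ᵗ_) ts → x ∈ varsᵗ* ts
    ∈ᵗ*⇒∈varsᵗ* (VecAny.here x∈)            = ∈-++⁺ˡ (∈ᵗ⇒∈varsᵗ x∈)
    ∈ᵗ*⇒∈varsᵗ* {ts = t ∷ _} (VecAny.there x∈) = ∈-++⁺ʳ (varsᵗ t) (∈ᵗ*⇒∈varsᵗ* x∈)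

  vecParams : ∀ {A B : Set} {n} → Vec (A ⊎ B) n → List A
  vecParams []            = []
  vecParams (inj₁ a ∷ vs) = a ∷ vecParams vs
  vecParams (inj₂ _ ∷ vs) = vecParams vs

  -- Axiom [3] addresses its parameters by position in a vector of variables, so the elements
  -- occurring in a system are listed and replaced by their positions.
  indexParams : ∀ {A B : Set} {n} (ps : List A) (vs : Vec (A ⊎ B) n) → vecParams vs ⊆ ps →
    ∃ λ ws → Vec.map (Sum.map (List.lookup ps) id) ws ≡ vs
  indexParams ps []            _    = [] , refl
  indexParams ps (inj₁ a ∷ vs) sub with indexParams ps vs (sub ∘ there)
  ... | ws , e = inj₁ (Any.index (sub (here refl))) ∷ ws ,
    cong₂ _∷_ (cong inj₁ (sym (lookup-index (sub (here refl))))) e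
  indexParams ps (inj₂ b ∷ vs) sub with indexParams ps vs sub
  ... | ws , e = inj₂ b ∷ ws , cong (inj₂ b ∷_) e

  -- The axioms at arbitrary elements of a model

  module Axioms (𝓜 : Structure) (model : Model 𝓜) where
    open Structure 𝓜
    open Coincidence 𝓜

    private
      C = Carrier

    axiom-valid : ∀ {φ} → Axiom φ → Valid φ
    axiom-valid ax = valid (model ax)

    emptyArgs : ∀ {A : Set} {f} → arity f ≡ 0 → Vec A (arity f)
    emptyArgs e = subst (Vec _) (sym e) []

    point : C
    point = fun _ (emptyArgs (proj₂ someConstant))

    nthVar : ∀ {k} → Fin k → Var
    nthVar = Inverse.from countablyInfinite ∘ toℕ

    extend : ∀ {k} → (Fin k → C) → ℕ → C
    extend {zero}  a _       = point
    extend {suc k} a zero    = a zero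
    extend {suc k} a (suc n) = extend (a ∘ suc) n

    extend-toℕ : ∀ {k} (a : Fin k → C) i → extend a (toℕ i) ≡ a i
    extend-toℕ a zero    = refl
    extend-toℕ a (suc i) = extend-toℕ (a ∘ suc) i

    valuation : ∀ {k} → (Fin k → C) → Valuation 𝓜
    valuation a = extend a ∘ Inverse.to countablyInfinite

    valuation-nthVar : ∀ {k} (a : Fin k → C) i → valuation a (nthVar i) ≡ a i
    valuation-nthVar a i =
      trans (cong (extend a) (Inverse.strictlyInverseˡ countablyInfinite (toℕ i))) (extend-toℕ a i)

    nthVar-injective : ∀ {k} {i j : Fin k} → nthVar i ≡ nthVar j → i ≡ j
    nthVar-injective {i = i} {j} e = toℕ-injective (begin
      toℕ i                                              ≡⟨ Inverse.strictlyInverseˡ countablyInfinite (toℕ i) ⟨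
      Inverse.to countablyInfinite (nthVar i)          ≡⟨ cong (Inverse.to countablyInfinite) e ⟩
      Inverse.to countablyInfinite (nthVar j)          ≡⟨ Inverse.strictlyInverseˡ countablyInfinite (toℕ j) ⟩
      toℕ j                                              ∎)
      where open ≡-Reasoning

    map-tabulate : ∀ {A B : Set} {n} (ρ : A → B) (g : Fin n → A) (as : Vec B n) →
      (∀ i → ρ (g i) ≡ lookup as i) → Vec.map ρ (tabulate g) ≡ as
    map-tabulate ρ g as h =
      trans (sym (Vec.tabulate-∘ ρ g)) (trans (Vec.tabulate-cong h) (Vec.tabulate∘lookup as))

    -- The axioms quantify over variables. Placing `as` and `bs` on disjoint segments of the
    -- enumeration of `Var` instantiates them at arbitrary elements, whether or not some of these
    -- coincide.
    module Two {m n} (as : Vec C m) (bs : Vec C n) where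
      ρ : Valuation 𝓜
      ρ = valuation ([ lookup as , lookup bs ]′ ∘ splitAt m)

      x̄ : Vec Var m
      x̄ = tabulate (λ i → nthVar (i ↑ˡ n))

      ȳ : Vec Var n
      ȳ = tabulate (λ i → nthVar (m ↑ʳ i))

      ρx̄ : Vec.map ρ x̄ ≡ as
      ρx̄ = map-tabulate ρ _ as λ i → trans (valuation-nthVar _ (i ↑ˡ n))
        (cong [ lookup as , lookup bs ]′ (splitAt-↑ˡ m i n))

      ρȳ : Vec.map ρ ȳ ≡ bs
      ρȳ = map-tabulate ρ _ bs λ i → trans (valuation-nthVar _ (m ↑ʳ i))
        (cong [ lookup as , lookup bs ]′ (splitAt-↑ʳ m n i))

    fun-head : ∀ {f g} {as : Vec C (arity f)} {bs : Vec C (arity g)} → fun f as ≡ fun g bs → f ≡ g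
    fun-head {f} {g} {as} {bs} e with em {P = f ≡ g}
    ... | yes f≡g = f≡g
    ... | no f≢g  = ⊥-elim (holds (∀*-elim (toList ȳ) (∀*-elim (toList x̄) (axiom-valid (clash f≢g x̄ ȳ)))) ρ (begin
      eval 𝓜 ρ (apply f x̄) ≡⟨ eval-apply ρ x̄ ⟩
      fun f (Vec.map ρ x̄)  ≡⟨ cong (fun f) ρx̄ ⟩
      fun f as             ≡⟨ e ⟩
      fun g bs             ≡⟨ cong (fun g) ρȳ ⟨
      fun g (Vec.map ρ ȳ)  ≡⟨ eval-apply ρ ȳ ⟨
      eval 𝓜 ρ (apply g ȳ) ∎))
      where
      open ≡-Reasoning
      open Two as bs

    fun-injective : ∀ {f} {as bs : Vec C (arity f)} → fun f as ≡ fun f bs → as ≡ bs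
    fun-injective {f} {as} {bs} e = trans (sym ρx̄) (trans (≐*-elim ρ x̄ ȳ
      (holds (∀*-elim (toList ȳ) (∀*-elim (toList x̄) (axiom-valid (injective {f} x̄ ȳ)))) ρ (begin
      eval 𝓜 ρ (apply f x̄) ≡⟨ eval-apply ρ x̄ ⟩
      fun f (Vec.map ρ x̄)  ≡⟨ cong (fun f) ρx̄ ⟩
      fun f as             ≡⟨ e ⟩
      fun f bs             ≡⟨ cong (fun f) ρȳ ⟨
      fun f (Vec.map ρ ȳ)  ≡⟨ eval-apply ρ ȳ ⟨
      eval 𝓜 ρ (apply f ȳ) ∎))) ρȳ)
      where
      open ≡-Reasoning
      open Two as bs

    -- The systems of axiom [3] with carrier elements in place of the parameter variables: `inj₁` is
    -- a parameter, `inj₂` an unknown.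
    CarrierSystem : ℕ → Set
    CarrierSystem n = Fin n → Σ Sym λ f → Vec (C ⊎ Fin n) (arity f)

    Solves : ∀ {n} → CarrierSystem n → (Fin n → C) → Set
    Solves t b = ∀ i → b i ≡ fun (proj₁ (t i)) (Vec.map [ id , b ]′ (proj₂ (t i)))

    module UniqueSolution {n} (s : CarrierSystem n) where
      ps : List C
      ps = List.concatMap (vecParams ∘ proj₂ ∘ s) (List.allFin n)

      m = length ps

      indexed : ∀ i → _
      indexed i = indexParams ps (proj₂ (s i))
        (λ a∈ → ∈-concatMap⁺ (vecParams ∘ proj₂ ∘ s) (Any.map (λ { refl → a∈ }) (∈-allFin {n} i)))

      t : System m n
      t i = proj₁ (s i) , proj₁ (indexed i)

      -- The first `m + (n + n)` variables fall into three segments: the parameters, the unknowns,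
      -- and the second copy of the unknowns that expresses uniqueness.
      i₁ : Fin m → Fin (m + (n + n))
      i₁ i = i ↑ˡ (n + n)
      i₂ i₃ : Fin n → Fin (m + (n + n))
      i₂ i = m ↑ʳ (i ↑ˡ n)
      i₃ i = m ↑ʳ (n ↑ʳ i)

      i₁≢i₂₃ : ∀ {i j} → i₁ i ≢ m ↑ʳ j
      i₁≢i₂₃ {i} {j} e with trans (sym (splitAt-↑ˡ m i (n + n))) (trans (cong (splitAt m) e) (splitAt-↑ʳ m (n + n) j))
      ... | ()

      i₂≢i₃ : ∀ {i j} → i₂ i ≢ i₃ j
      i₂≢i₃ {i} {j} e with trans (sym (splitAt-↑ˡ n i n)) (trans (cong (splitAt n) (↑ʳ-injective m _ _ e)) (splitAt-↑ʳ n n j))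
      ... | ()

      x̄ : Vec Var m
      x̄ = tabulate (nthVar ∘ i₁)
      z̄ z̄′ : Vec Var n
      z̄  = tabulate (nthVar ∘ i₂)
      z̄′ = tabulate (nthVar ∘ i₃)

      ∈-tab : ∀ {k x} (g : Fin k → Var) → x ∈ toList (tabulate g) → ∃ λ i → x ≡ g i
      ∈-tab {zero}  g ()
      ∈-tab {suc k} g (here e)   = zero , e
      ∈-tab {suc k} g (there x∈) with ∈-tab (g ∘ suc) x∈
      ... | i , e = suc i , e

      toList-tabulate : ∀ {k} (g : Fin k → Var) → toList (tabulate g) ≡ List.tabulate g
      toList-tabulate {zero}  g = refl
      toList-tabulate {suc k} g = cong (g zero ∷_) (toList-tabulate (g ∘ suc))

      unique-tab : ∀ {k} (g : Fin k → Var) → (∀ {i j} → g i ≡ g j → i ≡ j) → Distinct (toList (tabulate g))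
      unique-tab g inj = subst Distinct (sym (toList-tabulate g)) (UniqueP.tabulate⁺ inj)

      distinct : Distinct (toList z̄ ++ toList z̄′)
      distinct = UniqueP.++⁺ {xs = toList z̄} {ys = toList z̄′}
        (unique-tab _ (λ e → ↑ˡ-injective n _ _ (↑ʳ-injective m _ _ (nthVar-injective e))))
        (unique-tab _ (λ e → ↑ʳ-injective n _ _ (↑ʳ-injective m _ _ (nthVar-injective e))))
        λ { (x∈ , x∈′) → let (i , e) = ∈-tab (nthVar ∘ i₂) x∈ ; (j , e′) = ∈-tab (nthVar ∘ i₃) x∈′
                         in i₂≢i₃ {i} {j} (nthVar-injective (trans (sym e) e′)) }

      fresh : ∀ {x} → x ∈ toList x̄ → x ∉ toList z̄ ++ toList z̄′
      fresh x∈ x∈′ with ∈-tab (nthVar ∘ i₁) x∈ | ∈-++⁻ (toList z̄) x∈′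
      ... | i , e | inj₁ x∈z with ∈-tab (nthVar ∘ i₂) x∈z
      ...   | j , e′ = i₁≢i₂₃ {i} (nthVar-injective (trans (sym e) e′))
      fresh x∈ x∈′ | i , e | inj₂ x∈z with ∈-tab (nthVar ∘ i₃) x∈z
      ...   | j , e′ = i₁≢i₂₃ {i} (nthVar-injective (trans (sym e) e′))

      axiom = ∀*-elim (toList x̄) (axiom-valid (uniqueSolution t x̄ z̄ z̄′ distinct fresh))

      args : ∀ ρ (w̄ : Vec Var n) b → (∀ i → ρ (lookup x̄ i) ≡ List.lookup ps i) → (∀ i → ρ (lookup w̄ i) ≡ b i) → ∀ i →
        eval 𝓜 ρ (apply (proj₁ (t i)) (Vec.map [ lookup x̄ , lookup w̄ ]′ (proj₂ (t i)))) ≡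
        fun (proj₁ (s i)) (Vec.map [ id , b ]′ (proj₂ (s i)))
      args ρ w̄ b ex ew i = trans (eval-apply ρ (Vec.map [ lookup x̄ , lookup w̄ ]′ (proj₂ (t i)))) (cong (fun (proj₁ (s i))) (begin
        Vec.map ρ (Vec.map [ lookup x̄ , lookup w̄ ]′ ws)          ≡⟨ Vec.map-∘ ρ _ ws ⟨
        Vec.map (ρ ∘ [ lookup x̄ , lookup w̄ ]′) ws               ≡⟨ Vec.map-cong (λ { (inj₁ j) → ex j ; (inj₂ j) → ew j }) ws ⟩
        Vec.map ([ id , b ]′ ∘ Sum.map (List.lookup ps) id) ws  ≡⟨ Vec.map-∘ [ id , b ]′ _ ws ⟩
        Vec.map [ id , b ]′ (Vec.map (Sum.map (List.lookup ps) id) ws) ≡⟨ cong (Vec.map [ id , b ]′) (proj₂ (indexed i)) ⟩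
        Vec.map [ id , b ]′ (proj₂ (s i)) ∎))
        where
        open ≡-Reasoning
        ws = proj₂ (t i)

      module Values (b b′ : Fin n → C) where
        values : Fin (m + (n + n)) → C
        values = [ List.lookup ps , [ b , b′ ]′ ∘ splitAt n ]′ ∘ splitAt m

        ρ : Valuation 𝓜
        ρ = valuation values

        ρx : ∀ i → ρ (lookup x̄ i) ≡ List.lookup ps i
        ρx i = trans (cong ρ (Vec.lookup∘tabulate (nthVar ∘ i₁) i)) (trans (valuation-nthVar values (i₁ i))
          (cong [ List.lookup ps , [ b , b′ ]′ ∘ splitAt n ]′ (splitAt-↑ˡ m i (n + n))))

        ρz : ∀ i → ρ (lookup z̄ i) ≡ b i
        ρz i = trans (cong ρ (Vec.lookup∘tabulate (nthVar ∘ i₂) i)) (trans (valuation-nthVar values (i₂ i))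
          (trans (cong [ List.lookup ps , [ b , b′ ]′ ∘ splitAt n ]′ (splitAt-↑ʳ m (n + n) (i ↑ˡ n)))
                 (cong [ b , b′ ]′ (splitAt-↑ˡ n i n))))

        ρz′ : ∀ i → ρ (lookup z̄′ i) ≡ b′ i
        ρz′ i = trans (cong ρ (Vec.lookup∘tabulate (nthVar ∘ i₃) i)) (trans (valuation-nthVar values (i₃ i))
          (trans (cong [ List.lookup ps , [ b , b′ ]′ ∘ splitAt n ]′ (splitAt-↑ʳ m (n + n) (n ↑ʳ i)))
                 (cong [ b , b′ ]′ (splitAt-↑ʳ n n i))))

      exists : ∃ (Solves s)
      -- Existence depends on the parameters only, so the values `point` given to both copies of the
      -- unknowns are arbitrary.
      exists with ∃*-elim (toList z̄) (proj₁ (holds axiom ρ)) where open Values (λ _ → point) (λ _ → point)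
      ... | σ , σ≗ , sat = σ ∘ lookup z̄ , λ i → trans
        (⋀-elim sat (∈-map⁺ _ (∈-allFin i))) (args σ z̄ _ σx (λ _ → refl) i)
        where
        open Values (λ _ → point) (λ _ → point)
        ∈x̄ : ∀ i → lookup x̄ i ∈ toList x̄
        ∈x̄ i = go x̄ i
          where
          go : ∀ {k} (v : Vec Var k) i → lookup v i ∈ toList v
          go (x ∷ v) zero    = here refl
          go (x ∷ v) (suc i) = there (go v i)
        σx : ∀ i → σ (lookup x̄ i) ≡ List.lookup ps i
        σx i = trans (σ≗ (λ x∈ → fresh (∈x̄ i) (∈-++⁺ˡ x∈))) (ρx i)

      unique : ∀ {b b′} → Solves s b → Solves s b′ → b ≗ b′
      unique {b} {b′} sol sol′ i = begin
        b i                          ≡⟨ ρz i ⟨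
        ρ (lookup z̄ i)               ≡⟨ Vec.lookup-map i ρ z̄ ⟨
        lookup (Vec.map ρ z̄) i       ≡⟨ cong (λ v → lookup v i) (≐*-elim ρ z̄ z̄′
          (holds (∀*-elim (toList z̄′) (∀*-elim (toList z̄) (valid (proj₂ ∘ holds axiom)))) ρ
            (satisfied z̄ ρz sol , satisfied z̄′ ρz′ sol′))) ⟩
        lookup (Vec.map ρ z̄′) i      ≡⟨ Vec.lookup-map i ρ z̄′ ⟩
        ρ (lookup z̄′ i)              ≡⟨ ρz′ i ⟩
        b′ i                         ∎
        where
        open ≡-Reasoning
        open Values b b′
        satisfied : ∀ (w̄ : Vec Var n) {c} → (∀ i → ρ (lookup w̄ i) ≡ c i) → Solves s c → Sat 𝓜 ρ (⟪ t ⟫ x̄ w̄)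
        satisfied w̄ {c} ew solc = ⋀-intro _ λ φ∈ → one (∈-map⁻ _ φ∈)
          where
          one : ∀ {φ} → (∃ λ i → i ∈ List.allFin n × φ ≡ _) → Sat 𝓜 ρ φ
          one (i , _ , refl) = trans (ew i) (trans (solc i) (sym (args ρ w̄ c ρx ew i)))

    abstract
      solution-exists : ∀ {n} (s : CarrierSystem n) → ∃ (Solves s)
      solution-exists = UniqueSolution.exists

      solution-unique : ∀ {n} (s : CarrierSystem n) {b b′} → Solves s b → Solves s b′ → b ≗ b′
      solution-unique = UniqueSolution.unique

    cyclic⇒¬finite : ∀ (ρ : Valuation 𝓜) {u f} {ts : Vec Term (arity f)} → u ∈ᵗ app f ts →
      ρ u ≡ eval 𝓜 ρ (app f ts) → ¬ Finite (ρ u)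
    cyclic⇒¬finite ρ {u} {f} {ts} u∈ e fin =
      -- Taking all variables of the term as the quantified vector settles the side condition of
      -- axiom [4]; `u` may well be among them.
      holds (∀-elim (∀*-elim (varsᵗ (app f ts)) (axiom-valid (acyclic _ u ts u∈ (inj₂ ∘ ∈ᵗ⇒∈varsᵗ))))) ρ (e , fin)

    module Finiteness {f} (as : Vec C (arity f)) where
      open Two as (fun f as ∷ [])

      u = Vec.head ȳ

      ρu : ρ u ≡ fun f as
      ρu = cong Vec.head ρȳ

      axiom = holds (∀-elim (∀*-elim (toList x̄) (axiom-valid (finiteness {f} x̄ u)))) ρ

      u≐ : ρ u ≡ eval 𝓜 ρ (apply f x̄)
      u≐ = trans ρu (sym (trans (eval-apply ρ x̄) (cong (fun f) ρx̄)))

      allFinite⁺ : ∀ {n} (x̄ : Vec Var n) → (∀ i → Finite (lookup (Vec.map ρ x̄) i)) → Sat 𝓜 ρ (⋀ (List.map finiteVar (toList x̄)))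
      allFinite⁺ []      h = _
      allFinite⁺ (x ∷ x̄) h = h zero , allFinite⁺ x̄ (h ∘ suc)

      allFinite⁻ : ∀ {n} (x̄ : Vec Var n) → Sat 𝓜 ρ (⋀ (List.map finiteVar (toList x̄))) → ∀ i → Finite (lookup (Vec.map ρ x̄) i)
      allFinite⁻ (x ∷ x̄) (s , _) zero    = s
      allFinite⁻ (x ∷ x̄) (_ , s) (suc i) = allFinite⁻ x̄ s i

    finite-fun⁺ : ∀ {f} {as : Vec C (arity f)} → (∀ i → Finite (lookup as i)) → Finite (fun f as)
    finite-fun⁺ {f} {as} h = subst Finite ρu (proj₂ (proj₂ axiom
      (u≐ , allFinite⁺ x̄ (λ i → subst (λ v → Finite (lookup v i)) (sym ρx̄) (h i)))))
      where
      open Two as (fun f as ∷ [])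
      open Finiteness {f} as

    finite-fun⁻ : ∀ {f} {as : Vec C (arity f)} → Finite (fun f as) → ∀ i → Finite (lookup as i)
    finite-fun⁻ {f} {as} h i = subst (λ v → Finite (lookup v i)) ρx̄
      (allFinite⁻ x̄ (proj₂ (proj₁ axiom (u≐ , subst Finite (sym ρu) h))) i)
      where
      open Two as (fun f as ∷ [])
      open Finiteness {f} as

    infix 4 _▷_

    _▷_ : C → C → Set
    a ▷ b = ∃ λ f → Σ (Vec C (arity f)) λ as → a ≡ fun f as × ∃ λ i → b ≡ lookup as i

    -- A chain of immediate subtrees is realised by a single term, under any
    -- valuation whose range contains the siblings met along the chain.
    module Chains where
      Covers : Valuation 𝓜 → List C → Set
      Covers ρ cs = ∀ {c} → c ∈ cs → ∃ λ x → ρ x ≡ c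

      embed : ∀ {n} (ρ : Valuation 𝓜) {u t} (as : Vec C n) i → Covers ρ (toList as) →
        eval 𝓜 ρ t ≡ lookup as i → u ∈ᵗ t →
        Σ (Vec Term n) λ ts → evals 𝓜 ρ ts ≡ as × VecAny.Any (u ∈ᵗ_) ts
      embed ρ {t = t} (a ∷ as) zero cov e u∈ = t ∷ others as (cov ∘ there) .proj₁ ,
        cong₂ _∷_ e (others as (cov ∘ there) .proj₂) , VecAny.here u∈
        where
        others : ∀ {n} (as : Vec C n) → Covers ρ (toList as) → Σ (Vec Term n) λ ts → evals 𝓜 ρ ts ≡ as
        others []       cov = [] , refl
        others (a ∷ as) cov with cov (here refl) | others as (cov ∘ there)
        ... | x , e | ts , es = var x ∷ ts , cong₂ _∷_ e es
      embed ρ (a ∷ as) (suc i) cov e u∈ with cov (here refl) | embed ρ as i (cov ∘ there) e u∈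
      ... | x , e′ | ts , es , u∈ts = var x ∷ ts , cong₂ _∷_ e′ es , VecAny.there u∈ts

      realise : ∀ {a b} → TransClosure _▷_ a b → ∃ λ cs → ∀ (ρ : Valuation 𝓜) {u} → Covers ρ cs → ρ u ≡ b →
        ∃ λ f → Σ (Vec Term (arity f)) λ ts → u ∈ᵗ app f ts × a ≡ eval 𝓜 ρ (app f ts)
      realise [ f , as , refl , i , refl ] = toList as , λ ρ cov ρu →
        let (ts , es , u∈) = embed ρ as i cov ρu here in f , ts , there u∈ , cong (fun f) (sym es)
      realise ((f , as , refl , i , refl) ∷ rest) with realise rest
      ... | cs , real = toList as ++ cs , λ ρ cov ρu →
        let (g , us , u∈ , e) = real ρ (cov ∘ ∈-++⁺ʳ (toList as)) ρu
            (ts , es , u∈ts)  = embed ρ {t = app g us} as i (cov ∘ ∈-++⁺ˡ) (sym e) u∈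
        in f , ts , there u∈ts , cong (fun f) (sym es)

    -- Axiom [4] forbids cycles one term at a time, so the chain is first condensed into a single
    -- term containing a variable whose value is `a`.
    cycle⇒¬finite : ∀ {a} → TransClosure _▷_ a a → ¬ Finite a
    cycle⇒¬finite {a} chain fin with Chains.realise chain
    ... | cs , real = cyclic⇒¬finite ρ {ts = ts} u∈ (trans ρu e) (subst Finite (sym ρu) fin)
      where
      open Chains
      -- Variable 0 carries `a`, the following ones carry the siblings met along the chain.
      ρ = valuation (List.lookup (a ∷ cs))
      ρu : ρ (nthVar {suc (length cs)} zero) ≡ a
      ρu = valuation-nthVar (List.lookup (a ∷ cs)) zero
      cov : Covers ρ cs
      cov c∈ = nthVar (Any.index (there {x = a} c∈)) ,
        trans (valuation-nthVar (List.lookup (a ∷ cs)) _) (sym (lookup-index (there {x = a} c∈)))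
      f = real ρ cov ρu .proj₁
      ts = real ρ cov ρu .proj₂ .proj₁
      u∈ = real ρ cov ρu .proj₂ .proj₂ .proj₁
      e = real ρ cov ρu .proj₂ .proj₂ .proj₂

    point-finite : Finite point
    point-finite = finite-fun⁺ λ i → ⊥-elim (noArgs (proj₂ someConstant) i)
      where
      noArgs : ∀ {n} → n ≡ 0 → ¬ Fin n
      noArgs refl ()

  -- Congruence closure of a system of flat constraints

  -- Selects a canonical index. By `first-cong` it depends on `P` only up to equivalence, so that
  -- related nodes later obtain the same one.
  first : ∀ {n} → (Fin n → Set) → Maybe (Fin n)
  first {zero}  P = nothing
  first {suc n} P with em {P = P zero}
  ... | yes _ = just zero
  ... | no _  = Maybe.map suc (first (P ∘ suc))

  first-cong : ∀ {n} {P Q : Fin n → Set} → (∀ {i} → P i → Q i) → (∀ {i} → Q i → P i) → first P ≡ first Q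
  first-cong {zero}              P⇒Q Q⇒P = refl
  first-cong {suc n} {P} {Q} P⇒Q Q⇒P with em {P = P zero} | em {P = Q zero}
  ... | yes p | yes q = refl
  ... | yes p | no ¬q = ⊥-elim (¬q (P⇒Q p))
  ... | no ¬p | yes q = ⊥-elim (¬p (Q⇒P q))
  ... | no ¬p | no ¬q = cong (Maybe.map suc) (first-cong P⇒Q Q⇒P)

  data First {n} (P : Fin n → Set) : Maybe (Fin n) → Set where
    found : ∀ {i} → P i → First P (just i)
    none  : (∀ i → ¬ P i) → First P nothing

  first-view : ∀ {n} (P : Fin n → Set) → First P (first P)
  first-view {zero}  P = none λ ()
  first-view {suc n} P with em {P = P zero}
  ... | yes p = found p
  ... | no ¬p with first (P ∘ suc) | first-view (P ∘ suc)
  ...   | just i  | found q = found q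
  ...   | nothing | none ¬q = none λ { zero → ¬p ; (suc i) → ¬q i }

  Application : Set → Set
  Application N = Σ Sym λ f → Vec N (arity f)

  infix 5 _≃_ _≔_

  data Constraint (N : Set) : Set where
    _≃_ : N → N → Constraint N
    _≔_ : N → Application N → Constraint N
    fin : N → Constraint N

  Constraints : Set → Set
  Constraints N = List (Constraint N)

  equationsOf : ∀ {N} → Constraints N → List (N × Application N)
  equationsOf []            = []
  equationsOf ((x ≔ a) ∷ γ) = (x , a) ∷ equationsOf γ
  equationsOf ((_ ≃ _) ∷ γ) = equationsOf γ
  equationsOf (fin _ ∷ γ)   = equationsOf γ

  equationsOf⁺ : ∀ {N} {γ : Constraints N} {x a} → (x ≔ a) ∈ γ → (x , a) ∈ equationsOf γ
  equationsOf⁺ (here refl) = here refl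
  equationsOf⁺ {γ = (_ ≔ _) ∷ _} (there e) = there (equationsOf⁺ e)
  equationsOf⁺ {γ = (_ ≃ _) ∷ _} (there e) = equationsOf⁺ e
  equationsOf⁺ {γ = fin _ ∷ _}   (there e) = equationsOf⁺ e

  equationsOf⁻ : ∀ {N} (γ : Constraints N) {x a} → (x , a) ∈ equationsOf γ → (x ≔ a) ∈ γ
  equationsOf⁻ ((x ≔ a) ∷ γ) (here refl) = here refl
  equationsOf⁻ ((x ≔ a) ∷ γ) (there e)   = there (equationsOf⁻ γ e)
  equationsOf⁻ ((_ ≃ _) ∷ γ) e           = there (equationsOf⁻ γ e)
  equationsOf⁻ (fin _ ∷ γ) e             = there (equationsOf⁻ γ e)

  module Closure {N : Set} (γ : Constraints N) where

    infix 4 _~_ _⇝_ _⇝⁺_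

    -- The closure of unification: by injectivity equality descends from applications to their
    -- arguments, but it never climbs back. Equalities that hold only by uniqueness, as for
    -- `x = f(x)` and `y = f(y)`, stay underivable and are recovered semantically.
    data _~_ : N → N → Set where
      base  : ∀ {x y} → (x ≃ y) ∈ γ → x ~ y
      ~refl  : ∀ {x} → x ~ x
      ~sym   : ∀ {x y} → x ~ y → y ~ x
      ~trans : ∀ {x y z} → x ~ y → y ~ z → x ~ z
      arg   : ∀ {x y f xs ys} → x ~ y → (x ≔ (f , xs)) ∈ γ → (y ≔ (f , ys)) ∈ γ →
              ∀ i → lookup xs i ~ lookup ys i

    -- Finiteness likewise only descends, following axiom [5]. That it climbs back in a solution is
    -- proved in `Extension`, along an acyclic order.
    data Fin* : N → Set where
      base : ∀ {x} → fin x ∈ γ → Fin* x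
      cong* : ∀ {x y} → Fin* x → x ~ y → Fin* y
      arg  : ∀ {x f xs} → Fin* x → (x ≔ (f , xs)) ∈ γ → ∀ i → Fin* (lookup xs i)

    _⇝_ : N → N → Set
    z ⇝ z′ = ∃ λ x → ∃ λ a → z ~ x × (x ≔ a) ∈ γ × ∃ λ i → z′ ~ lookup (proj₂ a) i

    _⇝⁺_ : N → N → Set
    _⇝⁺_ = TransClosure _⇝_

    Fun : N → Set
    Fun z = ∃ λ x → ∃ λ a → z ~ x × (x ≔ a) ∈ γ

    -- These turn out to be the only obstructions to a solution. Cycles are excluded just at nodes
    -- that must be finite, since elsewhere they denote infinite trees.
    record Consistent : Set where
      field
        noClash : ∀ {x y f g xs ys} → x ~ y → (x ≔ (f , xs)) ∈ γ → (y ≔ (g , ys)) ∈ γ → f ≡ g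
        noCycle : ∀ {z} → Fin* z → ¬ (z ⇝⁺ z)

    -- The nodes whose value is forced by the values on `K` through equality and injectivity alone.
    data Reached (K : N → Set) : N → Set where
      start : ∀ {z} → K z → Reached K z
      along : ∀ {z z′} → Reached K z → z ~ z′ → Reached K z′
      down  : ∀ {z z′} → Reached K z → z ⇝ z′ → Reached K z′

    Fun-resp : ∀ {x y} → x ~ y → Fun x → Fun y
    Fun-resp x~y (z , a , x~z , z∈) = z , a , ~trans (~sym x~y) x~z , z∈

  -- Solutions of constraints in a model

  module Solutions (𝓜 : Structure) (model : Model 𝓜) where
    open Structure 𝓜
    open Axioms 𝓜 model

    infix 4 _⊨ₐ_ _⊨_

    _⊨ₐ_ : ∀ {N} → (N → Carrier) → Constraint N → Set
    v ⊨ₐ (x ≃ y)        = v x ≡ v y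
    v ⊨ₐ (x ≔ (f , xs)) = v x ≡ fun f (Vec.map v xs)
    v ⊨ₐ fin x          = Finite (v x)

    _⊨_ : ∀ {N} → (N → Carrier) → Constraints N → Set
    v ⊨ γ = All (v ⊨ₐ_) γ

    ⊨-⊆ : ∀ {N} {v : N → Carrier} {α γ} → α ⊆ γ → v ⊨ γ → v ⊨ α
    ⊨-⊆ α⊆γ v⊨γ = All.tabulate (All.lookup v⊨γ ∘ α⊆γ)

    lookup-cong : ∀ {N : Set} {n} {v w : N → Carrier} (xs ys : Vec N n) → Vec.map v xs ≡ Vec.map w ys →
      ∀ i → v (lookup xs i) ≡ w (lookup ys i)
    lookup-cong {v = v} {w} xs ys e i =
      trans (sym (Vec.lookup-map i v xs)) (trans (cong (λ as → lookup as i) e) (Vec.lookup-map i w ys))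

    map-≡ : ∀ {N : Set} {n} {v w : N → Carrier} (xs ys : Vec N n) →
      (∀ i → v (lookup xs i) ≡ w (lookup ys i)) → Vec.map v xs ≡ Vec.map w ys
    map-≡ []       []       h = refl
    map-≡ (x ∷ xs) (y ∷ ys) h = cong₂ _∷_ (h zero) (map-≡ xs ys (h ∘ suc))

    module Soundness {N : Set} {γ : Constraints N} {v : N → Carrier} (v⊨γ : v ⊨ γ) where
      open Closure γ

      ~-sound : ∀ {x y} → x ~ y → v x ≡ v y
      ~-sound (base e)       = All.lookup v⊨γ e
      ~-sound ~refl           = refl
      ~-sound (~sym e)        = sym (~-sound e)
      ~-sound (~trans d e)    = trans (~-sound d) (~-sound e)
      ~-sound (arg {xs = xs} {ys} e x∈ y∈ i) = lookup-cong xs ys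
        (fun-injective (trans (sym (All.lookup v⊨γ x∈)) (trans (~-sound e) (All.lookup v⊨γ y∈)))) i

      value : ∀ {x y a} → x ~ y → (y ≔ a) ∈ γ → v x ≡ fun (proj₁ a) (Vec.map v (proj₂ a))
      value e y∈ = trans (~-sound e) (All.lookup v⊨γ y∈)

      Fin*-sound : ∀ {x} → Fin* x → Finite (v x)
      Fin*-sound (base x∈)    = All.lookup v⊨γ x∈
      Fin*-sound (cong* φ e)   = subst Finite (~-sound e) (Fin*-sound φ)
      Fin*-sound (arg {xs = xs} φ x∈ i) = subst Finite (Vec.lookup-map i v xs)
        (finite-fun⁻ (subst Finite (All.lookup v⊨γ x∈) (Fin*-sound φ)) i)

      ⇝-sound : ∀ {x y} → x ⇝ y → v x ▷ v y
      ⇝-sound (z , (f , xs) , x~z , z∈ , i , y~) =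
        f , Vec.map v xs , value x~z z∈ , i , trans (~-sound y~) (sym (Vec.lookup-map i v xs))

      ⇝⁺-sound : ∀ {x y} → x ⇝⁺ y → TransClosure _▷_ (v x) (v y)
      ⇝⁺-sound [ s ]    = [ ⇝-sound s ]
      ⇝⁺-sound (s ∷ ss) = ⇝-sound s ∷ ⇝⁺-sound ss

      consistent : Consistent
      consistent = record
        { noClash = λ e x∈ y∈ → fun-head (trans (sym (value ~refl x∈)) (value e y∈))
        ; noCycle = λ φ c → cycle⇒¬finite (⇝⁺-sound c) (Fin*-sound φ)
        }

    open Soundness public using (consistent)

    agree-reached : ∀ {N : Set} {γ : Constraints N} {v w : N → Carrier} (K : N → Set) → v ⊨ γ → w ⊨ γ →
      (∀ {z} → K z → v z ≡ w z) → ∀ {z} → Closure.Reached γ K z → v z ≡ w z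
    agree-reached {γ = γ} {v} {w} K v⊨γ w⊨γ eq = go
      where
      open Closure γ
      module V = Soundness v⊨γ
      module W = Soundness w⊨γ
      go : ∀ {z} → Reached K z → v z ≡ w z
      go (start Kz)   = eq Kz
      go (along r e)  = trans (sym (V.~-sound e)) (trans (go r) (W.~-sound e))
      go (down r (x , (f , xs) , z~x , x∈ , i , e)) = trans (V.~-sound e) (trans
        (lookup-cong xs xs (fun-injective (trans (sym (V.value z~x x∈)) (trans (go r) (W.value z~x x∈)))) i)
        (sym (W.~-sound e)))

    -- Both valuations solve one common system with an unknown for each equation of `Φ`. An argument
    -- on which they agree enters as a parameter; any other enters as the unknown of a left-hand
    -- side that has its value under both. Then uniqueness in axiom [3] applies.
    unique-equations : ∀ {N : Set} {v w : N → Carrier} (Φ : List (N × Application N)) →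
      (∀ {x f xs} → (x , f , xs) ∈ Φ → v x ≡ fun f (Vec.map v xs)) →
      (∀ {x f xs} → (x , f , xs) ∈ Φ → w x ≡ fun f (Vec.map w xs)) →
      (∀ {x f xs} → (x , f , xs) ∈ Φ → ∀ i → v (lookup xs i) ≡ w (lookup xs i) ⊎
        ∃ λ y → (∃ λ a → (y , a) ∈ Φ) × v (lookup xs i) ≡ v y × w (lookup xs i) ≡ w y) →
      ∀ {y a} → (y , a) ∈ Φ → v y ≡ w y
    unique-equations {N} {v} {w} Φ solv solw link y∈ =
      trans (cong (v ∘ proj₁) (lookup-index y∈)) (trans
        (solution-unique system (solves (inj₁ refl) solv) (solves (inj₂ refl) solw) (Any.index y∈))
        (cong (w ∘ proj₁) (sym (lookup-index y∈))))
      where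
      equation : Fin (length Φ) → N × Application N
      equation = List.lookup Φ
      entry : ∀ {c d : Carrier} → (c ≡ d ⊎ ∃ λ y → (∃ λ a → (y , a) ∈ Φ) × c ≡ v y × d ≡ w y) → Carrier ⊎ Fin (length Φ)
      entry {c} (inj₁ _)                = inj₁ c
      entry (inj₂ (_ , (_ , y∈) , _)) = inj₂ (Any.index y∈)
      system : CarrierSystem (length Φ)
      system j = proj₁ (proj₂ (equation j)) , tabulate (λ i → entry (link (∈-lookup j) i))
      entry-value : ∀ {u : N → Carrier} {z} → u ≡ v ⊎ u ≡ w →
        (l : v z ≡ w z ⊎ ∃ λ y → (∃ λ a → (y , a) ∈ Φ) × v z ≡ v y × w z ≡ w y) →
        [ id , u ∘ proj₁ ∘ equation ]′ (entry l) ≡ u z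
      entry-value (inj₁ refl) (inj₁ _) = refl
      entry-value (inj₂ refl) (inj₁ e) = e
      entry-value (inj₁ refl) (inj₂ (_ , (_ , y∈) , e , _)) = trans (cong (v ∘ proj₁) (sym (lookup-index y∈))) (sym e)
      entry-value (inj₂ refl) (inj₂ (_ , (_ , y∈) , _ , e)) = trans (cong (w ∘ proj₁) (sym (lookup-index y∈))) (sym e)
      solves : ∀ {u} → u ≡ v ⊎ u ≡ w → (∀ {x f xs} → (x , f , xs) ∈ Φ → u x ≡ fun f (Vec.map u xs)) →
        Solves system (u ∘ proj₁ ∘ equation)
      solves {u} u≡ solu j = trans (solu (∈-lookup j)) (cong (fun _) (sym (map-tabulate _ _ _ λ i →
        trans (entry-value u≡ (link (∈-lookup j) i)) (sym (Vec.lookup-map i u (proj₂ (proj₂ (equation j))))))))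

    -- The equations within `S` may be cyclic, so agreement cannot be carried upwards from the
    -- leaves by induction. Instead all equations whose left-hand side lies in `S` are compared at
    -- once.
    agree-determined : ∀ {N : Set} {γ : Constraints N} {v w : N → Carrier} (S : N → Set) → let open Closure γ in
      v ⊨ γ → w ⊨ γ → (∀ {x y} → S x → x ~ y → S y) → (∀ {x y} → S x → x ⇝ y → S y) →
      (∀ {z} → S z → ¬ Fun z → v z ≡ w z) → ∀ {z} → S z → v z ≡ w z
    agree-determined {N} {γ} {v} {w} S v⊨γ w⊨γ S~ S⇝ eq {z} Sz with em {P = Closure.Fun γ z}
    ... | no ¬fun = eq Sz ¬fun
    ... | yes (x , a , z~x , x∈) = trans (V.~-sound z~x) (trans (unique-equations Φ
          (All.lookup v⊨γ ∘ Φ⊆) (All.lookup w⊨γ ∘ Φ⊆)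
          (λ e∈ i → link (S⇝ (Φ⇒S e∈) (_ , _ , ~refl , Φ⊆ e∈ , i , ~refl)))
          (∈Φ (S~ Sz z~x) x∈)) (sym (W.~-sound z~x)))
      where
      open Closure γ
      module V = Soundness v⊨γ
      module W = Soundness w⊨γ
      Φ : List (N × Application N)
      Φ = filter (λ e → em {P = S (proj₁ e)}) (equationsOf γ)
      Φ⊆ : ∀ {x a} → (x , a) ∈ Φ → (x ≔ a) ∈ γ
      Φ⊆ e∈ = equationsOf⁻ γ (proj₁ (∈-filter⁻ (λ e → em {P = S (proj₁ e)}) e∈))
      Φ⇒S : ∀ {x a} → (x , a) ∈ Φ → S x
      Φ⇒S e∈ = proj₂ (∈-filter⁻ (λ e → em {P = S (proj₁ e)}) {xs = equationsOf γ} e∈)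
      ∈Φ : ∀ {x a} → S x → (x ≔ a) ∈ γ → (x , a) ∈ Φ
      ∈Φ Sx x∈ = ∈-filter⁺ (λ e → em {P = S (proj₁ e)}) (equationsOf⁺ x∈) Sx
      link : ∀ {z} → S z → v z ≡ w z ⊎ ∃ λ y → (∃ λ a → (y , a) ∈ Φ) × v z ≡ v y × w z ≡ w y
      link {z} Sz with em {P = Fun z}
      ... | no ¬fun = inj₁ (eq Sz ¬fun)
      ... | yes (y , a , z~y , y∈) = inj₂ (y , (a , ∈Φ (S~ Sz z~y) y∈) , V.~-sound z~y , W.~-sound z~y)

    -- Each equation becomes an unknown, and a class with a symbol takes the value of the first
    -- equation whose left-hand side belongs to it. `noClash`, together with the closure of `_~_`
    -- under arguments, makes the other equations of the class hold too. All remaining classes take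
    -- their values from `q`.
    module Extension {N : Set} {γ : Constraints N} (cons : Closure.Consistent γ) (q : N → Carrier)
      (q-resp : ∀ {x y} → Closure._~_ γ x y → ¬ Closure.Fun γ x → q x ≡ q y)
      (q-fin : ∀ {x} → Closure.Fin* γ x → ¬ Closure.Fun γ x → Finite (q x)) where

      open Closure γ
      open Consistent cons

      Φ = equationsOf γ
      n = length Φ

      lhs : Fin n → N
      lhs j = proj₁ (List.lookup Φ j)

      rhs : Fin n → Application N
      rhs j = proj₂ (List.lookup Φ j)

      Φ∋ : ∀ j → (lhs j ≔ rhs j) ∈ γ
      Φ∋ j = equationsOf⁻ γ (∈-lookup j)

      index : N → Maybe (Fin n)
      index z = first (λ j → z ~ lhs j)

      extend-by : (Fin n → Carrier) → N → Carrier
      extend-by b z = maybe′ b (q z) (index z)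

      system : CarrierSystem n
      system j = proj₁ (rhs j) , Vec.map (λ z → maybe′ inj₂ (inj₁ (q z)) (index z)) (proj₂ (rhs j))

      b : Fin n → Carrier
      b = proj₁ (solution-exists system)

      v : N → Carrier
      v = extend-by b

      b-equation : ∀ j → b j ≡ fun (proj₁ (rhs j)) (Vec.map v (proj₂ (rhs j)))
      b-equation j = trans (proj₂ (solution-exists system) j) (cong (fun _)
        (trans (sym (Vec.map-∘ _ _ (proj₂ (rhs j)))) (Vec.map-cong same (proj₂ (rhs j)))))
        where
        same : ∀ z → [ id , b ]′ (maybe′ inj₂ (inj₁ (q z)) (index z)) ≡ v z
        same z with index z
        ... | just i  = refl
        ... | nothing = refl

      Fun⇒index : ∀ {x a z} → z ~ x → (x ≔ a) ∈ γ → ∃ λ j → index z ≡ just j × z ~ lhs j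
      Fun⇒index {x} {a} {z} z~x x∈ with index z | first-view (λ j → z ~ lhs j)
      ... | just j  | found z~ = j , refl , z~
      ... | nothing | none ¬z~ = ⊥-elim (¬z~ (Any.index (equationsOf⁺ x∈))
                                   (subst (λ e → z ~ proj₁ e) (lookup-index (equationsOf⁺ x∈)) z~x))

      index-cong : ∀ {x y} → x ~ y → index x ≡ index y
      index-cong x~y = first-cong (~trans (~sym x~y)) (~trans x~y)

      v-resp : ∀ {x y} → x ~ y → v x ≡ v y
      v-resp {x} {y} x~y with index x | index y | index-cong x~y | first-view (λ j → x ~ lhs j)
      ... | just _  | _ | refl | _ = refl
      ... | nothing | _ | refl | none ¬x~ =
        q-resp x~y λ { (z , a , x~z , z∈) →
          ¬x~ (Any.index (equationsOf⁺ z∈)) (subst (λ e → x ~ proj₁ e) (lookup-index (equationsOf⁺ z∈)) x~z) }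

      v-nonfun : ∀ {z} → ¬ Fun z → v z ≡ q z
      v-nonfun {z} ¬fun with index z | first-view (λ j → z ~ lhs j)
      ... | just j  | found z~ = ⊥-elim (¬fun (lhs j , rhs j , z~ , Φ∋ j))
      ... | nothing | _ = refl

      v-fun : ∀ {x f xs} → (x ≔ (f , xs)) ∈ γ → v x ≡ fun f (Vec.map v xs)
      v-fun {x} {f} {xs} x∈ with Fun⇒index ~refl x∈
      ... | j , e , x~ = trans (cong (maybe′ b (q x)) e) (trans (b-equation j) (align (rhs j) (Φ∋ j)))
        where
        align : ∀ a → (lhs j ≔ a) ∈ γ → fun (proj₁ a) (Vec.map v (proj₂ a)) ≡ fun f (Vec.map v xs)
        align (g , ys) y∈ with noClash x~ x∈ y∈
        ... | refl = cong (fun f) (map-≡ ys xs λ i → v-resp (~sym (arg x~ x∈ y∈ i)))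

      -- Finiteness is established from the arguments upwards. `noCycle` makes this relation
      -- irreflexive, and a strict order on finitely many equations is well-founded.
      _⊏_ : Fin n → Fin n → Set
      i ⊏ j = Fin* (lhs j) × lhs j ⇝⁺ lhs i

      ⊏-isStrictPartialOrder : IsStrictPartialOrder _≡_ _⊏_
      ⊏-isStrictPartialOrder = record
        { isEquivalence = isEquivalence
        ; irrefl        = λ { refl (φ , c) → noCycle φ c }
        ; trans         = λ { (_ , c) (φ , d) → φ , d Plus.++ c }
        ; <-resp-≈      = (λ { refl s → s }) , λ { refl s → s }
        }

      v-fin : ∀ {z} → Fin* z → Finite (v z)
      v-fin′ : ∀ {j} → Acc _⊏_ j → Fin* (lhs j) → Finite (v (lhs j))

      v-fin {z} φ with em {P = Fun z}
      ... | no ¬fun = subst Finite (sym (v-nonfun ¬fun)) (q-fin φ ¬fun)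
      ... | yes (x , a , z~x , x∈) with Fun⇒index z~x x∈
      ...   | j , _ , z~ = subst Finite (sym (v-resp z~)) (v-fin′ (spo-wellFounded ⊏-isStrictPartialOrder j) (cong* φ z~))

      v-fin′ {j} (acc rec) φ = subst Finite (sym (v-fun (Φ∋ j))) (finite-fun⁺ λ i →
          subst Finite (sym (Vec.lookup-map i v (proj₂ (rhs j)))) (go i))
        where
        go : ∀ i → Finite (v (lookup (proj₂ (rhs j)) i))
        go i with em {P = Fun (lookup (proj₂ (rhs j)) i)}
        ... | no ¬fun = subst Finite (sym (v-nonfun ¬fun)) (q-fin (arg φ (Φ∋ j) i) ¬fun)
        ... | yes (x , a , z~x , x∈) with Fun⇒index z~x x∈
        ...   | k , _ , z~ = subst Finite (sym (v-resp z~)) (v-fin′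
                  (rec (φ , [ (_ , _ , ~refl , Φ∋ j , i , ~sym z~) ])) (cong* (arg φ (Φ∋ j) i) z~))

      v⊨γ : v ⊨ γ
      v⊨γ = All.tabulate holds-at
        where
        holds-at : ∀ {a} → a ∈ γ → v ⊨ₐ a
        holds-at {x ≃ y} e       = v-resp (base e)
        holds-at {x ≔ (f , xs)} e = v-fun e
        holds-at {fin x} e       = v-fin (base e)

  -- Eliminating an existential quantifier

  -- `K` holds the nodes that stay free, `KX` those shared by `α` and its exceptions; whatever lies
  -- outside `KX` belongs to an exception alone.
  module Elimination {N : Set} (K KX : N → Set) (K⊆KX : ∀ {z} → K z → KX z) (α : Constraints N) where

    private
      module α = Closure α

    Known : N → Set
    Known = α.Reached K

    -- The nodes in scope whose value α leaves open once those of K are fixed.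
    Param : N → Set
    Param z = α.Reached KX z × ¬ α.Fun z × ¬ Known z

    -- `γ` is `α` joined with one exception. Each field rules out one reason why generic values of
    -- the parameters would falsify the exception: inconsistency, a head symbol, an additional
    -- finiteness demand, dependence on `K`, the identification of two parameters.
    record Irrelevant (γ : Constraints N) : Set where
      private module γ = Closure γ
      field
        consistentγ  : γ.Consistent
        unstructured : ∀ {z} → Param z → ¬ γ.Fun z
        notFinite    : ∀ {z} → Param z → γ.Fin* z → α.Fin* z
        undetermined : ∀ {z} → Param z → ¬ γ.Reached K z
        separate     : ∀ {z z′} → Param z → Param z′ → z γ.~ z′ → z α.~ z′

    -- Symbols for the generic trees. There may be infinitely many classes while symbols are picked
    -- one after another, so injectivity is demanded on the finite list `zs` only; `fs` lists the
    -- symbols to be dodged.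
    record Heads (zs : List N) (fs : List Sym) : Set where
      field
        head        : N → Sym
        nonConstant : ∀ z → arity (head z) ≢ 0
        invariant   : ∀ {x y} → x α.~ y → head x ≡ head y
        fresh       : ∀ z → head z ∉ fs
        injective-on : ∀ {x y} → x ∈ zs → y ∈ zs → head x ≡ head y → x α.~ y

    heads : ∀ zs fs → Heads zs fs
    heads [] fs with infinitelyManyNonConstants fs
    ... | f , f∉ , nc = record
      { head = λ _ → f ; nonConstant = λ _ → nc ; invariant = λ _ → refl
      ; fresh = λ _ → f∉ ; injective-on = λ () }
    heads (z₀ ∷ zs) fs with heads zs fs
    ... | H with infinitelyManyNonConstants (List.map (Heads.head H) (z₀ ∷ zs) ++ fs)
    ... | f , f∉ , nc = record
      { head = h ; nonConstant = nonConstant′ ; invariant = invariant′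
      ; fresh = fresh′ ; injective-on = injective′ }
      where
      open Heads H
      h : N → Sym
      h z with em {P = z α.~ z₀}
      ... | yes _ = f
      ... | no _  = head z
      nonConstant′ : ∀ z → arity (h z) ≢ 0
      nonConstant′ z with em {P = z α.~ z₀}
      ... | yes _ = nc
      ... | no _  = nonConstant z
      invariant′ : ∀ {x y} → x α.~ y → h x ≡ h y
      invariant′ {x} {y} e with em {P = x α.~ z₀} | em {P = y α.~ z₀}
      ... | yes _ | yes _ = refl
      ... | yes p | no ¬q = ⊥-elim (¬q (α.~trans (α.~sym e) p))
      ... | no ¬p | yes q = ⊥-elim (¬p (α.~trans e q))
      ... | no _  | no _  = invariant e
      fresh′ : ∀ z → h z ∉ fs
      fresh′ z with em {P = z α.~ z₀}
      ... | yes _ = f∉ ∘ ∈-++⁺ʳ _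
      ... | no _  = fresh z
      f≢ : ∀ {x} → x ∈ zs → f ≢ head x
      f≢ x∈ refl = f∉ (there (∈-++⁺ˡ (∈-map⁺ head x∈)))
      tail : ∀ {x} → x ∈ z₀ ∷ zs → ¬ x α.~ z₀ → x ∈ zs
      tail (here refl) ¬p = ⊥-elim (¬p α.~refl)
      tail (there x∈)  _  = x∈
      injective′ : ∀ {x y} → x ∈ z₀ ∷ zs → y ∈ z₀ ∷ zs → h x ≡ h y → x α.~ y
      injective′ {x} {y} x∈ y∈ e with em {P = x α.~ z₀} | em {P = y α.~ z₀}
      ... | yes p | yes q = α.~trans p (α.~sym q)
      ... | yes p | no ¬q = ⊥-elim (f≢ (tail y∈ ¬q) e)
      ... | no ¬p | yes q = ⊥-elim (f≢ (tail x∈ ¬p) (sym e))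
      ... | no ¬p | no ¬q = injective-on (tail x∈ ¬p) (tail y∈ ¬q) e

    -- Generic values and their transfer in a model

    module InModel (𝓜 : Structure) (model : Model 𝓜) where
      open Structure 𝓜
      open Axioms 𝓜 model
      open Solutions 𝓜 model

      finiteTree : Sym → Carrier
      finiteTree f = fun f (Vec.replicate _ point)

      finiteTree-finite : ∀ f → Finite (finiteTree f)
      finiteTree-finite f = finite-fun⁺ λ i → subst Finite (sym (Vec.lookup-replicate i point)) point-finite

      loop : ∀ f → ∃ λ a → a ≡ fun f (Vec.replicate _ a)
      loop f with solution-exists {1} (λ _ → f , Vec.replicate _ (inj₂ zero))
      ... | b , solves = b zero , trans (solves zero) (cong (fun f) (Vec.map-replicate _ (inj₂ zero) _))

      infiniteTree : Sym → Carrier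
      infiniteTree f = proj₁ (loop f)

      infiniteTree-infinite : ∀ f → arity f ≢ 0 → ¬ Finite (infiniteTree f)
      infiniteTree-infinite f nc = cycle⇒¬finite
        [ (f , Vec.replicate _ (infiniteTree f) , proj₂ (loop f) , first-arg nc , sym (Vec.lookup-replicate (first-arg nc) _)) ]
        where
        first-arg : ∀ {n} → n ≢ 0 → Fin n
        first-arg {zero}  n≢0 = ⊥-elim (n≢0 refl)
        first-arg {suc n} _   = zero

      tree : ∀ {P : Set} → Sym → Dec P → Carrier
      tree f (yes _) = finiteTree f
      tree f (no _)  = infiniteTree f

      tree-head : ∀ {P : Set} f (d : Dec P) → ∃ λ as → tree f d ≡ fun f as
      tree-head f (yes _) = _ , refl
      tree-head f (no _)  = _ , proj₂ (loop f)

      tree-cong : ∀ {P Q : Set} {f g} (d : Dec P) (e : Dec Q) → (P → Q) → (Q → P) → f ≡ g → tree f d ≡ tree g e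
      tree-cong (yes p) (yes q) _ _ refl = refl
      tree-cong (yes p) (no ¬q) P⇒Q _ _  = ⊥-elim (¬q (P⇒Q p))
      tree-cong (no ¬p) (yes q) _ Q⇒P _  = ⊥-elim (¬p (Q⇒P q))
      tree-cong (no ¬p) (no ¬q) _ _ refl = refl

      tree-finite : ∀ {P : Set} f (d : Dec P) → P → Finite (tree f d)
      tree-finite f (yes _) _ = finiteTree-finite f
      tree-finite f (no ¬p) p = ⊥-elim (¬p p)

      tree-infinite : ∀ {P : Set} f (d : Dec P) → arity f ≢ 0 → ¬ P → ¬ Finite (tree f d)
      tree-infinite f (yes p) _  ¬p = ⊥-elim (¬p p)
      tree-infinite f (no _)  nc _  = infiniteTree-infinite f nc

      -- `γ` is solved anew, with the values of `v` on the classes of parameters and those of `w` on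
      -- the other classes without a symbol. By `undetermined` this change does not touch what `K`
      -- reaches, so the solution still equals `w`, hence `v`, on `K`; uniqueness for `α` then
      -- extends the agreement with `v` to all of `KX`.
      transfer : ∀ {γ} → α ⊆ γ → Irrelevant γ → ∀ {v w} → v ⊨ α → w ⊨ γ → (∀ {z} → K z → w z ≡ v z) →
        ∃ λ u → u ⊨ γ × (∀ {z} → KX z → u z ≡ v z)
      transfer {γ} α⊆γ irr {v} {w} v⊨α w⊨γ w≡v = E.v , E.v⊨γ , λ KXz →
        agree-determined (α.Reached KX) (⊨-⊆ α⊆γ E.v⊨γ) v⊨α α.along α.down nonfun (α.start KXz)
        where
        open Irrelevant irr
        module γ = Closure γ
        module V = Soundness v⊨α
        module W = Soundness w⊨γ

        q : N → Carrier
        q z with em {P = ∃ λ x → Param x × x γ.~ z}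
        ... | yes (x , _) = v x
        ... | no _        = w z

        q-param : ∀ {x z} → Param x → x γ.~ z → q z ≡ v x
        q-param {x} {z} Px e with em {P = ∃ λ x → Param x × x γ.~ z}
        ... | yes (x′ , Px′ , e′) = V.~-sound (separate Px′ Px (γ.~trans e′ (γ.~sym e)))
        ... | no ¬p               = ⊥-elim (¬p (x , Px , e))

        q-other : ∀ {z} → ¬ (∃ λ x → Param x × x γ.~ z) → q z ≡ w z
        q-other {z} ¬p with em {P = ∃ λ x → Param x × x γ.~ z}
        ... | yes p = ⊥-elim (¬p p)
        ... | no _  = refl

        q-resp : ∀ {x y} → x γ.~ y → ¬ γ.Fun x → q x ≡ q y
        q-resp {x} {y} e _ with em {P = ∃ λ p → Param p × p γ.~ x}
        ... | yes (p , Pp , e′) = sym (q-param Pp (γ.~trans e′ e))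
        ... | no ¬p             = trans (W.~-sound e)
                (sym (q-other λ { (p , Pp , e′) → ¬p (p , Pp , γ.~trans e′ (γ.~sym e)) }))

        q-fin : ∀ {x} → γ.Fin* x → ¬ γ.Fun x → Finite (q x)
        q-fin {x} φ _ with em {P = ∃ λ p → Param p × p γ.~ x}
        ... | yes (p , Pp , e) = V.Fin*-sound (notFinite Pp (γ.cong* φ (γ.~sym e)))
        ... | no _             = W.Fin*-sound φ

        module E = Extension consistentγ q q-resp q-fin

        known : ∀ {z} → K z → E.v z ≡ v z
        known Kz = trans (agree-determined (γ.Reached K) E.v⊨γ w⊨γ γ.along γ.down
          (λ r ¬fun → trans (E.v-nonfun ¬fun) (q-other λ { (p , Pp , e) → undetermined Pp (γ.along r (γ.~sym e)) }))
          (γ.start Kz)) (w≡v Kz)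

        nonfun : ∀ {z} → α.Reached KX z → ¬ α.Fun z → E.v z ≡ v z
        nonfun {z} r ¬fun with em {P = Known z}
        ... | yes k = agree-reached K (⊨-⊆ α⊆γ E.v⊨γ) v⊨α known k
        ... | no ¬k = trans (E.v-nonfun (unstructured (r , ¬fun , ¬k))) (q-param (r , ¬fun , ¬k) γ.~refl)

      record GenericSolution (v₀ : N → Carrier) {zs fs} (H : Heads zs fs) : Set where
        open Heads H
        field
          v      : N → Carrier
          v⊨α    : v ⊨ α
          known  : ∀ {z} → Known z → v z ≡ v₀ z
          value  : ∀ {z} → Param z → v z ≡ tree (head z) (em {P = α.Fin* z})

      -- Known nodes keep their values under `v₀`, and fresh trees are grown elsewhere. Being known
      -- is closed under `_~_` and under passing to arguments, so uniqueness leaves every known node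
      -- unchanged.
      genericSolution : ∀ {v₀ zs fs} → v₀ ⊨ α → (H : Heads zs fs) → GenericSolution v₀ H
      genericSolution {v₀} v₀⊨α H = record
        { v = E.v ; v⊨α = E.v⊨γ
        ; known = agree-determined Known E.v⊨γ v₀⊨α α.along α.down (λ k ¬fun → trans (E.v-nonfun ¬fun) (q-known k))
        ; value = λ { (_ , ¬fun , ¬k) → trans (E.v-nonfun ¬fun) (q-unknown ¬k) } }
        where
        open Heads H
        module V₀ = Soundness v₀⊨α

        q : N → Carrier
        q z with em {P = Known z}
        ... | yes _ = v₀ z
        ... | no _  = tree (head z) (em {P = α.Fin* z})

        q-known : ∀ {z} → Known z → q z ≡ v₀ z
        q-known {z} k with em {P = Known z}
        ... | yes _ = refl
        ... | no ¬k = ⊥-elim (¬k k)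

        q-unknown : ∀ {z} → ¬ Known z → q z ≡ tree (head z) (em {P = α.Fin* z})
        q-unknown {z} ¬k with em {P = Known z}
        ... | yes k = ⊥-elim (¬k k)
        ... | no _  = refl

        q-resp : ∀ {x y} → x α.~ y → ¬ α.Fun x → q x ≡ q y
        q-resp {x} {y} e _ with em {P = Known x}
        ... | yes k = trans (V₀.~-sound e) (sym (q-known (α.along k e)))
        ... | no ¬k = trans (tree-cong em em (λ φ → α.cong* φ e) (λ φ → α.cong* φ (α.~sym e)) (invariant e))
                        (sym (q-unknown λ k → ¬k (α.along k (α.~sym e))))

        q-fin : ∀ {x} → α.Fin* x → ¬ α.Fun x → Finite (q x)
        q-fin {x} φ _ with em {P = Known x}
        ... | yes _ = V₀.Fin*-sound φ
        ... | no _  = tree-finite (head x) em φ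

        module E = Extension (consistent v₀⊨α) q q-resp q-fin

      Avoids : ∀ {v₀ zs fs} {H : Heads zs fs} → GenericSolution v₀ H → Constraints N → Set
      Avoids G γ = ∀ {w} → w ⊨ γ → (∀ {z} → KX z → w z ≡ GenericSolution.v G z) → ⊥

      -- The demands on head symbols are returned before any heads are chosen, so that those of
      -- several exceptions can be combined and one generic solution avoids them all. The cases
      -- follow the field of `Irrelevant` that fails.
      avoid : ∀ v₀ {γ} → α ⊆ γ → ¬ Irrelevant γ →
        ∃ λ zs → ∃ λ fs → ∀ {zs′ fs′} → zs ⊆ zs′ → fs ⊆ fs′ → (H : Heads zs′ fs′) (G : GenericSolution v₀ H) → Avoids G γ
      avoid v₀ {γ} α⊆γ ¬irr
        with em {P = Closure.Consistent γ}
           | em {P = ∃ λ z → Param z × Closure.Fun γ z}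
           | em {P = ∃ λ z → Param z × Closure.Fin* γ z × ¬ α.Fin* z}
           | em {P = ∃ λ z → Param z × Closure.Reached γ K z}
           | em {P = ∃ λ z → ∃ λ z′ → Param z × Param z′ × Closure._~_ γ z z′ × ¬ z α.~ z′}
      ... | no ¬c | _ | _ | _ | _ = [] , [] , λ _ _ H G w⊨γ w≡v → ¬c (consistent w⊨γ)
      ... | yes _ | yes (z , Pz , y , (f , xs) , z~y , y∈) | _ | _ | _ = [] , f ∷ [] , λ _ fs⊆ H G w⊨γ w≡v →
        let open Heads H
            open GenericSolution G
            w≡v′ = agree-reached KX (⊨-⊆ α⊆γ w⊨γ) v⊨α w≡v (proj₁ Pz)
            e = trans (sym (proj₂ (tree-head (head z) em))) (trans (sym (value Pz)) (trans (sym w≡v′) (Soundness.value w⊨γ z~y y∈)))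
        in fresh z (fs⊆ (here (fun-head e)))
      ... | yes _ | no _ | yes (z , Pz , φ , ¬φ) | _ | _ = [] , [] , λ _ _ H G w⊨γ w≡v →
        let open Heads H
            open GenericSolution G
            w≡v′ = agree-reached KX (⊨-⊆ α⊆γ w⊨γ) v⊨α w≡v (proj₁ Pz)
        -- `α` does not force `z` to be finite, so its generic tree is infinite, whereas `γ` forces
        -- it to be finite.
        in tree-infinite (head z) em (nonConstant z) ¬φ
             (subst Finite (trans w≡v′ (value Pz)) (Soundness.Fin*-sound w⊨γ φ))
      -- The values on K determine the one at z, so a single symbol covers the
      -- heads of w z for all solutions w of γ.
      ... | yes _ | no _ | no _ | yes (z , Pz , r) | _
        with em {P = ∃ λ w → ∃ λ f → ∃ λ as → w ⊨ γ × (∀ {y} → K y → w y ≡ v₀ y) × w z ≡ fun f as}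
      ...   | no ¬w = [] , [] , λ _ _ H G {w} w⊨γ w≡v →
        let open Heads H
            open GenericSolution G
            w≡v′ = agree-reached KX (⊨-⊆ α⊆γ w⊨γ) v⊨α w≡v (proj₁ Pz)
        in ¬w (w , head z , _ , w⊨γ , (λ Ky → trans (w≡v (K⊆KX Ky)) (known (α.start Ky))) ,
                 trans w≡v′ (trans (value Pz) (proj₂ (tree-head (head z) em))))
      ...   | yes (w* , f , as , w*⊨γ , w*≡ , w*z) = [] , f ∷ [] , λ _ fs⊆ H G {w} w⊨γ w≡v →
        let open Heads H
            open GenericSolution G
            w≡v′ = agree-reached KX (⊨-⊆ α⊆γ w⊨γ) v⊨α w≡v (proj₁ Pz)
            w*≡w = agree-reached K w*⊨γ w⊨γ
                     (λ Ky → trans (w*≡ Ky) (sym (trans (w≡v (K⊆KX Ky)) (known (α.start Ky))))) r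
            e = trans (sym (proj₂ (tree-head (head z) em))) (trans (sym (value Pz)) (trans (sym w≡v′) (trans (sym w*≡w) w*z)))
        in fresh z (fs⊆ (here (fun-head e)))
      avoid v₀ {γ} α⊆γ ¬irr
          | yes _ | no _ | no _ | no _ | yes (z , z′ , Pz , Pz′ , e , ¬e) = z ∷ z′ ∷ [] , [] , λ zs⊆ _ H G w⊨γ w≡v →
        let open Heads H
            open GenericSolution G
            w≡v′ : ∀ {y} → Param y → _
            w≡v′ Py = trans (agree-reached KX (⊨-⊆ α⊆γ w⊨γ) v⊨α w≡v (proj₁ Py)) (trans (value Py) (proj₂ (tree-head (head _) em)))
        in ¬e (injective-on (zs⊆ (here refl)) (zs⊆ (there (here refl)))
             (fun-head (trans (sym (w≡v′ Pz)) (trans (Soundness.~-sound w⊨γ e) (w≡v′ Pz′)))))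
      avoid v₀ {γ} α⊆γ ¬irr | yes c | no ¬a | no ¬b | no ¬r | no ¬d = ⊥-elim (¬irr record
        { consistentγ  = c
        ; unstructured = λ Pz f → ¬a (_ , Pz , f)
        ; notFinite    = λ {z} Pz φ → [ id , (λ ¬φ → ⊥-elim (¬b (z , Pz , φ , ¬φ))) ]′ (decide _)
        ; undetermined = λ Pz r → ¬r (_ , Pz , r)
        ; separate     = λ {z} {z′} Pz Pz′ e → [ id , (λ ¬e → ⊥-elim (¬d (z , z′ , Pz , Pz′ , e , ¬e))) ]′ (decide _)
        })
        where
        decide : ∀ (P : Set) → P ⊎ ¬ P
        decide P with em {P = P}
        ... | yes p = inj₁ p
        ... | no ¬p = inj₂ ¬p

      avoid-all : ∀ v₀ γs → (∀ {γ} → γ ∈ γs → α ⊆ γ) →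
        ∃ λ zs → ∃ λ fs → ∀ {zs′ fs′} → zs ⊆ zs′ → fs ⊆ fs′ → (H : Heads zs′ fs′) (G : GenericSolution v₀ H) →
          ∀ {γ} → γ ∈ γs → ¬ Irrelevant γ → Avoids G γ
      avoid-all v₀ []       _   = [] , [] , λ _ _ _ _ ()
      avoid-all v₀ (γ ∷ γs) sub with avoid-all v₀ γs (sub ∘ there) | em {P = Irrelevant γ}
      ... | zs , fs , rest | yes irr = zs , fs , λ zs⊆ fs⊆ H G →
        λ { (here refl) ¬irr → ⊥-elim (¬irr irr) ; (there γ∈) → rest zs⊆ fs⊆ H G γ∈ }
      ... | zs , fs , rest | no ¬irr with avoid v₀ (sub (here refl)) ¬irr
      ...   | zs′ , fs′ , one = zs′ ++ zs , fs′ ++ fs , λ zs⊆ fs⊆ H G →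
        λ { (here refl) _ → one (zs⊆ ∘ ∈-++⁺ˡ) (fs⊆ ∘ ∈-++⁺ˡ) H G
          ; (there γ∈)  → rest (zs⊆ ∘ ∈-++⁺ʳ zs′) (fs⊆ ∘ ∈-++⁺ʳ fs′) H G γ∈ }

      generic : ∀ {v₀} → v₀ ⊨ α → ∀ γs → (∀ {γ} → γ ∈ γs → α ⊆ γ) →
        ∃ λ v → v ⊨ α × (∀ {z} → K z → v z ≡ v₀ z) ×
          (∀ {γ} → γ ∈ γs → ¬ Irrelevant γ → ∀ {w} → w ⊨ γ → (∀ {z} → KX z → w z ≡ v z) → ⊥)
      generic {v₀} v₀⊨α γs sub with avoid-all v₀ γs sub
      ... | zs , fs , avoids = v , v⊨α , known ∘ α.start , avoids id id H G
        where
        H = heads zs fs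
        G = genericSolution v₀⊨α H
        open GenericSolution G

  -- Disjunctive normal forms

  infix 1 _⟺_

  _⟺_ : Set → Set → Set
  A ⟺ B = (A → B) × (B → A)

  mapConstraint : ∀ {M N : Set} → (M → N) → Constraint M → Constraint N
  mapConstraint g (x ≃ y)        = g x ≃ g y
  mapConstraint g (x ≔ (f , xs)) = g x ≔ (f , Vec.map g xs)
  mapConstraint g (fin x)        = fin (g x)

  rename : ∀ {M N : Set} → (M → N) → Constraints M → Constraints N
  rename g = List.map (mapConstraint g)

  -- Names for bound variables.  Flattening a term names every subterm after
  -- itself, and a block under ∃ or ∧ is renamed apart by a constructor, so no
  -- freshness condition ever arises.
  data Bound : Set where
    term        : Term → Bound
    nil         : Bound
    outer inner : Bound → Bound

  Block∃ : Set → Set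
  Block∃ A = Constraints (A ⊎ Bound)

  Conjunct : Set → Set
  Conjunct A = Block∃ A × List (Block∃ A)

  DNF : Set → Set
  DNF A = List (Conjunct A)

  mapDNF : ∀ {A B} → (A → B) → DNF A → DNF B
  mapDNF h = List.map λ { (α , βs) → rename (Sum.map h id) α , List.map (rename (Sum.map h id)) βs }

  _⊓_ : ∀ {A} → Conjunct A → Conjunct A → Conjunct A
  (α , βs) ⊓ (α′ , βs′) = rename (Sum.map id outer) α ++ rename (Sum.map id inner) α′ , βs ++ βs′

  andᴰ orᴰ : ∀ {A} → DNF A → DNF A → DNF A
  andᴰ = cartesianProductWith _⊓_
  orᴰ  = _++_

  trueᴰ : ∀ {A} → DNF A
  trueᴰ = ([] , []) ∷ []

  -- A satisfied exception already refutes the conjunct, so it may be asserted alone, without `α`;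
  -- this keeps the negation free of products.
  negᶜ : ∀ {A} → Conjunct A → DNF A
  negᶜ (α , βs) = ([] , α ∷ []) ∷ List.map (_, []) βs

  negᴰ : ∀ {A} → DNF A → DNF A
  negᴰ []      = trueᴰ
  negᴰ (c ∷ d) = andᴰ (negᶜ c) (negᴰ d)

  impliesᴰ : ∀ {A} → DNF A → DNF A → DNF A
  impliesᴰ d d′ = orᴰ (negᴰ d) d′

  -- `k` tells whether a free name survives or is the variable being bound, which then becomes
  -- `nil`. The bound names of the outer block and of an exception are kept apart by `outer` and
  -- `inner`, so that `visible` contains the scope of the outer block and nothing private to an
  -- exception.
  module Quantified {A B : Set} (k : A → B ⊎ ⊤) where

    target : B ⊎ ⊤ → B ⊎ Bound
    target = Sum.map id (λ _ → nil)

    name : (Bound → Bound) → A ⊎ Bound → B ⊎ Bound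
    name place (inj₁ a) = target (k a)
    name place (inj₂ b) = inj₂ (place b)

    free visible : B ⊎ Bound → Set
    free (inj₁ _) = ⊤
    free (inj₂ _) = ⊥
    visible (inj₂ (inner _)) = ⊥
    visible _                = ⊤

    free⊆visible : ∀ {z} → free z → visible z
    free⊆visible {inj₁ _} _ = tt

    module E (α : Block∃ A) = Elimination free visible (λ {z} → free⊆visible {z}) (rename (name outer) α)

    combined : Block∃ A → Block∃ A → Block∃ B
    combined α β = rename (name outer) α ++ rename (name inner) β

    irrelevant? : ∀ α γ → Dec (E.Irrelevant α γ)
    irrelevant? α γ = em

    existsᶜ : Conjunct A → Conjunct B
    existsᶜ (α , βs) = rename (name outer) α , filter (irrelevant? α) (List.map (combined α) βs)

  existsᴰ : ∀ {A B} → (A → B ⊎ ⊤) → DNF A → DNF B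
  existsᴰ k = List.map (Quantified.existsᶜ k)

  mutual
    flat : ∀ {A} t → (∀ {x} → x ∈ᵗ t → A) → Block∃ A
    flat (var x)    k = (inj₂ (term (var x)) ≃ inj₁ (k here)) ∷ []
    flat (app f ts) k = (inj₂ (term (app f ts)) ≔ (f , Vec.map (inj₂ ∘ term) ts)) ∷ flats ts (k ∘ there)

    flats : ∀ {A n} (ts : Vec Term n) → (∀ {x} → VecAny.Any (x ∈ᵗ_) ts → A) → Block∃ A
    flats []       k = []
    flats (t ∷ ts) k = flat t (k ∘ VecAny.here) ++ flats ts (k ∘ VecAny.there)

  -- Indexing normal forms by certified free variables keeps all other variables out by typing. Two
  -- certificates for one variable count as two names, which valuations of the form `ρ ∘ freeVar`
  -- merge again.
  record FV (p : Formula) : Set where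
    constructor _,_
    field
      freeVar : Var
      isFree    : freeVar ∈FV p
  open FV

  dropBound : ∀ {Q x φ} → FV φ → FV (quantify Q x φ) ⊎ ⊤
  dropBound {x = x} (y , y∈) with y ≟ x
  ... | yes _  = inj₂ tt
  ... | no y≢x = inj₁ (y , y≢x , y∈)

  inLeft : ∀ {⊙ φ ψ} → FV φ → FV (binary ⊙ φ ψ)
  inLeft (x , x∈) = x , inj₁ x∈

  inRight : ∀ {⊙ φ ψ} → FV ψ → FV (binary ⊙ φ ψ)
  inRight (x , x∈) = x , inj₂ x∈

  dnf : ∀ p → DNF (FV p)
  dnf true       = trueᴰ
  dnf false      = []
  dnf (s ≐ t)    = (flat s (λ x∈ → _ , inj₁ x∈) ++ flat t (λ x∈ → _ , inj₂ x∈) ++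
                    (inj₂ (term s) ≃ inj₂ (term t)) ∷ [] , []) ∷ []
  dnf (finite t) = (flat t (λ x∈ → _ , x∈) ++ fin (inj₂ (term t)) ∷ [] , []) ∷ []
  dnf (neg φ)    = negᴰ (mapDNF (λ (x , x∈) → x , x∈) (dnf φ))
  dnf (φ ∧ ψ)    = andᴰ (mapDNF inLeft (dnf φ)) (mapDNF inRight (dnf ψ))
  dnf (φ ∨ ψ)    = orᴰ (mapDNF inLeft (dnf φ)) (mapDNF inRight (dnf ψ))
  dnf (φ ⇒ ψ)    = impliesᴰ (mapDNF inLeft (dnf φ)) (mapDNF inRight (dnf ψ))
  dnf (φ ⇔ ψ)    = andᴰ (impliesᴰ (mapDNF inLeft (dnf φ)) (mapDNF inRight (dnf ψ)))
                        (impliesᴰ (mapDNF inRight (dnf ψ)) (mapDNF inLeft (dnf φ)))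
  dnf (quantify some x φ) = existsᴰ (dropBound {some} {x} {φ}) (dnf φ)
  dnf (quantify all x φ)  = negᴰ (existsᴰ (dropBound {all} {x} {φ}) (negᴰ (dnf φ)))

  -- Correctness of the disjunctive normal form in every model

  module Correctness (𝓜 : Structure) (model : Model 𝓜) where
    open Structure 𝓜
    open Axioms 𝓜 model
    open Solutions 𝓜 model

    private
      C = Carrier

    rename⁺ : ∀ {M N : Set} {g : M → N} {v : N → C} {w : M → C} {β} →
      (∀ z → v (g z) ≡ w z) → w ⊨ β → v ⊨ rename g β
    rename⁺ {g = g} {v} {w} e w⊨β = All.map⁺ (All.map {P = w ⊨ₐ_} (λ {c} → one {c}) w⊨β)
      where
      one : ∀ {a} → w ⊨ₐ a → v ⊨ₐ mapConstraint g a
      one {x ≃ y}        s = trans (e x) (trans s (sym (e y)))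
      one {x ≔ (f , xs)} s = trans (e x) (trans s (cong (fun f)
        (trans (Vec.map-cong (sym ∘ e) xs) (Vec.map-∘ v g xs))))
      one {fin x}        s = subst Finite (sym (e x)) s

    rename⁻ : ∀ {M N : Set} {g : M → N} {v : N → C} {w : M → C} {β} →
      (∀ z → v (g z) ≡ w z) → v ⊨ rename g β → w ⊨ β
    rename⁻ {g = g} {v} {w} e v⊨ = All.map {P = λ c → v ⊨ₐ mapConstraint g c} (λ {c} → one {c}) (All.map⁻ v⊨)
      where
      one : ∀ {a} → v ⊨ₐ mapConstraint g a → w ⊨ₐ a
      one {x ≃ y}        s = trans (sym (e x)) (trans s (e y))
      one {x ≔ (f , xs)} s = trans (sym (e x)) (trans s (cong (fun f)
        (trans (sym (Vec.map-∘ v g xs)) (Vec.map-cong e xs))))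
      one {fin x}        s = subst Finite (e x) s

    ⊨-cong : ∀ {N : Set} {v w : N → C} {β} → (∀ z → v z ≡ w z) → v ⊨ β → w ⊨ β
    ⊨-cong {v = v} {w} e v⊨ = All.map {P = v ⊨ₐ_} (λ {c} → one c) v⊨
      where
      one : ∀ c → v ⊨ₐ c → w ⊨ₐ c
      one (x ≃ y)        s = trans (sym (e x)) (trans s (e y))
      one (x ≔ (f , xs)) s = trans (sym (e x)) (trans s (cong (fun f) (Vec.map-cong e xs)))
      one (fin x)        s = subst Finite (e x) s

    ⟦_⟧ᴮ : ∀ {A} → Block∃ A → (A → C) → Set
    ⟦ β ⟧ᴮ ρ = ∃ λ (e : Bound → C) → [ ρ , e ]′ ⊨ β

    ⟦_⟧ᶜ : ∀ {A} → Conjunct A → (A → C) → Set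
    ⟦ α , βs ⟧ᶜ ρ = ⟦ α ⟧ᴮ ρ × (∀ {β} → β ∈ βs → ¬ ⟦ β ⟧ᴮ ρ)

    ⟦_⟧ᴰ : ∀ {A} → DNF A → (A → C) → Set
    ⟦ d ⟧ᴰ ρ = ∃ λ c → c ∈ d × ⟦ c ⟧ᶜ ρ

    block-cong : ∀ {A} {ρ σ : A → C} → (∀ a → ρ a ≡ σ a) → ∀ {β} → ⟦ β ⟧ᴮ ρ → ⟦ β ⟧ᴮ σ
    block-cong e (f , s) = f , ⊨-cong (λ { (inj₁ a) → e a ; (inj₂ _) → refl }) s

    dnf-cong : ∀ {A} {ρ σ : A → C} → (∀ a → ρ a ≡ σ a) → ∀ {d} → ⟦ d ⟧ᴰ ρ → ⟦ d ⟧ᴰ σ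
    dnf-cong e (c , c∈ , s , ss) = c , c∈ , block-cong e s , λ β∈ → ss β∈ ∘ block-cong (sym ∘ e)

    map-block : ∀ {A B} (h : A → B) {ρ : B → C} {σ : A → C} → (∀ a → ρ (h a) ≡ σ a) →
      ∀ β → ⟦ rename (Sum.map h id) β ⟧ᴮ ρ ⟺ ⟦ β ⟧ᴮ σ
    map-block h {ρ} {σ} e β = (λ (f , s) → f , rename⁻ (same f) s) , (λ (f , s) → f , rename⁺ (same f) s)
      where
      same : ∀ f z → [ ρ , f ]′ (Sum.map h id z) ≡ [ σ , f ]′ z
      same f (inj₁ a) = e a
      same f (inj₂ b) = refl

    map-correct : ∀ {A B} (h : A → B) {ρ : B → C} {σ : A → C} → (∀ a → ρ (h a) ≡ σ a) →
      ∀ d → ⟦ mapDNF h d ⟧ᴰ ρ ⟺ ⟦ d ⟧ᴰ σ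
    map-correct h {ρ} {σ} e d = to , from
      where
      to : ⟦ mapDNF h d ⟧ᴰ ρ → ⟦ d ⟧ᴰ σ
      to (c , c∈ , s , ss) with ∈-map⁻ _ c∈
      ... | (α , βs) , c∈′ , refl = (α , βs) , c∈′ , proj₁ (map-block h e α) s ,
        λ {β} β∈ t → ss (∈-map⁺ _ β∈) (proj₂ (map-block h e β) t)
      from : ⟦ d ⟧ᴰ σ → ⟦ mapDNF h d ⟧ᴰ ρ
      from ((α , βs) , c∈ , s , ss) = _ , ∈-map⁺ _ c∈ , proj₂ (map-block h e α) s , λ β∈ t → neither (∈-map⁻ _ β∈) t
        where
        neither : ∀ {β} → (∃ λ β′ → β′ ∈ βs × β ≡ rename (Sum.map h id) β′) → ¬ ⟦ β ⟧ᴮ ρ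
        neither (β′ , β∈ , refl) t = ss β∈ (proj₁ (map-block h e β′) t)

    ⊓-correct : ∀ {A} {ρ : A → C} c c′ → ⟦ c ⊓ c′ ⟧ᶜ ρ ⟺ (⟦ c ⟧ᶜ ρ × ⟦ c′ ⟧ᶜ ρ)
    ⊓-correct {A} {ρ} (α , βs) (α′ , βs′) = to , from
      where
      join : (Bound → C) → (Bound → C) → Bound → C
      join e e′ (outer b) = e b
      join e e′ (inner b) = e′ b
      join e e′ _         = point
      to : ⟦ (α , βs) ⊓ (α′ , βs′) ⟧ᶜ ρ → ⟦ α , βs ⟧ᶜ ρ × ⟦ α′ , βs′ ⟧ᶜ ρ
      to ((e , s) , ss) =
        ((e ∘ outer , rename⁻ (λ { (inj₁ _) → refl ; (inj₂ _) → refl }) (All.++⁻ˡ _ s)) , ss ∘ ∈-++⁺ˡ) ,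
        ((e ∘ inner , rename⁻ (λ { (inj₁ _) → refl ; (inj₂ _) → refl }) (All.++⁻ʳ (rename (Sum.map id outer) α) s)) , ss ∘ ∈-++⁺ʳ βs)
      from : ⟦ α , βs ⟧ᶜ ρ × ⟦ α′ , βs′ ⟧ᶜ ρ → ⟦ (α , βs) ⊓ (α′ , βs′) ⟧ᶜ ρ
      from (((e , s) , ss) , ((e′ , s′) , ss′)) =
        (join e e′ , All.++⁺ (rename⁺ (λ { (inj₁ _) → refl ; (inj₂ _) → refl }) s)
                             (rename⁺ (λ { (inj₁ _) → refl ; (inj₂ _) → refl }) s′)) ,
        λ β∈ → [ ss , ss′ ]′ (∈-++⁻ βs β∈)

    and-correct : ∀ {A} {ρ : A → C} d d′ → ⟦ andᴰ d d′ ⟧ᴰ ρ ⟺ (⟦ d ⟧ᴰ ρ × ⟦ d′ ⟧ᴰ ρ)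
    and-correct {A} {ρ} d d′ = to , from
      where
      to : ⟦ andᴰ d d′ ⟧ᴰ ρ → ⟦ d ⟧ᴰ ρ × ⟦ d′ ⟧ᴰ ρ
      to (c , c∈ , s) with ∈-cartesianProductWith⁻ _⊓_ d d′ c∈
      ... | c₁ , c₂ , c₁∈ , c₂∈ , refl with proj₁ (⊓-correct c₁ c₂) s
      ...   | s₁ , s₂ = (c₁ , c₁∈ , s₁) , (c₂ , c₂∈ , s₂)
      from : ⟦ d ⟧ᴰ ρ × ⟦ d′ ⟧ᴰ ρ → ⟦ andᴰ d d′ ⟧ᴰ ρ
      from ((c₁ , c₁∈ , s₁) , (c₂ , c₂∈ , s₂)) =
        _ , ∈-cartesianProductWith⁺ _⊓_ c₁∈ c₂∈ , proj₂ (⊓-correct c₁ c₂) (s₁ , s₂)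

    or-correct : ∀ {A} {ρ : A → C} d d′ → ⟦ orᴰ d d′ ⟧ᴰ ρ ⟺ (⟦ d ⟧ᴰ ρ ⊎ ⟦ d′ ⟧ᴰ ρ)
    or-correct d d′ =
      (λ { (c , c∈ , s) → Sum.map (λ c∈ → c , c∈ , s) (λ c∈ → c , c∈ , s) (∈-++⁻ d c∈) }) ,
      [ (λ { (c , c∈ , s) → c , ∈-++⁺ˡ c∈ , s }) , (λ { (c , c∈ , s) → c , ∈-++⁺ʳ d c∈ , s }) ]′

    negᶜ-correct : ∀ {A} {ρ : A → C} c → ⟦ negᶜ c ⟧ᴰ ρ ⟺ (¬ ⟦ c ⟧ᶜ ρ)
    negᶜ-correct {A} {ρ} (α , βs) = to , from
      where
      to : ⟦ negᶜ (α , βs) ⟧ᴰ ρ → ¬ ⟦ α , βs ⟧ᶜ ρ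
      to (_ , here refl , _ , ss) (s , _) = ss (here refl) s
      to (_ , there c∈ , s , _) (_ , ss) with ∈-map⁻ (_, []) c∈
      ... | β , β∈ , refl = ss β∈ s
      from : ¬ ⟦ α , βs ⟧ᶜ ρ → ⟦ negᶜ (α , βs) ⟧ᴰ ρ
      from ¬s with em {P = ⟦ α ⟧ᴮ ρ} | em {P = ∃ λ β → β ∈ βs × ⟦ β ⟧ᴮ ρ}
      ... | no ¬α | _ = _ , here refl , ((λ _ → point) , []) , λ { (here refl) → ¬α }
      ... | yes _ | yes (β , β∈ , t) = (β , []) , there (∈-map⁺ (_, []) β∈) , t , λ ()
      ... | yes s | no ¬t = ⊥-elim (¬s (s , λ β∈ t → ¬t (_ , β∈ , t)))

    true-correct : ∀ {A} {ρ : A → C} → ⟦ trueᴰ ⟧ᴰ ρ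
    true-correct = _ , here refl , ((λ _ → point) , []) , λ ()

    neg-correct : ∀ {A} {ρ : A → C} d → ⟦ negᴰ d ⟧ᴰ ρ ⟺ (¬ ⟦ d ⟧ᴰ ρ)
    neg-correct []      = (λ _ ()) , λ _ → true-correct
    neg-correct {ρ = ρ} (c ∷ d) = to , from
      where
      to : ⟦ negᴰ (c ∷ d) ⟧ᴰ ρ → ¬ ⟦ c ∷ d ⟧ᴰ ρ
      to s with proj₁ (and-correct (negᶜ c) (negᴰ d)) s
      ... | s₁ , s₂ = λ { (_ , here refl , t)  → proj₁ (negᶜ-correct c) s₁ t
                        ; (c′ , there c∈ , t) → proj₁ (neg-correct d) s₂ (c′ , c∈ , t) }
      from : ¬ ⟦ c ∷ d ⟧ᴰ ρ → ⟦ negᴰ (c ∷ d) ⟧ᴰ ρ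
      from ¬s = proj₂ (and-correct (negᶜ c) (negᴰ d))
        (proj₂ (negᶜ-correct c) (λ t → ¬s (c , here refl , t)) ,
         proj₂ (neg-correct d) (λ { (c′ , c∈ , t) → ¬s (c′ , there c∈ , t) }))

    implies-correct : ∀ {A} {ρ : A → C} d d′ → ⟦ impliesᴰ d d′ ⟧ᴰ ρ ⟺ (⟦ d ⟧ᴰ ρ → ⟦ d′ ⟧ᴰ ρ)
    implies-correct {ρ = ρ} d d′ =
      (λ s t → [ (λ ¬t → ⊥-elim (proj₁ (neg-correct d) ¬t t)) , id ]′ (proj₁ (or-correct (negᴰ d) d′) s)) , from
      where
      from : (⟦ d ⟧ᴰ ρ → ⟦ d′ ⟧ᴰ ρ) → ⟦ impliesᴰ d d′ ⟧ᴰ ρ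
      from h with em {P = ⟦ d ⟧ᴰ ρ}
      ... | yes t = proj₂ (or-correct (negᴰ d) d′) (inj₂ (h t))
      ... | no ¬t = proj₂ (or-correct (negᴰ d) d′) (inj₁ (proj₂ (neg-correct d) ¬t))

    module _ {A B : Set} (k : A → B ⊎ ⊤) where
      open Quantified k

      extended : (B → C) → C → A → C
      extended ρ a = [ ρ , (λ _ → a) ]′ ∘ k

      name-value : ∀ place {ρ a} {e : Bound → C} (v : B ⊎ Bound → C) →
        (∀ b → v (inj₁ b) ≡ ρ b) → v (inj₂ nil) ≡ a → (∀ b → v (inj₂ (place b)) ≡ e b) →
        ∀ z → v (name place z) ≡ [ extended ρ a , e ]′ z
      name-value place v vρ va ve (inj₁ x) with k x
      ... | inj₁ b = vρ b
      ... | inj₂ _ = va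
      name-value place v vρ va ve (inj₂ b) = ve b

      existsᶜ-correct : ∀ {ρ : B → C} c → ⟦ existsᶜ c ⟧ᶜ ρ ⟺ (∃ λ a → ⟦ c ⟧ᶜ (extended ρ a))
      existsᶜ-correct {ρ} (α , βs) = to , from
        where
        α′ = rename (name outer) α
        γs = List.map (combined α) βs
        module M = E.InModel α 𝓜 model

        α′⊆ : ∀ {γ} → γ ∈ γs → α′ ⊆ γ
        α′⊆ γ∈ a∈ with ∈-map⁻ (combined α) γ∈
        ... | β , _ , refl = ∈-++⁺ˡ a∈

        to : ⟦ existsᶜ (α , βs) ⟧ᶜ ρ → ∃ λ a → ⟦ α , βs ⟧ᶜ (extended ρ a)
        -- The given solution may satisfy an exception that the filter has dropped, so it is
        -- exchanged for a generic one with the same free values, whose value at `nil` becomes the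
        -- witness.
        to ((e , s) , ss) with M.generic {[ ρ , e ]′} s γs α′⊆
        ... | v , v⊨α′ , v≡ , avoids = a , (v ∘ inj₂ ∘ outer , v⊨α) , impossible
          where
          a = v (inj₂ nil)
          v⊨α : [ extended ρ a , v ∘ inj₂ ∘ outer ]′ ⊨ α
          v⊨α = rename⁻ (name-value outer v (λ b → v≡ {inj₁ b} tt) refl (λ _ → refl)) v⊨α′

          impossible : ∀ {β} → β ∈ βs → ¬ ⟦ β ⟧ᴮ (extended ρ a)
          impossible {β} β∈ (e₂ , t) with em {P = E.Irrelevant α (combined α β)}
          ... | yes irr = ss (∈-filter⁺ (irrelevant? α) (∈-map⁺ (combined α) β∈) irr) (w ∘ inj₂ , w⊨′)
            where
            w : B ⊎ Bound → C
            w (inj₂ (inner b)) = e₂ b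
            w (inj₁ b)         = ρ b
            w z                = v z
            w⊨ : w ⊨ combined α β
            w⊨ = All.++⁺ (rename⁺ (name-value outer w (λ _ → refl) refl (λ _ → refl)) v⊨α)
                         (rename⁺ (name-value inner w (λ _ → refl) refl (λ _ → refl)) t)
            w⊨′ : [ ρ , w ∘ inj₂ ]′ ⊨ combined α β
            w⊨′ = ⊨-cong (λ { (inj₁ _) → refl ; (inj₂ _) → refl }) w⊨
          ... | no ¬irr = avoids (∈-map⁺ (combined α) β∈) ¬irr {w} w⊨ λ {z} → w≡v z
            where
            w : B ⊎ Bound → C
            w (inj₂ (inner b)) = e₂ b
            w z                = v z
            w⊨ : w ⊨ combined α β
            w⊨ = All.++⁺ (rename⁺ (name-value outer w (λ b → v≡ {inj₁ b} tt) refl (λ _ → refl)) v⊨α)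
                         (rename⁺ (name-value inner w (λ b → v≡ {inj₁ b} tt) refl (λ _ → refl)) t)
            w≡v : ∀ z → visible z → w z ≡ v z
            w≡v (inj₁ _)         _ = refl
            w≡v (inj₂ (term _))  _ = refl
            w≡v (inj₂ nil)       _ = refl
            w≡v (inj₂ (outer _)) _ = refl

        from : (∃ λ a → ⟦ α , βs ⟧ᶜ (extended ρ a)) → ⟦ existsᶜ (α , βs) ⟧ᶜ ρ
        from (a , (e₁ , s) , ss) = (e , v⊨α′) , impossible
          where
          e : Bound → C
          e nil       = a
          e (outer b) = e₁ b
          e _         = point
          v⊨α′ : [ ρ , e ]′ ⊨ α′
          v⊨α′ = rename⁺ (name-value outer [ ρ , e ]′ (λ _ → refl) refl (λ _ → refl)) s
          impossible : ∀ {γ} → γ ∈ filter (irrelevant? α) γs → ¬ ⟦ γ ⟧ᴮ ρ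
          impossible γ∈ (e′ , t) with ∈-filter⁻ (irrelevant? α) {xs = γs} γ∈
          ... | γ∈′ , irr with ∈-map⁻ (combined α) γ∈′
          -- A solution of the retained block may bind the quantified variable differently. It is
          -- moved onto the values given by `e`, where it satisfies the exception `β` at the element
          -- `a` itself.
          ...   | β , β∈ , refl with M.transfer ∈-++⁺ˡ irr v⊨α′ t (λ { {inj₁ _} _ → refl ; {inj₂ _} () })
          ...     | u , u⊨ , u≡ = ss β∈ (u ∘ inj₂ ∘ inner ,
            rename⁻ (name-value inner u (λ b → u≡ {inj₁ b} tt) (u≡ {inj₂ nil} tt) (λ _ → refl))
                    (All.++⁻ʳ α′ u⊨))

      exists-correct : ∀ {ρ : B → C} d → ⟦ existsᴰ k d ⟧ᴰ ρ ⟺ (∃ λ a → ⟦ d ⟧ᴰ (extended ρ a))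
      exists-correct {ρ} d = to , from
        where
        to : ⟦ existsᴰ k d ⟧ᴰ ρ → ∃ λ a → ⟦ d ⟧ᴰ (extended ρ a)
        to (_ , c∈ , s) with ∈-map⁻ existsᶜ c∈
        ... | c , c∈′ , refl with proj₁ (existsᶜ-correct c) s
        ...   | a , t = a , c , c∈′ , t
        from : (∃ λ a → ⟦ d ⟧ᴰ (extended ρ a)) → ⟦ existsᴰ k d ⟧ᴰ ρ
        from (a , c , c∈ , t) = _ , ∈-map⁺ existsᶜ c∈ , proj₂ (existsᶜ-correct c) (a , t)

    mutual
      flat-sound : ∀ {A} t (k : ∀ {x} → x ∈ᵗ t → A) {ρ} (v : A ⊎ Bound → C) →
        (∀ {x} (x∈ : x ∈ᵗ t) → v (inj₁ (k x∈)) ≡ ρ x) → v ⊨ flat t k → v (inj₂ (term t)) ≡ eval 𝓜 ρ t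
      flat-sound (var x)    k v e (s ∷ []) = trans s (e here)
      flat-sound (app f ts) k v e (s ∷ ss) = trans s (cong (fun f) (flats-sound ts (k ∘ there) v (e ∘ there) ss))

      flats-sound : ∀ {A n} (ts : Vec Term n) (k : ∀ {x} → VecAny.Any (x ∈ᵗ_) ts → A) {ρ} (v : A ⊎ Bound → C) →
        (∀ {x} (x∈ : VecAny.Any (x ∈ᵗ_) ts) → v (inj₁ (k x∈)) ≡ ρ x) → v ⊨ flats ts k →
        Vec.map v (Vec.map (inj₂ ∘ term) ts) ≡ evals 𝓜 ρ ts
      flats-sound []       k v e s = refl
      flats-sound (t ∷ ts) k v e s = cong₂ _∷_
        (flat-sound t (k ∘ VecAny.here) v (e ∘ VecAny.here) (All.++⁻ˡ _ s))
        (flats-sound ts (k ∘ VecAny.there) v (e ∘ VecAny.there) (All.++⁻ʳ (flat t (k ∘ VecAny.here)) s))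

    mutual
      flat-complete : ∀ {A} t (k : ∀ {x} → x ∈ᵗ t → A) {ρ} (v : A ⊎ Bound → C) → (∀ t → v (inj₂ (term t)) ≡ eval 𝓜 ρ t) →
        (∀ {x} (x∈ : x ∈ᵗ t) → v (inj₁ (k x∈)) ≡ ρ x) → v ⊨ flat t k
      flat-complete (var x)    k v ev e = trans (ev (var x)) (sym (e here)) ∷ []
      flat-complete (app f ts) k v ev e =
        trans (ev (app f ts)) (cong (fun f) (sym (values ts))) ∷ flats-complete ts (k ∘ there) v ev (e ∘ there)
        where
        values : ∀ {n} (ts : Vec Term n) → Vec.map v (Vec.map (inj₂ ∘ term) ts) ≡ evals 𝓜 _ ts
        values []       = refl
        values (t ∷ ts) = cong₂ _∷_ (ev t) (values ts)

      flats-complete : ∀ {A n} (ts : Vec Term n) (k : ∀ {x} → VecAny.Any (x ∈ᵗ_) ts → A) {ρ} (v : A ⊎ Bound → C) →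
        (∀ t → v (inj₂ (term t)) ≡ eval 𝓜 ρ t) →
        (∀ {x} (x∈ : VecAny.Any (x ∈ᵗ_) ts) → v (inj₁ (k x∈)) ≡ ρ x) → v ⊨ flats ts k
      flats-complete []       k v ev e = []
      flats-complete (t ∷ ts) k v ev e = All.++⁺ (flat-complete t (k ∘ VecAny.here) v ev (e ∘ VecAny.here))
                                                 (flats-complete ts (k ∘ VecAny.there) v ev (e ∘ VecAny.there))

    dnf-correct : ∀ p ρ → Sat 𝓜 ρ p ⟺ ⟦ dnf p ⟧ᴰ (ρ ∘ freeVar)
    dnf-correct true  ρ = (λ _ → true-correct) , _
    dnf-correct false ρ = (λ ()) , λ { (_ , () , _) }
    dnf-correct (s ≐ t) ρ = to , from
      where
      to : eval 𝓜 ρ s ≡ eval 𝓜 ρ t → ⟦ dnf (s ≐ t) ⟧ᴰ (ρ ∘ freeVar)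
      to e = _ , here refl , (b , All.++⁺ (flat-complete s _ v (λ _ → refl) (λ _ → refl))
        (All.++⁺ (flat-complete t _ v (λ _ → refl) (λ _ → refl)) (e ∷ []))) , λ ()
        where
        b : Bound → C
        b (term t) = eval 𝓜 ρ t
        b _        = point
        v : FV (s ≐ t) ⊎ Bound → C
        v = [ ρ ∘ freeVar , b ]′
      from : ⟦ dnf (s ≐ t) ⟧ᴰ (ρ ∘ freeVar) → eval 𝓜 ρ s ≡ eval 𝓜 ρ t
      from (_ , here refl , (b , ss) , _) = trans (sym (flat-sound s ks v (λ _ → refl) (All.++⁻ˡ _ ss)))
        (trans (All.head (All.++⁻ʳ (flat t kt) ss′)) (flat-sound t kt v (λ _ → refl) (All.++⁻ˡ _ ss′)))
        where
        v : FV (s ≐ t) ⊎ Bound → C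
        v = [ ρ ∘ freeVar , b ]′
        ks : ∀ {x} → x ∈ᵗ s → FV (s ≐ t)
        ks x∈ = _ , inj₁ x∈
        kt : ∀ {x} → x ∈ᵗ t → FV (s ≐ t)
        kt x∈ = _ , inj₂ x∈
        ss′ = All.++⁻ʳ (flat s ks) ss
    dnf-correct (finite t) ρ = to , from
      where
      to : Finite (eval 𝓜 ρ t) → ⟦ dnf (finite t) ⟧ᴰ (ρ ∘ freeVar)
      to φ = _ , here refl , (b , All.++⁺ (flat-complete t _ [ ρ ∘ freeVar , b ]′ (λ _ → refl) (λ _ → refl)) (φ ∷ [])) , λ ()
        where
        b : Bound → C
        b (term t) = eval 𝓜 ρ t
        b _        = point
      from : ⟦ dnf (finite t) ⟧ᴰ (ρ ∘ freeVar) → Finite (eval 𝓜 ρ t)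
      from (_ , here refl , (b , ss) , _) = subst Finite (flat-sound t k v (λ _ → refl) (All.++⁻ˡ _ ss))
        (All.head (All.++⁻ʳ (flat t k) ss))
        where
        v : FV (finite t) ⊎ Bound → C
        v = [ ρ ∘ freeVar , b ]′
        k : ∀ {x} → x ∈ᵗ t → FV (finite t)
        k x∈ = _ , x∈
    dnf-correct (neg φ) ρ =
      (λ ¬s → proj₂ (neg-correct (mapDNF keep (dnf φ))) (¬s ∘ proj₂ (dnf-correct φ ρ) ∘ proj₁ same)) ,
      (λ t s → proj₁ (neg-correct (mapDNF keep (dnf φ))) t (proj₂ same (proj₁ (dnf-correct φ ρ) s)))
      where
      keep : FV φ → FV (neg φ)
      keep (x , x∈) = x , x∈
      same : ⟦ mapDNF keep (dnf φ) ⟧ᴰ (ρ ∘ freeVar) ⟺ ⟦ dnf φ ⟧ᴰ (ρ ∘ freeVar)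
      same = map-correct keep (λ _ → refl) (dnf φ)
    dnf-correct (binary ⊙ φ ψ) ρ = connective ⊙
      where
      d  = λ ⊙ → mapDNF (inLeft {⊙} {φ} {ψ}) (dnf φ)
      d′ = λ ⊙ → mapDNF (inRight {⊙} {φ} {ψ}) (dnf ψ)
      φ⇔ : ∀ ⊙ → Sat 𝓜 ρ φ ⟺ ⟦ d ⊙ ⟧ᴰ (ρ ∘ freeVar)
      φ⇔ ⊙ = let (f , g) = dnf-correct φ ρ ; (h , i) = map-correct (inLeft {⊙} {φ} {ψ}) (λ _ → refl) (dnf φ) in i ∘ f , g ∘ h
      ψ⇔ : ∀ ⊙ → Sat 𝓜 ρ ψ ⟺ ⟦ d′ ⊙ ⟧ᴰ (ρ ∘ freeVar)
      ψ⇔ ⊙ = let (f , g) = dnf-correct ψ ρ ; (h , i) = map-correct (inRight {⊙} {φ} {ψ}) (λ _ → refl) (dnf ψ) in i ∘ f , g ∘ h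
      connective : ∀ ⊙ → Sat 𝓜 ρ (binary ⊙ φ ψ) ⟺ ⟦ dnf (binary ⊙ φ ψ) ⟧ᴰ (ρ ∘ freeVar)
      connective and =
        (λ { (s , t) → proj₂ (and-correct (d and) (d′ and)) (proj₁ (φ⇔ and) s , proj₁ (ψ⇔ and) t) }) ,
        (λ s → let (t , u) = proj₁ (and-correct (d and) (d′ and)) s in proj₂ (φ⇔ and) t , proj₂ (ψ⇔ and) u)
      connective or =
        (λ s → proj₂ (or-correct (d or) (d′ or)) (Sum.map (proj₁ (φ⇔ or)) (proj₁ (ψ⇔ or)) s)) ,
        (λ s → Sum.map (proj₂ (φ⇔ or)) (proj₂ (ψ⇔ or)) (proj₁ (or-correct (d or) (d′ or)) s))
      connective implies =
        (λ s → proj₂ (implies-correct (d implies) (d′ implies)) (proj₁ (ψ⇔ implies) ∘ s ∘ proj₂ (φ⇔ implies))) ,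
        (λ s → proj₂ (ψ⇔ implies) ∘ proj₁ (implies-correct (d implies) (d′ implies)) s ∘ proj₁ (φ⇔ implies))
      connective iff =
        (λ { (s , t) → proj₂ (and-correct (impliesᴰ (d iff) (d′ iff)) (impliesᴰ (d′ iff) (d iff)))
          ( proj₂ (implies-correct (d iff) (d′ iff)) (proj₁ (ψ⇔ iff) ∘ s ∘ proj₂ (φ⇔ iff))
          , proj₂ (implies-correct (d′ iff) (d iff)) (proj₁ (φ⇔ iff) ∘ t ∘ proj₂ (ψ⇔ iff)) ) }) ,
        (λ s → let (t , u) = proj₁ (and-correct (impliesᴰ (d iff) (d′ iff)) (impliesᴰ (d′ iff) (d iff))) s in
          proj₂ (ψ⇔ iff) ∘ proj₁ (implies-correct (d iff) (d′ iff)) t ∘ proj₁ (φ⇔ iff) ,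
          proj₂ (φ⇔ iff) ∘ proj₁ (implies-correct (d′ iff) (d iff)) u ∘ proj₁ (ψ⇔ iff))
    dnf-correct (quantify Q x φ) ρ = quantifier Q
      where
      update : ∀ Q a y → extended (dropBound {Q} {x} {φ}) (ρ ∘ freeVar) a y ≡ (_[_↦_] 𝓜 ρ x a) (freeVar y)
      update Q a (y , y∈) with y ≟ x
      ... | yes _ = refl
      ... | no _  = refl
      ext⇔ : ∀ Q a d → ⟦ d ⟧ᴰ (extended (dropBound {Q} {x} {φ}) (ρ ∘ freeVar) a) ⟺ ⟦ d ⟧ᴰ ((_[_↦_] 𝓜 ρ x a) ∘ freeVar)
      ext⇔ Q a d = dnf-cong (update Q a) {d} , dnf-cong (sym ∘ update Q a) {d}
      quantifier : ∀ Q → Sat 𝓜 ρ (quantify Q x φ) ⟺ ⟦ dnf (quantify Q x φ) ⟧ᴰ (ρ ∘ freeVar)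
      quantifier some =
        (λ { (a , s) → proj₂ (exists-correct _ (dnf φ)) (a , proj₂ (ext⇔ some a (dnf φ)) (proj₁ (dnf-correct φ _) s)) }) ,
        (λ s → let (a , t) = proj₁ (exists-correct _ (dnf φ)) s in a , proj₂ (dnf-correct φ _) (proj₁ (ext⇔ some a (dnf φ)) t))
      quantifier all =
        (λ s → proj₂ (neg-correct (existsᴰ (dropBound {all} {x} {φ}) (negᴰ (dnf φ)))) λ t →
          let (a , ¬u) = proj₁ (exists-correct _ (negᴰ (dnf φ))) t in
          proj₁ (neg-correct (dnf φ)) ¬u (proj₂ (ext⇔ all a (dnf φ)) (proj₁ (dnf-correct φ _) (s a)))) ,
        from
        where
        from : ⟦ dnf (quantify all x φ) ⟧ᴰ (ρ ∘ freeVar) → ∀ a → Sat 𝓜 (_[_↦_] 𝓜 ρ x a) φ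
        from s a with em {P = Sat 𝓜 (_[_↦_] 𝓜 ρ x a) φ}
        ... | yes t = t
        ... | no ¬t = ⊥-elim (proj₁ (neg-correct (existsᴰ (dropBound {all} {x} {φ}) (negᴰ (dnf φ)))) s
          (proj₂ (exists-correct _ (negᴰ (dnf φ))) (a , proj₂ (neg-correct (dnf φ)) λ u →
            ¬t (proj₂ (dnf-correct φ _) (proj₁ (ext⇔ all a (dnf φ)) u)))))

  -- Solving a block

  _≺_ : Var → Var → Set
  x ≺ y = y ≻ x

  Sorted : List Var → Set
  Sorted = AllPairs _≺_

  AllPairs-cross : ∀ {R : Var → Var → Set} {xs ys} → AllPairs R (xs ++ ys) → ∀ {x y} → x ∈ xs → y ∈ ys → R x y
  AllPairs-cross {xs = x ∷ xs} (p ∷ _)  (here refl) y∈ = All.lookup p (∈-++⁺ʳ xs y∈)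
  AllPairs-cross {xs = x ∷ xs} (_ ∷ ps) (there x∈)  y∈ = AllPairs-cross ps x∈ y∈

  subjectOf : ∀ {N} → Constraint N → N
  subjectOf (x ≃ _) = x
  subjectOf (x ≔ _) = x
  subjectOf (fin x) = x

  nodes : ∀ {N} → Constraint N → List N
  nodes (x ≃ y)        = x ∷ y ∷ []
  nodes (x ≔ (_ , xs)) = x ∷ toList xs
  nodes (fin x)        = x ∷ []

  subject∈nodes : ∀ {N} (a : Constraint N) → subjectOf a ∈ nodes a
  subject∈nodes (x ≃ y) = here refl
  subject∈nodes (x ≔ _) = here refl
  subject∈nodes (fin x) = here refl

  ∈-lookupⱽ : ∀ {A : Set} {n} (xs : Vec A n) i → lookup xs i ∈ toList xs
  ∈-lookupⱽ (x ∷ xs) zero    = here refl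
  ∈-lookupⱽ (x ∷ xs) (suc i) = there (∈-lookupⱽ xs i)

  ∈-toList⁻ : ∀ {A : Set} {n x} (xs : Vec A n) → x ∈ toList xs → ∃ λ i → x ≡ lookup xs i
  ∈-toList⁻ (x ∷ xs) (here refl) = zero , refl
  ∈-toList⁻ (x ∷ xs) (there x∈) with ∈-toList⁻ xs x∈
  ... | i , e = suc i , e

  collect : ∀ {A B : Set} → (A → Maybe B) → List A → List B
  collect f []       = []
  collect f (x ∷ xs) = maybe′ (_∷ collect f xs) (collect f xs) (f x)

  collect⁺ : ∀ {A B : Set} (f : A → Maybe B) {xs x b} → x ∈ xs → f x ≡ just b → b ∈ collect f xs
  collect⁺ f (here refl) e rewrite e = here refl
  collect⁺ f {x′ ∷ _} (there x∈) e with f x′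
  ... | just _  = there (collect⁺ f x∈ e)
  ... | nothing = collect⁺ f x∈ e

  collect⁻ : ∀ {A B : Set} (f : A → Maybe B) xs {b} → b ∈ collect f xs → ∃ λ x → x ∈ xs × f x ≡ just b
  collect⁻ f (x ∷ xs) b∈ with f x in e
  collect⁻ f (x ∷ xs) (here refl) | just _ = x , here refl , e
  collect⁻ f (x ∷ xs) (there b∈)  | just _ with collect⁻ f xs b∈
  ... | y , y∈ , e′ = y , there y∈ , e′
  collect⁻ f (x ∷ xs) b∈ | nothing with collect⁻ f xs b∈
  ... | y , y∈ , e′ = y , there y∈ , e′

  toAtom : Constraint Var → Atom
  toAtom (x ≃ y)        = x ≈ var y
  toAtom (x ≔ (f , xs)) = x ≈ app f xs
  toAtom (fin x)        = finite x

  toBasic : Constraints Var → Basic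
  toBasic = List.map toAtom

  toBasic-≈ : ∀ {β x t} → (x ≈ t) ∈ toBasic β → ∃ λ a → a ∈ β × toAtom a ≡ x ≈ t
  toBasic-≈ x∈ with ∈-map⁻ toAtom x∈
  ... | a , a∈ , e = a , a∈ , sym e

  -- `α₀` holds the equations that must reappear verbatim, `γ` everything that has to be expressed.
  -- `flat₀` says that the right side of a variable equation heads no equation of `α₀`, so such
  -- equations never form chains.
  module Solve (U ȳ : List Var) (sorted : Sorted (U ++ ȳ)) (α₀ γ : Constraints Var) (α₀⊆γ : α₀ ⊆ γ)
    (no-fin : ∀ {x} → fin x ∉ α₀)
    (distinct₀ : ∀ {a b} → a ∈ α₀ → b ∈ α₀ → subjectOf a ≡ subjectOf b → a ≡ b)
    (oriented₀ : ∀ {x y} → (x ≃ y) ∈ α₀ → x ≻ y)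
    (flat₀ : ∀ {x y a} → (x ≃ y) ∈ α₀ → a ∈ α₀ → subjectOf a ≢ y)
    (nodes₀ : ∀ {a} → a ∈ α₀ → nodes a ⊆ U)
    (nodesγ : ∀ {a} → a ∈ γ → nodes a ⊆ U ++ ȳ)
    (cons : Closure.Consistent γ) where

    open Closure γ
    open Consistent cons

    ns = U ++ ȳ

    ~-nodes : ∀ {x y} → x ~ y → x ≡ y ⊎ (x ∈ ns × y ∈ ns)
    ~-nodes (base e)       = inj₂ (nodesγ e (here refl) , nodesγ e (there (here refl)))
    ~-nodes ~refl          = inj₁ refl
    ~-nodes (~sym e)       = Sum.map sym (λ (p , q) → q , p) (~-nodes e)
    ~-nodes (~trans d e) with ~-nodes d | ~-nodes e
    ... | inj₁ refl    | r            = r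
    ... | inj₂ r       | inj₁ refl    = inj₂ r
    ... | inj₂ (p , _) | inj₂ (_ , q) = inj₂ (p , q)
    ~-nodes (arg {xs = xs} {ys} _ x∈ y∈ i) =
      inj₂ (nodesγ x∈ (there (∈-lookupⱽ xs i)) , nodesγ y∈ (there (∈-lookupⱽ ys i)))

    ~-∈ns : ∀ {x y} → x ~ y → y ∈ ns → x ∈ ns
    ~-∈ns e y∈ with ~-nodes e
    ... | inj₁ refl     = y∈
    ... | inj₂ (x∈ , _) = x∈

    firstIn : List Var → Var → Var
    firstIn []       z = z
    firstIn (x ∷ xs) z with em {P = z ~ x}
    ... | yes _ = x
    ... | no _  = firstIn xs z

    firstIn-~ : ∀ xs z → z ~ firstIn xs z
    firstIn-~ []       z = ~refl
    firstIn-~ (x ∷ xs) z with em {P = z ~ x}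
    ... | yes e = e
    ... | no _  = firstIn-~ xs z

    firstIn-cong : ∀ {xs z z′ x} → x ∈ xs → z ~ x → z ~ z′ → firstIn xs z ≡ firstIn xs z′
    firstIn-cong {x ∷ xs} {z} {z′} x∈ z~ e with em {P = z ~ x} | em {P = z′ ~ x}
    ... | yes _ | yes _ = refl
    ... | yes p | no ¬q = ⊥-elim (¬q (~trans (~sym e) p))
    ... | no ¬p | yes q = ⊥-elim (¬p (~trans e q))
    firstIn-cong (here refl) z~ e | no ¬p | no _ = ⊥-elim (¬p z~)
    firstIn-cong (there x∈)  z~ e | no _  | no _ = firstIn-cong x∈ z~ e

    firstIn-∈ : ∀ {xs z x} → x ∈ xs → z ~ x → firstIn xs z ∈ xs
    firstIn-∈ {x ∷ xs} {z} x∈ z~ with em {P = z ~ x}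
    ... | yes _ = here refl
    firstIn-∈ (here refl) z~ | no ¬p = ⊥-elim (¬p z~)
    firstIn-∈ (there x∈)  z~ | no _  = there (firstIn-∈ x∈ z~)

    firstIn-least : ∀ {xs z x} → Sorted xs → x ∈ xs → z ~ x → firstIn xs z ≡ x ⊎ firstIn xs z ≺ x
    firstIn-least {x ∷ xs} {z} (p ∷ ps) x∈ z~ with em {P = z ~ x}
    firstIn-least (p ∷ ps) (here refl) z~ | yes _ = inj₁ refl
    firstIn-least (p ∷ ps) (there x∈)  z~ | yes _ = inj₂ (All.lookup p x∈)
    firstIn-least (p ∷ ps) (here refl) z~ | no ¬p = ⊥-elim (¬p z~)
    firstIn-least (p ∷ ps) (there x∈)  z~ | no _  = firstIn-least ps x∈ z~

    -- The ≻-least member of the class, in U whenever the class meets U.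
    rep : Var → Var
    rep = firstIn ns

    rep-~ : ∀ {z} → z ~ rep z
    rep-~ = firstIn-~ ns _

    rep-cong : ∀ {z z′} → z ~ z′ → rep z ≡ rep z′
    rep-cong e with ~-nodes e
    ... | inj₁ refl     = refl
    ... | inj₂ (z∈ , _) = firstIn-cong z∈ ~refl e

    rep-idem : ∀ {z} → rep (rep z) ≡ rep z
    rep-idem = sym (rep-cong rep-~)

    rep-∈ns : ∀ {z} → z ∈ ns → rep z ∈ ns
    rep-∈ns z∈ = firstIn-∈ z∈ ~refl

    rep-least : ∀ {z x} → x ∈ ns → z ~ x → rep z ≡ x ⊎ x ≻ rep z
    rep-least = firstIn-least sorted

    rep-minimal : ∀ {z x} → x ∈ ns → z ~ x → ¬ rep z ≻ x
    rep-minimal x∈ e r≻x with rep-least x∈ e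
    ... | inj₁ refl = irrefl refl r≻x
    ... | inj₂ x≻r  = asym r≻x x≻r

    rep∈U : ∀ {z u} → u ∈ U → z ~ u → rep z ∈ U
    rep∈U {z} {u} u∈ e with ∈-++⁻ U (firstIn-∈ (∈-++⁺ˡ u∈) e)
    ... | inj₁ r∈ = r∈
    ... | inj₂ r∈ = ⊥-elim (rep-minimal (∈-++⁺ˡ u∈) e (AllPairs-cross sorted u∈ r∈))

    ReachedU : Var → Set
    ReachedU = Reached (_∈ U)

    Fixed : Var → Set
    Fixed z = ∃ λ a → a ∈ α₀ × subjectOf a ≡ z

    -- At most one atom per variable makes the subjects distinct. In a class with a symbol each
    -- unfixed variable gets an equation of its own instead of a link to the representative; their
    -- equality follows by uniqueness. Finiteness is stated only at representatives without a
    -- symbol, to which it has descended in the closure.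
    data Emits (z : Var) : Maybe (Constraint Var) → Set where
      keep  : ∀ {a} → a ∈ α₀ → subjectOf a ≡ z → Emits z (just a)
      build : ∀ {x f xs} → ¬ Fixed z → z ~ x → (x ≔ (f , xs)) ∈ γ → Emits z (just (z ≔ (f , Vec.map rep xs)))
      link  : ¬ Fixed z → ¬ Fun z → z ≢ rep z → Emits z (just (z ≃ rep z))
      bound : ¬ Fixed z → ¬ Fun z → z ≡ rep z → Fin* z → Emits z (just (fin z))
      none  : ¬ Fixed z → ¬ Fun z → z ≡ rep z → ¬ Fin* z → Emits z nothing

    emits : ∀ z → ∃ (Emits z)
    emits z with em {P = Fixed z} | em {P = Fun z} | em {P = z ≡ rep z} | em {P = Fin* z}
    ... | yes (a , a∈ , e) | _ | _ | _ = _ , keep a∈ e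
    ... | no ¬k | yes (x , _ , e , x∈) | _ | _ = _ , build ¬k e x∈
    ... | no ¬k | no ¬f | no ¬r | _ = _ , link ¬k ¬f ¬r
    ... | no ¬k | no ¬f | yes r | yes φ = _ , bound ¬k ¬f r φ
    ... | no ¬k | no ¬f | yes r | no ¬φ = _ , none ¬k ¬f r ¬φ

    emit : Var → Maybe (Constraint Var)
    emit = proj₁ ∘ emits

    -- The arguments of built equations are representatives, and bound variables out of reach from
    -- `U` do not influence it. All others are dropped; `β-complete` finds values for them again.
    chosen? : ∀ y → Dec (y ≡ rep y × ReachedU y)
    chosen? y = em

    ȳ′ : List Var
    ȳ′ = filter chosen? ȳ

    kept : List Var
    kept = U ++ ȳ′

    β : Constraints Var
    β = collect emit kept

    ȳ′⊆ȳ : ȳ′ ⊆ ȳ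
    ȳ′⊆ȳ = proj₁ ∘ ∈-filter⁻ chosen?

    ȳ′-rep : ∀ {y} → y ∈ ȳ′ → y ≡ rep y
    ȳ′-rep = proj₁ ∘ proj₂ ∘ ∈-filter⁻ chosen? {xs = ȳ}

    kept⊆ns : kept ⊆ ns
    kept⊆ns z∈ with ∈-++⁻ U z∈
    ... | inj₁ z∈U = ∈-++⁺ˡ z∈U
    ... | inj₂ z∈ȳ = ∈-++⁺ʳ U (ȳ′⊆ȳ z∈ȳ)

    kept-reached : ∀ {z} → z ∈ kept → ReachedU z
    kept-reached z∈ with ∈-++⁻ U z∈
    ... | inj₁ z∈U = start z∈U
    ... | inj₂ z∈ȳ = proj₂ (proj₂ (∈-filter⁻ chosen? {xs = ȳ} z∈ȳ))

    rep-kept : ∀ {z} → z ∈ ns → ReachedU z → rep z ∈ kept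
    rep-kept z∈ r with ∈-++⁻ U (rep-∈ns z∈)
    ... | inj₁ r∈U = ∈-++⁺ˡ r∈U
    ... | inj₂ r∈ȳ = ∈-++⁺ʳ U (∈-filter⁺ chosen? r∈ȳ (sym rep-idem , along r rep-~))

    β⁻ : ∀ {a} → a ∈ β → ∃ λ z → z ∈ kept × emit z ≡ just a × Emits z (just a)
    β⁻ a∈ with collect⁻ emit kept a∈
    ... | z , z∈ , e = z , z∈ , e , subst (Emits z) e (proj₂ (emits z))

    emits-subject : ∀ {z a} → Emits z (just a) → subjectOf a ≡ z
    emits-subject (keep _ e)      = e
    emits-subject (build _ _ _)   = refl
    emits-subject (link _ _ _)    = refl
    emits-subject (bound _ _ _ _) = refl

    α₀⊆β : α₀ ⊆ β
    α₀⊆β {a} a∈ with emits (subjectOf a) in e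
    ... | _ , keep b∈ s with distinct₀ b∈ a∈ s
    ...   | refl = collect⁺ emit (∈-++⁺ˡ (nodes₀ a∈ (subject∈nodes a))) (cong proj₁ e)
    α₀⊆β {a} a∈ | _ , build ¬k _ _   = ⊥-elim (¬k (a , a∈ , refl))
    α₀⊆β {a} a∈ | _ , link ¬k _ _    = ⊥-elim (¬k (a , a∈ , refl))
    α₀⊆β {a} a∈ | _ , bound ¬k _ _ _ = ⊥-elim (¬k (a , a∈ , refl))
    α₀⊆β {a} a∈ | _ , none ¬k _ _ _  = ⊥-elim (¬k (a , a∈ , refl))

    β-distinct : ∀ {a b} → a ∈ β → b ∈ β → subjectOf a ≡ subjectOf b → a ≡ b
    β-distinct a∈ b∈ e = same (β⁻ a∈) (β⁻ b∈) e
      where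
      same : ∀ {a b} → (∃ λ z → z ∈ kept × emit z ≡ just a × Emits z (just a)) →
        (∃ λ z → z ∈ kept × emit z ≡ just b × Emits z (just b)) → subjectOf a ≡ subjectOf b → a ≡ b
      same (z , _ , ea , va) (z′ , _ , eb , vb) e with trans (sym (emits-subject va)) (trans e (emits-subject vb))
      ... | refl = just-injective (trans (sym ea) eb)

    β-oriented : ∀ {x y} → (x ≃ y) ∈ β → x ≻ y
    β-oriented x∈ with β⁻ x∈
    ... | _ , z∈ , _ , keep a∈ refl = oriented₀ a∈
    ... | z , z∈ , _ , link _ _ z≢ with rep-least (kept⊆ns z∈) (~refl {z})
    ...   | inj₁ e  = ⊥-elim (z≢ (sym e))
    ...   | inj₂ z≻ = z≻

    β-nodes : ∀ {a} → a ∈ β → nodes a ⊆ kept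
    β-nodes a∈ x∈ with β⁻ a∈
    ... | z , z∈ , _ , keep a∈₀ refl = ∈-++⁺ˡ (nodes₀ a∈₀ x∈)
    β-nodes a∈ (here refl) | z , z∈ , _ , build _ _ _ = z∈
    β-nodes a∈ (there x∈) | z , z∈ , _ , build {xs = xs} _ e y∈ with ∈-toList⁻ (Vec.map rep xs) x∈
    ... | i , refl = subst (_∈ kept) (sym (Vec.lookup-map i rep xs)) (rep-kept (nodesγ y∈ (there (∈-lookupⱽ xs i)))
            (down (kept-reached z∈) (_ , _ , e , y∈ , i , ~refl)))
    β-nodes a∈ (here refl) | z , z∈ , _ , link _ _ _ = z∈
    β-nodes a∈ (there (here refl)) | z , z∈ , _ , link _ _ _ = rep-kept (kept⊆ns z∈) (kept-reached z∈)
    β-nodes a∈ (here refl) | z , z∈ , _ , bound _ _ _ _ = z∈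

    -- An oriented variable equation of `α₀` has a smaller member of the same class on its right,
    -- which the least member cannot have.
    Fixed-minimal : ∀ {z} → ¬ Fun (rep z) → ¬ Fixed (rep z)
    Fixed-minimal ¬fun (x ≃ y , a∈ , refl) =
      rep-minimal (∈-++⁺ˡ (nodes₀ a∈ (there (here refl)))) (~trans rep-~ (base (α₀⊆γ a∈))) (oriented₀ a∈)
    Fixed-minimal ¬fun (x ≔ a , a∈ , refl) = ¬fun (x , a , ~refl , α₀⊆γ a∈)
    Fixed-minimal ¬fun (fin x , a∈ , refl) = no-fin a∈

    _⟶_ : Var → Var → Set
    _⟶_ = Step (toBasic β)

    -- Follows the derivation of `ReachedU`. In a step down, the representative of the parent is
    -- kept and reachable. Either its built equation supplies the edge to `z′`, or its equation
    -- comes from `α₀`, whose arguments lie in `U`; then `z′`, being its own representative, lies in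
    -- `U` too.
    reachable : ∀ {z z′} → ReachedU z → z′ ∈ kept → z′ ~ z → ∃ λ u → u ∈ U × Reach (toBasic β) u z′
    reachable {z} {z′} r z′∈ e with ∈-++⁻ U z′∈
    ... | inj₁ z′∈U = z′ , z′∈U , ε
    ... | inj₂ z′∈ȳ = go r e
      where
      class-meets-U : ∀ {u} → u ∈ U → z′ ~ u → ∃ λ u → u ∈ U × Reach (toBasic β) u z′
      class-meets-U u∈ e = z′ , subst (_∈ U) (sym (ȳ′-rep z′∈ȳ)) (rep∈U u∈ e) , ε
      go : ∀ {z} → ReachedU z → z′ ~ z → ∃ λ u → u ∈ U × Reach (toBasic β) u z′
      go (start z∈)   e = class-meets-U z∈ e
      go (along r e′) e = go r (~trans e (~sym e′))
      go (down {z₁} r (x , (f , xs) , z₁~x , x∈ , i , z~)) e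
        with rep-kept z₁∈ r | reachable r (rep-kept z₁∈ r) (~sym rep-~) | emits (rep z₁) in eq
        where
        z₁∈ : z₁ ∈ ns
        z₁∈ = ~-∈ns z₁~x (nodesγ x∈ (here refl))
      ... | w∈ | u , u∈ , path | _ , keep {y ≃ _} a∈ refl =
        ⊥-elim (rep-minimal (∈-++⁺ˡ (nodes₀ a∈ (there (here refl)))) (~trans rep-~ (base (α₀⊆γ a∈))) (oriented₀ a∈))
      ... | w∈ | u , u∈ , path | _ , keep {y ≔ (g , ys)} a∈ refl
        with noClash (~trans (~sym rep-~) z₁~x) (α₀⊆γ a∈) x∈
      ...   | refl = class-meets-U (nodes₀ a∈ (there (∈-lookupⱽ ys i)))
                (~trans e (~trans z~ (arg (~trans (~sym z₁~x) rep-~) x∈ (α₀⊆γ a∈) i)))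
      go (down r (x , (f , xs) , z₁~x , x∈ , i , z~)) e
        | w∈ | u , u∈ , path | _ , keep {fin _} a∈ refl = ⊥-elim (no-fin a∈)
      go (down {z₁} r (x , (f , xs) , z₁~x , x∈ , i , z~)) e
        | w∈ | u , u∈ , path | _ , build {y} {g} {ys} ¬k w~y y∈
        with noClash (~trans (~sym w~y) (~trans (~sym rep-~) z₁~x)) y∈ x∈
      ...   | refl = u , u∈ , path ◅◅ (_ , ∈-map⁺ toAtom (collect⁺ emit w∈ (cong proj₁ eq)) , target) ◅ ε
        where
        ys~z′ : lookup ys i ~ z′
        ys~z′ = ~trans (arg (~trans (~sym w~y) (~trans (~sym rep-~) z₁~x)) y∈ x∈ i) (~sym (~trans e z~))
        target : z′ ∈ toList (Vec.map rep ys)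
        target = subst (_∈ toList (Vec.map rep ys))
          (trans (Vec.lookup-map i rep ys) (trans (rep-cong ys~z′) (sym (ȳ′-rep z′∈ȳ))))
          (∈-lookupⱽ (Vec.map rep ys) i)
      go (down r (x , (f , xs) , z₁~x , x∈ , i , z~)) e
        | w∈ | u , u∈ , path | _ , link _ ¬f _ = ⊥-elim (¬f (x , _ , ~trans (~sym rep-~) z₁~x , x∈))
      go (down r (x , (f , xs) , z₁~x , x∈ , i , z~)) e
        | w∈ | u , u∈ , path | _ , bound _ ¬f _ _ = ⊥-elim (¬f (x , _ , ~trans (~sym rep-~) z₁~x , x∈))
      go (down r (x , (f , xs) , z₁~x , x∈ , i , z~)) e
        | w∈ | u , u∈ , path | _ , none _ ¬f _ _ = ⊥-elim (¬f (x , _ , ~trans (~sym rep-~) z₁~x , x∈))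

    Fin*-step : ∀ {x y} → Fin* x → x ⟶ y → Fin* y × y ∈ kept
    Fin*-step φ (t , x∈ , y∈) with toBasic-≈ x∈
    ... | a , a∈ , e = go a a∈ e (proj₂ (proj₂ (proj₂ (β⁻ a∈)))) φ y∈
      where
      go : ∀ {z x y t} a → a ∈ β → toAtom a ≡ x ≈ t → Emits z (just a) → Fin* x → y ∈ varsᶠ t → Fin* y × y ∈ kept
      go (x ≃ y) a∈ refl (keep a∈₀ refl) φ (here refl) = cong* φ (base (α₀⊆γ a∈₀)) , β-nodes a∈ (there (here refl))
      go (x ≃ y) a∈ refl (link _ _ _)    φ (here refl) = cong* φ rep-~ , β-nodes a∈ (there (here refl))
      go (x ≔ (f , xs)) a∈ refl (keep a∈₀ refl) φ y∈ with ∈-toList⁻ xs y∈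
      ... | i , refl = arg φ (α₀⊆γ a∈₀) i , β-nodes a∈ (there (∈-lookupⱽ xs i))
      go (x ≔ (f , _)) a∈ refl (build {xs = xs} _ e z∈) φ y∈ with ∈-toList⁻ (Vec.map rep xs) y∈
      ... | i , refl = subst Fin* (sym (Vec.lookup-map i rep xs)) (cong* (arg (cong* φ e) z∈ i) rep-~) ,
                       β-nodes a∈ (there (∈-lookupⱽ (Vec.map rep xs) i))

    -- Finiteness is inherited along the equations of `β`, and a kept variable of a finite class
    -- that heads no equation has emitted its finiteness atom.
    covered : ∀ {u v} → Fin* u → u ∈ kept → Reach (toBasic β) u v → ¬ (v isLhsIn toBasic β) → finite v ∈ toBasic β
    covered φ _ (s ◅ ss) ¬lhs with Fin*-step φ s
    ... | φ′ , u′∈ = covered φ′ u′∈ ss ¬lhs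
    covered {u} φ u∈ ε ¬lhs with emits u in e
    ... | _ , keep {x ≃ y} a∈ refl = ⊥-elim (¬lhs (_ , ∈-map⁺ toAtom (α₀⊆β a∈)))
    ... | _ , keep {x ≔ a} a∈ refl = ⊥-elim (¬lhs (_ , ∈-map⁺ toAtom (α₀⊆β a∈)))
    ... | _ , keep {fin x} a∈ refl = ⊥-elim (no-fin a∈)
    ... | _ , build _ _ _   = ⊥-elim (¬lhs (_ , ∈-map⁺ toAtom (collect⁺ emit u∈ (cong proj₁ e))))
    ... | _ , link _ _ _    = ⊥-elim (¬lhs (_ , ∈-map⁺ toAtom (collect⁺ emit u∈ (cong proj₁ e))))
    ... | _ , bound _ _ _ _ = ∈-map⁺ toAtom (collect⁺ emit u∈ (cong proj₁ e))
    ... | _ , none _ _ _ ¬φ = ⊥-elim (¬φ φ)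

    -- Without inherited equations, links lead only to representatives without a symbol, and these
    -- head no equation. This is what the outer block supplies as `flat₀` for its exceptions. An
    -- inherited `x = y` would break it as soon as `γ` gives `y` a symbol.
    β-flat : (∀ {a} → a ∉ α₀) → ∀ {x y a} → (x ≃ y) ∈ β → a ∈ β → (∀ {z} → a ≢ fin z) → subjectOf a ≢ y
    β-flat empty x∈ a∈ = no-chain (proj₂ (proj₂ (proj₂ (β⁻ x∈)))) (proj₂ (proj₂ (proj₂ (β⁻ a∈))))
      where
      no-chain : ∀ {x y a z z′} → Emits z (just (x ≃ y)) → Emits z′ (just a) → (∀ {z} → a ≢ fin z) → subjectOf a ≢ y
      no-chain (keep b∈ _)   _                 eqn e = empty b∈
      no-chain (link _ ¬f _) (keep b∈ _)       eqn e = empty b∈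
      no-chain (link _ ¬f _) (build _ z~ z∈)   eqn e = ¬f (Fun-resp (~sym rep-~) (subst Fun e (_ , _ , z~ , z∈)))
      no-chain (link _ ¬f _) (link _ _ z≢)     eqn e = z≢ (subst (λ y → y ≡ rep y) (sym e) (sym rep-idem))
      no-chain (link _ ¬f _) (bound _ _ _ _)   eqn e = eqn refl

    module Semantics (𝓜 : Structure) (model : Model 𝓜) where
      open Structure 𝓜
      open Axioms 𝓜 model
      open Solutions 𝓜 model

      β-sound : ∀ {v} → v ⊨ γ → v ⊨ β
      β-sound {v} v⊨γ = All.tabulate λ a∈ → one (proj₂ (proj₂ (proj₂ (β⁻ a∈))))
        where
        module V = Soundness v⊨γ
        one : ∀ {z a} → Emits z (just a) → v ⊨ₐ a
        one (keep a∈ _)      = All.lookup v⊨γ (α₀⊆γ a∈)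
        one (build {f = f} {xs} _ e x∈) = trans (V.value e x∈) (cong (fun f)
          (trans (Vec.map-cong (λ x → V.~-sound rep-~) xs) (Vec.map-∘ v rep xs)))
        one (link _ _ _)     = V.~-sound rep-~
        one (bound _ _ _ φ)  = V.Fin*-sound φ

      -- The solution of γ with the values of v at representatives solves β too,
      -- so v agrees with it by uniqueness.  This is where axiom [3] is needed: from
      -- x = f(x) ∧ y = f(y) alone, congruence does not give x = y.
      β-complete : ∀ {v} → v ⊨ β → ∃ λ w → w ⊨ γ × (∀ {u} → u ∈ U → w u ≡ v u)
      β-complete {v} v⊨β = E.v , E.v⊨γ , λ u∈ → sym (agree (∈-++⁺ˡ u∈))
        where
        holds-β : ∀ {z a} → z ∈ kept → emit z ≡ just a → v ⊨ₐ a
        holds-β z∈ e = All.lookup v⊨β (collect⁺ emit z∈ e)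

        default : ∀ {P : Set} → Dec P → Carrier → Carrier
        default (yes _) a = a
        default (no _)  _ = point

        q : Var → Carrier
        -- A class whose representative was dropped is not constrained by `v`; `point` is finite and
        -- so meets any finiteness demand on it.
        q z = default (em {P = rep z ∈ kept}) (v (rep z))

        q-resp : ∀ {x y} → x ~ y → ¬ Fun x → q x ≡ q y
        q-resp e _ rewrite rep-cong e = refl

        q-fin : ∀ {x} → Fin* x → ¬ Fun x → Finite (q x)
        q-fin {x} φ ¬f with em {P = rep x ∈ kept}
        ... | no _   = point-finite
        ... | yes r∈ with emits (rep x) in e
        ...   | _ , keep a∈ s       = ⊥-elim (Fixed-minimal (¬f ∘ Fun-resp (~sym rep-~)) (_ , a∈ , s))
        ...   | _ , build _ r~ r∈γ  = ⊥-elim (¬f (Fun-resp (~sym rep-~) (_ , _ , r~ , r∈γ)))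
        ...   | _ , link _ _ r≢     = ⊥-elim (r≢ (sym rep-idem))
        ...   | _ , bound _ _ _ _   = holds-β r∈ (cong proj₁ e)
        ...   | _ , none _ _ _ ¬φ   = ⊥-elim (¬φ (cong* φ rep-~))

        module E = Extension cons q q-resp q-fin

        w = E.v

        w⊨β : w ⊨ β
        w⊨β = β-sound E.v⊨γ

        q-kept : ∀ {z} → z ∈ kept → q z ≡ v (rep z)
        q-kept {z} z∈ with em {P = rep z ∈ kept}
        ... | yes _  = refl
        ... | no ¬r∈ = ⊥-elim (¬r∈ (rep-kept (kept⊆ns z∈) (kept-reached z∈)))

        v-rep : ∀ {z} → z ∈ kept → ¬ Fun z → ¬ Fixed z → v z ≡ v (rep z)
        v-rep {z} z∈ ¬f ¬k with emits z in e
        ... | _ , keep a∈ s       = ⊥-elim (¬k (_ , a∈ , s))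
        ... | _ , build _ z~ x∈   = ⊥-elim (¬f (_ , _ , z~ , x∈))
        ... | _ , link _ _ _      = holds-β z∈ (cong proj₁ e)
        ... | _ , bound _ _ z≡ _  = cong v z≡
        ... | _ , none _ _ z≡ _   = cong v z≡

        -- By `flat₀` the right side of an inherited variable equation is not fixed itself, so a
        -- single step along that equation reaches the case already settled.
        v-rep′ : ∀ {z} → z ∈ kept → ¬ Fun z → v z ≡ v (rep z)
        v-rep′ {z} z∈ ¬f with em {P = Fixed z}
        ... | no ¬k = v-rep z∈ ¬f ¬k
        ... | yes (x ≃ y , a∈ , refl) = trans (All.lookup v⊨β (α₀⊆β a∈)) (trans
                (v-rep (∈-++⁺ˡ (nodes₀ a∈ (there (here refl)))) (¬f ∘ Fun-resp (~sym (base (α₀⊆γ a∈))))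
                       (λ (_ , b∈ , s) → flat₀ a∈ b∈ s))
                (cong v (sym (rep-cong (base (α₀⊆γ a∈))))))
        ... | yes (x ≔ a , a∈ , refl) = ⊥-elim (¬f (x , a , ~refl , α₀⊆γ a∈))
        ... | yes (fin x , a∈ , refl) = ⊥-elim (no-fin a∈)

        Φ = equationsOf β

        Linked : Var → Set
        Linked z = v z ≡ w z ⊎ ∃ λ y → (∃ λ a → (y , a) ∈ Φ) × v z ≡ v y × w z ≡ w y

        unfixed : ∀ {z} → z ∈ kept → Fun z → ¬ Fixed z → ∃ λ a → (z , a) ∈ Φ
        unfixed {z} z∈ f ¬k with emits z in e
        ... | _ , keep a∈ s      = ⊥-elim (¬k (_ , a∈ , s))
        ... | _ , build _ _ _    = _ , equationsOf⁺ (collect⁺ emit z∈ (cong proj₁ e))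
        ... | _ , link _ ¬f _    = ⊥-elim (¬f f)
        ... | _ , bound _ ¬f _ _ = ⊥-elim (¬f f)
        ... | _ , none _ ¬f _ _  = ⊥-elim (¬f f)

        linked : ∀ {z} → z ∈ kept → Linked z
        linked {z} z∈ with em {P = Fun z} | em {P = Fixed z}
        ... | no ¬f | _     = inj₁ (trans (v-rep′ z∈ ¬f) (sym (trans (E.v-nonfun ¬f) (q-kept z∈))))
        ... | yes f | no ¬k = inj₂ (z , unfixed z∈ f ¬k , refl , refl)
        ... | yes f | yes (x ≃ y , a∈ , refl) = inj₂ (y ,
                unfixed (∈-++⁺ˡ (nodes₀ a∈ (there (here refl)))) (Fun-resp (base (α₀⊆γ a∈)) f)
                        (λ (_ , b∈ , s) → flat₀ a∈ b∈ s) ,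
                All.lookup v⊨β (α₀⊆β a∈) , All.lookup w⊨β (α₀⊆β a∈))
        ... | yes f | yes (x ≔ a , a∈ , refl) = inj₂ (x , (a , equationsOf⁺ (α₀⊆β a∈)) , refl , refl)
        ... | yes f | yes (fin x , a∈ , refl) = ⊥-elim (no-fin a∈)

        agree : ∀ {z} → z ∈ kept → v z ≡ w z
        agree z∈ with linked z∈
        ... | inj₁ e = e
        ... | inj₂ (y , (_ , y∈) , e , e′) = trans e (trans (unique-equations Φ
                (All.lookup v⊨β ∘ equationsOf⁻ β) (All.lookup w⊨β ∘ equationsOf⁻ β)
                (λ {x} {f} {xs} e∈ i → linked (β-nodes (equationsOf⁻ β e∈) (there (∈-lookupⱽ xs i)))) y∈) (sym e′))

  -- Naming bound variables

  -- `compare` decides `_≻_`, so `tri<` means that `x` is the larger variable and goes further back.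
  -- Lists are increasing along `_≻_`, and duplicates vanish.
  insert : Var → List Var → List Var
  insert x []       = x ∷ []
  insert x (y ∷ ys) with compare x y
  ... | tri< _ _ _ = y ∷ insert x ys
  ... | tri≈ _ _ _ = y ∷ ys
  ... | tri> _ _ _ = x ∷ y ∷ ys

  ∈-insert⁻ : ∀ {z} x xs → z ∈ insert x xs → z ≡ x ⊎ z ∈ xs
  ∈-insert⁻ x []       (here e) = inj₁ e
  ∈-insert⁻ x (y ∷ ys) z∈ with compare x y
  ∈-insert⁻ x (y ∷ ys) (here e)   | tri< _ _ _ = inj₂ (here e)
  ∈-insert⁻ x (y ∷ ys) (there z∈) | tri< _ _ _ = Sum.map id there (∈-insert⁻ x ys z∈)
  ∈-insert⁻ x (y ∷ ys) z∈         | tri≈ _ _ _ = inj₂ z∈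
  ∈-insert⁻ x (y ∷ ys) (here e)   | tri> _ _ _ = inj₁ e
  ∈-insert⁻ x (y ∷ ys) (there z∈) | tri> _ _ _ = inj₂ z∈

  ∈-insert⁺ : ∀ {z} x xs → z ≡ x ⊎ z ∈ xs → z ∈ insert x xs
  ∈-insert⁺ x []       (inj₁ e) = here e
  ∈-insert⁺ x (y ∷ ys) z∈ with compare x y
  ∈-insert⁺ x (y ∷ ys) (inj₁ e)          | tri< _ _ _ = there (∈-insert⁺ x ys (inj₁ e))
  ∈-insert⁺ x (y ∷ ys) (inj₂ (here e))   | tri< _ _ _ = here e
  ∈-insert⁺ x (y ∷ ys) (inj₂ (there z∈)) | tri< _ _ _ = there (∈-insert⁺ x ys (inj₂ z∈))
  ∈-insert⁺ x (y ∷ ys) (inj₁ e)          | tri≈ _ x≡y _ = here (trans e x≡y)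
  ∈-insert⁺ x (y ∷ ys) (inj₂ z∈)         | tri≈ _ _ _ = z∈
  ∈-insert⁺ x (y ∷ ys) (inj₁ e)          | tri> _ _ _ = here e
  ∈-insert⁺ x (y ∷ ys) (inj₂ z∈)         | tri> _ _ _ = there z∈

  insert-sorted : ∀ x {xs} → Sorted xs → Sorted (insert x xs)
  insert-sorted x []             = [] ∷ []
  insert-sorted x {y ∷ ys} (p ∷ ps) with compare x y
  ... | tri< x≻y _ _ = All.tabulate (λ z∈ → [ (λ { refl → x≻y }) , All.lookup p ]′ (∈-insert⁻ x ys z∈)) ∷ insert-sorted x ps
  ... | tri≈ _ _ _   = p ∷ ps
  ... | tri> _ _ y≻x = (y≻x ∷ All.map (λ z≻y → ≻-trans z≻y y≻x) p) ∷ p ∷ ps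

  sort : List Var → List Var
  sort = List.foldr insert []

  sort-sorted : ∀ xs → Sorted (sort xs)
  sort-sorted []       = []
  sort-sorted (x ∷ xs) = insert-sorted x (sort-sorted xs)

  ∈-sort⁺ : ∀ {z xs} → z ∈ xs → z ∈ sort xs
  ∈-sort⁺ {xs = x ∷ xs} (here e)   = ∈-insert⁺ x (sort xs) (inj₁ e)
  ∈-sort⁺ {xs = x ∷ xs} (there z∈) = ∈-insert⁺ x (sort xs) (inj₂ (∈-sort⁺ z∈))

  ∈-sort⁻ : ∀ {z} xs → z ∈ sort xs → z ∈ xs
  ∈-sort⁻ (x ∷ xs) z∈ = [ here , there ∘ ∈-sort⁻ xs ]′ (∈-insert⁻ x (sort xs) z∈)

  varsOf : Formula → List Var
  varsOf true             = []
  varsOf false            = []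
  varsOf (s ≐ t)          = varsᵗ s ++ varsᵗ t
  varsOf (finite t)       = varsᵗ t
  varsOf (neg φ)          = varsOf φ
  varsOf (binary _ φ ψ)   = varsOf φ ++ varsOf ψ
  varsOf (quantify _ _ φ) = varsOf φ

  ∈-varsOf : ∀ φ {x} → x ∈FV φ → x ∈ varsOf φ
  ∈-varsOf (s ≐ t)          = [ ∈-++⁺ˡ ∘ ∈ᵗ⇒∈varsᵗ , ∈-++⁺ʳ (varsᵗ s) ∘ ∈ᵗ⇒∈varsᵗ ]′
  ∈-varsOf (finite t)       = ∈ᵗ⇒∈varsᵗ
  ∈-varsOf (neg φ)          = ∈-varsOf φ
  ∈-varsOf (binary _ φ ψ)   = [ ∈-++⁺ˡ ∘ ∈-varsOf φ , ∈-++⁺ʳ (varsOf φ) ∘ ∈-varsOf ψ ]′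
  ∈-varsOf (quantify _ _ φ) = ∈-varsOf φ ∘ proj₂

  freeVars : Formula → List Var
  freeVars φ = sort (filter (λ x → em {P = x ∈FV φ}) (varsOf φ))

  freeVars-sorted : ∀ φ → Sorted (freeVars φ)
  freeVars-sorted φ = sort-sorted (filter (λ x → em {P = x ∈FV φ}) (varsOf φ))

  ∈-freeVars⁺ : ∀ φ {x} → x ∈FV φ → x ∈ freeVars φ
  ∈-freeVars⁺ φ x∈ = ∈-sort⁺ (∈-filter⁺ (λ x → em {P = x ∈FV φ}) (∈-varsOf φ x∈) x∈)

  ∈-freeVars⁻ : ∀ φ {x} → x ∈ freeVars φ → x ∈FV φ
  ∈-freeVars⁻ φ x∈ = proj₂ (∈-filter⁻ (λ x → em {P = x ∈FV φ}) {xs = varsOf φ} (∈-sort⁻ _ x∈))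

  Above : List Var → List Var → Set
  Above L ȳ = ∀ {y l} → y ∈ ȳ → l ∈ L → y ≻ l

  upperBound : ∀ L → ∃ λ x → ∀ {l} → l ∈ L → x ≻ l
  upperBound []      = Inverse.from countablyInfinite 0 , λ ()
  upperBound (l ∷ L) with upperBound L
  ... | x , x≻ with compare x l
  ...   | tri< x≻l _ _ = x , λ { (here refl) → x≻l ; (there l∈) → x≻ l∈ }
  ...   | tri≈ _ refl _ with unboundedAbove x
  ...     | z , z≻ = z , λ { (here refl) → z≻ ; (there l∈) → ≻-trans z≻ (x≻ l∈) }
  upperBound (l ∷ L) | x , x≻ | tri> _ _ l≻x with unboundedAbove l
  ...     | z , z≻ = z , λ { (here refl) → z≻ ; (there l∈) → ≻-trans z≻ (≻-trans l≻x (x≻ l∈)) }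

  record Naming {A : Set} (L : List Var) (bs : List A) : Set where
    field
      nameOf     : A → Var
      names     : List Var
      sorted    : Sorted names
      above     : Above L names
      covers    : ∀ {b} → b ∈ bs → nameOf b ∈ names
      name-injective : ∀ {b c} → b ∈ bs → c ∈ bs → nameOf b ≡ nameOf c → b ≡ c

  -- Each name is taken above `L` and above all names before it, so the list is increasing and
  -- distinct elements of `bs` get distinct names.
  naming : ∀ {A : Set} L (bs : List A) → Naming L bs
  naming L []       = record
    { nameOf = λ _ → Inverse.from countablyInfinite 0 ; names = [] ; sorted = [] ; above = λ ()
    ; covers = λ () ; name-injective = λ () }
  naming {A} L (b₀ ∷ bs) with upperBound L
  ... | x , x≻ = record
    { nameOf = ν ; names = x ∷ names ; sorted = All.tabulate (λ y∈ → above y∈ (here refl)) ∷ sorted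
    ; above = λ { (here refl) l∈ → x≻ l∈ ; (there y∈) l∈ → above y∈ (there l∈) }
    ; covers = covers′ ; name-injective = injective′ }
    where
    open Naming (naming (x ∷ L) bs)
    ν : A → Var
    ν b with em {P = b ≡ b₀}
    ... | yes _ = x
    ... | no _  = nameOf b
    tail : ∀ {b} → b ∈ b₀ ∷ bs → b ≢ b₀ → b ∈ bs
    tail (here e)   b≢ = ⊥-elim (b≢ e)
    tail (there b∈) _  = b∈
    covers′ : ∀ {b} → b ∈ b₀ ∷ bs → ν b ∈ x ∷ names
    covers′ {b} b∈ with em {P = b ≡ b₀}
    ... | yes _ = here refl
    ... | no b≢ = there (covers (tail b∈ b≢))
    x≢ : ∀ {b} → b ∈ bs → x ≢ nameOf b
    x≢ b∈ e = irrefl (sym e) (above (covers b∈) (here refl))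
    injective′ : ∀ {b c} → b ∈ b₀ ∷ bs → c ∈ b₀ ∷ bs → ν b ≡ ν c → b ≡ c
    injective′ {b} {c} b∈ c∈ e with em {P = b ≡ b₀} | em {P = c ≡ b₀}
    ... | yes p | yes q = trans p (sym q)
    ... | yes _ | no q  = ⊥-elim (x≢ (tail c∈ q) e)
    ... | no p  | yes _ = ⊥-elim (x≢ (tail b∈ p) (sym e))
    ... | no p  | no q  = name-injective (tail b∈ p) (tail c∈ q) e

  bound? : ∀ {A : Set} → A ⊎ Bound → Maybe Bound
  bound? (inj₁ _) = nothing
  bound? (inj₂ b) = just b

  boundNames : ∀ {A} → Block∃ A → List Bound
  boundNames β = collect bound? (List.concatMap nodes β)

  ∈-boundNames : ∀ {A} {β : Block∃ A} {a b} → a ∈ β → inj₂ b ∈ nodes a → b ∈ boundNames β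
  ∈-boundNames a∈ b∈ = collect⁺ bound? (∈-concatMap⁺ nodes (Any.map (λ { refl → b∈ }) a∈)) refl

  toList-map⁻ : ∀ {A B : Set} (g : A → B) {n} (xs : Vec A n) {y} → y ∈ toList (Vec.map g xs) →
    ∃ λ x → x ∈ toList xs × y ≡ g x
  toList-map⁻ g (x ∷ xs) (here e)   = x , here refl , e
  toList-map⁻ g (x ∷ xs) (there y∈) with toList-map⁻ g xs y∈
  ... | z , z∈ , e = z , there z∈ , e

  nodes-map⁻ : ∀ {M N : Set} (g : M → N) a {y} → y ∈ nodes (mapConstraint g a) → ∃ λ z → z ∈ nodes a × y ≡ g z
  nodes-map⁻ g (x ≃ y)        (here e)           = x , here refl , e
  nodes-map⁻ g (x ≃ y)        (there (here e))   = y , there (here refl) , e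
  nodes-map⁻ g (x ≔ (f , xs)) (here e)           = x , here refl , e
  nodes-map⁻ g (x ≔ (f , xs)) (there y∈) with toList-map⁻ g xs y∈
  ... | z , z∈ , e = z , there z∈ , e
  nodes-map⁻ g (fin x)        (here e)           = x , here refl , e

  equationPart : Constraints Var → Constraints Var
  equationPart []            = []
  equationPart (fin _ ∷ α)   = equationPart α
  equationPart ((x ≃ y) ∷ α) = (x ≃ y) ∷ equationPart α
  equationPart ((x ≔ a) ∷ α) = (x ≔ a) ∷ equationPart α

  equationPart⊆ : ∀ α → equationPart α ⊆ α
  equationPart⊆ (fin _ ∷ α)   a∈         = there (equationPart⊆ α a∈)
  equationPart⊆ ((_ ≃ _) ∷ α) (here e)   = here e
  equationPart⊆ ((_ ≃ _) ∷ α) (there a∈) = there (equationPart⊆ α a∈)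
  equationPart⊆ ((_ ≔ _) ∷ α) (here e)   = here e
  equationPart⊆ ((_ ≔ _) ∷ α) (there a∈) = there (equationPart⊆ α a∈)

  equationPart-no-fin : ∀ α {x a} → a ∈ equationPart α → a ≢ fin x
  equationPart-no-fin (fin _ ∷ α)   a∈          e    = equationPart-no-fin α a∈ e
  equationPart-no-fin ((_ ≃ _) ∷ α) (here refl) ()
  equationPart-no-fin ((_ ≃ _) ∷ α) (there a∈)  e    = equationPart-no-fin α a∈ e
  equationPart-no-fin ((_ ≔ _) ∷ α) (here refl) ()
  equationPart-no-fin ((_ ≔ _) ∷ α) (there a∈)  e    = equationPart-no-fin α a∈ e

  equations-toBasic : ∀ α {a} → a ∈ equations (toBasic α) → a ∈ toBasic (equationPart α)
  equations-toBasic (fin _ ∷ α)   a∈         = equations-toBasic α a∈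
  equations-toBasic ((_ ≃ _) ∷ α) (here e)   = here e
  equations-toBasic ((_ ≃ _) ∷ α) (there a∈) = there (equations-toBasic α a∈)
  equations-toBasic ((_ ≔ _) ∷ α) (here e)   = here e
  equations-toBasic ((_ ≔ _) ∷ α) (there a∈) = there (equations-toBasic α a∈)

  ≈∈equationPart : ∀ α {x t} → (x ≈ t) ∈ toBasic α → (x ≈ t) ∈ toBasic (equationPart α)
  ≈∈equationPart (fin _ ∷ α)   (there a∈) = ≈∈equationPart α a∈
  ≈∈equationPart ((_ ≃ _) ∷ α) (here e)   = here e
  ≈∈equationPart ((_ ≃ _) ∷ α) (there a∈) = there (≈∈equationPart α a∈)
  ≈∈equationPart ((_ ≔ _) ∷ α) (here e)   = here e
  ≈∈equationPart ((_ ≔ _) ∷ α) (there a∈) = there (≈∈equationPart α a∈)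

  toBasic-⊆ : ∀ {α β} → α ⊆ β → toBasic α ⊆ toBasic β
  toBasic-⊆ α⊆β a∈ with ∈-map⁻ toAtom a∈
  ... | b , b∈ , refl = ∈-map⁺ toAtom (α⊆β b∈)

  subject-toAtom : ∀ a → subject (toAtom a) ≡ subjectOf a
  subject-toAtom (x ≃ y) = refl
  subject-toAtom (x ≔ a) = refl
  subject-toAtom (fin x) = refl

  module Local (𝓜 : Structure) (model : Model 𝓜) where
    open Structure 𝓜
    open Axioms 𝓜 model
    open Coincidence 𝓜
    open Solutions 𝓜 model
    open Correctness 𝓜 model

    ⊨-local : ∀ {N : Set} {v w : N → Carrier} {β} → (∀ {a z} → a ∈ β → z ∈ nodes a → v z ≡ w z) → v ⊨ β → w ⊨ β
    ⊨-local {v = v} {w} e v⊨β = All.tabulate λ {a} a∈ → one a (e a∈) (All.lookup v⊨β a∈)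
      where
      one : ∀ a → (∀ {z} → z ∈ nodes a → v z ≡ w z) → v ⊨ₐ a → w ⊨ₐ a
      one (x ≃ y)        e s = trans (sym (e (here refl))) (trans s (e (there (here refl))))
      one (x ≔ (f , xs)) e s = trans (sym (e (here refl))) (trans s (cong (fun f)
        (map-≡ xs xs λ i → e (there (∈-lookupⱽ xs i)))))
      one (fin x)        e s = subst Finite (e (here refl)) s

    atom-correct : ∀ {v} a → Sat 𝓜 v (atom (toAtom a)) ⟺ (v ⊨ₐ a)
    atom-correct     (x ≃ y)        = id , id
    atom-correct {v} (x ≔ (f , xs)) = (λ s → trans s (eval-apply v xs)) , (λ s → trans s (sym (eval-apply v xs)))
    atom-correct     (fin x)        = id , id

    basic-correct : ∀ {v} β → Sat 𝓜 v (basic (toBasic β)) ⟺ (v ⊨ β)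
    basic-correct []      = (λ _ → []) , _
    basic-correct (a ∷ β) with atom-correct a | basic-correct β
    ... | f , g | f′ , g′ = (λ { (s , t) → f s ∷ f′ t }) , λ { (s ∷ t) → g s , g′ t }

    -- A solution may disagree with `ρ` on unrelated variables; resetting it outside `ȳ` makes it a
    -- legitimate witness for `∃* ȳ`.
    override : ∀ {ρ w : Valuation 𝓜} {U ȳ β} → Above U ȳ → (∀ {a} → a ∈ β → nodes a ⊆ U ++ ȳ) →
      (∀ {u} → u ∈ U → w u ≡ ρ u) → w ⊨ β → ∃ λ σ → (∀ {z} → z ∉ ȳ → σ z ≡ ρ z) × σ ⊨ β
    override {ρ} {w} {U} {ȳ} {β} above nodes⊆ w≡ρ w⊨β = σ , off , ⊨-local same w⊨β
      where
      σ : Valuation 𝓜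
      σ z with em {P = z ∈ ȳ}
      ... | yes _ = w z
      ... | no _  = ρ z
      off : ∀ {z} → z ∉ ȳ → σ z ≡ ρ z
      off {z} z∉ with em {P = z ∈ ȳ}
      ... | yes z∈ = ⊥-elim (z∉ z∈)
      ... | no _   = refl
      same : ∀ {a z} → a ∈ β → z ∈ nodes a → w z ≡ σ z
      same {z = z} a∈ z∈ with em {P = z ∈ ȳ}
      ... | yes _ = refl
      ... | no z∉ = [ w≡ρ , (λ z∈ȳ → ⊥-elim (z∉ z∈ȳ)) ]′ (∈-++⁻ U (nodes⊆ a∈ z∈))

    block-correct : ∀ {v U ȳ β} → Above U ȳ → (∀ {a} → a ∈ β → nodes a ⊆ U ++ ȳ) →
      Sat 𝓜 v (∃* ȳ (basic (toBasic β))) ⟺ (∃ λ w → (∀ {u} → u ∈ U → w u ≡ v u) × w ⊨ β)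
    block-correct {v} {U} {ȳ} {β} above nodes⊆ = to , from
      where
      to : Sat 𝓜 v (∃* ȳ (basic (toBasic β))) → ∃ λ w → (∀ {u} → u ∈ U → w u ≡ v u) × w ⊨ β
      to s with ∃*-elim ȳ s
      ... | w , w≡ , t = w , (λ u∈ → w≡ (λ u∈ȳ → irrefl refl (above u∈ȳ u∈))) , proj₁ (basic-correct β) t
      from : (∃ λ w → (∀ {u} → u ∈ U → w u ≡ v u) × w ⊨ β) → Sat 𝓜 v (∃* ȳ (basic (toBasic β)))
      from (w , w≡ , w⊨) with override above nodes⊆ w≡ w⊨
      ... | σ , σ≡ , σ⊨ = ∃*-intro ȳ σ σ≡ (proj₂ (basic-correct β) σ⊨)

  -- Solving a block relative to a solved context

  module _ (p : Formula) where

    W = freeVars p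

    freeVar∈W : ∀ (x : FV p) → FV.freeVar x ∈ W
    freeVar∈W x = ∈-freeVars⁺ p (FV.isFree x)

    -- One notion serves twice: the outer block is solved over the free variables of `p` with no
    -- constraints, and its exceptions over the context that the solved outer block provides.
    record SolvedContext : Set where
      field
        U         : List Var
        α         : Constraints Var
        W⊆U       : W ⊆ U
        U-sorted  : Sorted U
        nodesα    : ∀ {a} → a ∈ α → nodes a ⊆ U
        distinctα : ∀ {a b} → a ∈ α → b ∈ α → subjectOf a ≡ subjectOf b → a ≡ b
        orientedα : ∀ {x y} → (x ≃ y) ∈ α → x ≻ y
        flatα     : ∀ {x y a} → (x ≃ y) ∈ α → a ∈ α → (∀ {z} → a ≢ fin z) → subjectOf a ≢ y

    module _ (Γ : SolvedContext) where
      open SolvedContext Γ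

      record SolvedBlock (β : Block∃ (FV p)) (L : List Var) : Set₁ where
        field
          ȳ         : List Var
          β₁        : Constraints Var
          ȳ-sorted  : Sorted ȳ
          ȳ-above   : Above L ȳ
          nodesβ    : ∀ {a} → a ∈ β₁ → nodes a ⊆ U ++ ȳ
          distinctβ : ∀ {a b} → a ∈ β₁ → b ∈ β₁ → subjectOf a ≡ subjectOf b → a ≡ b
          orientedβ : ∀ {x y} → (x ≃ y) ∈ β₁ → x ≻ y
          flatβ     : (∀ {a} → a ∉ α) → ∀ {x y a} → (x ≃ y) ∈ β₁ → a ∈ β₁ → (∀ {z} → a ≢ fin z) → subjectOf a ≢ y
          extendsα  : equationPart α ⊆ β₁
          reachableβ : ∀ {y} → y ∈ ȳ → ∃ λ u → u ∈ U × Reach (toBasic β₁) u y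
          coveredβ  : ∀ {u v} → fin u ∈ α → Reach (toBasic β₁) u v → ¬ (v isLhsIn toBasic β₁) → finite v ∈ toBasic β₁
          correct   : ∀ 𝓜 (model : Model 𝓜) (v : Valuation 𝓜) → Solutions._⊨_ 𝓜 model v α →
            (∃ λ w → (∀ {u} → u ∈ U → w u ≡ v u) × Solutions._⊨_ 𝓜 model w β₁) ⟺
            Correctness.⟦_⟧ᴮ 𝓜 model β (v ∘ FV.freeVar)

      module Realise (β : Block∃ (FV p)) (L : List Var) (U⊆L : U ⊆ L) where
        open Naming (naming L (boundNames β)) public

        varOf : FV p ⊎ Bound → Var
        varOf = [ FV.freeVar , nameOf ]′

        γ : Constraints Var
        γ = α ++ rename varOf β

        sortedUȳ : Sorted (U ++ names)
        sortedUȳ = AllPairs.++⁺ U-sorted sorted (All.tabulate λ u∈ → All.tabulate λ y∈ → above y∈ (U⊆L u∈))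

        nodesγ : ∀ {a} → a ∈ γ → nodes a ⊆ U ++ names
        nodesγ a∈ z∈ with ∈-++⁻ α a∈
        ... | inj₁ a∈α = ∈-++⁺ˡ (nodesα a∈α z∈)
        ... | inj₂ a∈β with ∈-map⁻ (mapConstraint varOf) a∈β
        ...   | b , b∈ , refl with nodes-map⁻ varOf b z∈
        ...     | inj₁ x , _  , refl = ∈-++⁺ˡ (W⊆U (freeVar∈W x))
        ...     | inj₂ c , c∈ , refl = ∈-++⁺ʳ U (covers (∈-boundNames {β = β} b∈ c∈))

        module _ (𝓜 : Structure) (model : Model 𝓜) where
          open Structure 𝓜
          open Solutions 𝓜 model
          open Correctness 𝓜 model
          open Local 𝓜 model

          realise : ∀ {v : Valuation 𝓜} → v ⊨ α → ⟦ β ⟧ᴮ (v ∘ FV.freeVar) → ∃ λ w → (∀ {u} → u ∈ U → w u ≡ v u) × w ⊨ γ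
          realise {v} v⊨α (e , s) = w , w≡v ,
            All.++⁺ (⊨-local (λ a∈ z∈ → sym (w≡v (nodesα a∈ z∈))) v⊨α)
                    (rename⁺ (λ _ → refl) (⊨-local same s))
            where
            w : Valuation 𝓜
            w z with em {P = ∃ λ b → b ∈ boundNames β × nameOf b ≡ z}
            ... | yes (b , _) = e b
            ... | no _        = v z
            w≡v : ∀ {u} → u ∈ U → w u ≡ v u
            w≡v {u} u∈ with em {P = ∃ λ b → b ∈ boundNames β × nameOf b ≡ u}
            ... | yes (b , b∈ , refl) = ⊥-elim (irrefl refl (above (covers b∈) (U⊆L u∈)))
            ... | no _                = refl
            same : ∀ {a z} → a ∈ β → z ∈ nodes a → [ v ∘ FV.freeVar , e ]′ z ≡ w (varOf z)
            same {z = inj₁ x} a∈ z∈ = sym (w≡v (W⊆U (freeVar∈W x)))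
            same {z = inj₂ c} a∈ z∈ with em {P = ∃ λ b → b ∈ boundNames β × nameOf b ≡ nameOf c}
            ... | yes (b , b∈ , eq) = cong e (sym (name-injective b∈ (∈-boundNames {β = β} a∈ z∈) eq))
            ... | no ¬b             = ⊥-elim (¬b (c , ∈-boundNames {β = β} a∈ z∈ , refl))

          unrealise : ∀ {v w : Valuation 𝓜} → (∀ {u} → u ∈ U → w u ≡ v u) → w ⊨ γ → ⟦ β ⟧ᴮ (v ∘ FV.freeVar)
          unrealise {v} {w} w≡v w⊨γ = w ∘ nameOf , rename⁻ same (All.++⁻ʳ α w⊨γ)
            where
            same : ∀ z → w (varOf z) ≡ [ v ∘ FV.freeVar , w ∘ nameOf ]′ z
            same (inj₁ x) = w≡v (W⊆U (freeVar∈W x))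
            same (inj₂ _) = refl

      Inconsistent : Block∃ (FV p) → Set₁
      Inconsistent β = ∀ 𝓜 (model : Model 𝓜) v → Solutions._⊨_ 𝓜 model v α → ¬ Correctness.⟦_⟧ᴮ 𝓜 model β (v ∘ FV.freeVar)

      -- Consistency is decided once, outside all models: a solution in any single one would already
      -- imply it, so its failure refutes the block, given `α`, in every model.
      solveBlock : ∀ β L → U ⊆ L → Inconsistent β ⊎ SolvedBlock β L
      solveBlock β L U⊆L = decide em
        where
        open Realise β L U⊆L
        decide : Dec (Closure.Consistent γ) → Inconsistent β ⊎ SolvedBlock β L
        decide (no ¬cons) = inj₁ λ 𝓜 model v v⊨α s →
          ¬cons (Solutions.consistent 𝓜 model (proj₂ (proj₂ (realise 𝓜 model v⊨α s))))
        decide (yes cons) = inj₂ record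
          { ȳ = S.ȳ′ ; β₁ = S.β
          ; ȳ-sorted = AllPairs.filter⁺ S.chosen? sorted
          ; ȳ-above = λ y∈ → above (S.ȳ′⊆ȳ y∈)
          ; nodesβ = S.β-nodes ; distinctβ = S.β-distinct ; orientedβ = S.β-oriented
          ; flatβ = λ empty → S.β-flat (empty ∘ equationPart⊆ α)
          ; extendsα = S.α₀⊆β
          ; reachableβ = λ y∈ → S.reachable (S.kept-reached (∈-++⁺ʳ U y∈)) (∈-++⁺ʳ U y∈) Closure.~refl
          ; coveredβ = λ u∈ → S.covered (Closure.base (∈-++⁺ˡ u∈)) (∈-++⁺ˡ (nodesα u∈ (here refl)))
          ; correct = λ 𝓜 model v v⊨α →
              (λ { (w , w≡v , w⊨β) → let (w′ , w′⊨γ , w′≡w) = S.Semantics.β-complete 𝓜 model w⊨β in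
                   unrealise 𝓜 model (λ u∈ → trans (w′≡w u∈) (w≡v u∈)) w′⊨γ }) ,
              (λ s → let (w , w≡v , w⊨γ) = realise 𝓜 model v⊨α s in w , w≡v , S.Semantics.β-sound 𝓜 model w⊨γ) }
          where
          module S = Solve U names sortedUȳ (equationPart α) γ (∈-++⁺ˡ ∘ equationPart⊆ α)
            (λ x∈ → equationPart-no-fin α x∈ refl)
            (λ a∈ b∈ → distinctα (equationPart⊆ α a∈) (equationPart⊆ α b∈))
            (orientedα ∘ equationPart⊆ α)
            (λ x∈ a∈ → flatα (equationPart⊆ α x∈) (equationPart⊆ α a∈) (equationPart-no-fin α a∈))
            (nodesα ∘ equationPart⊆ α) nodesγ cons

  -- Assembling the explicit solved form

  quantified-∃* : ∀ x̄ {φ} → quantified (∃* x̄ φ) ≡ x̄ ++ quantified φ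
  quantified-∃* []      = refl
  quantified-∃* (x ∷ x̄) = cong (x ∷_) (quantified-∃* x̄)

  quantified-basic : ∀ α → quantified (basic (toBasic α)) ≡ []
  quantified-basic []            = refl
  quantified-basic ((x ≃ y) ∷ α) = quantified-basic α
  quantified-basic ((x ≔ a) ∷ α) = quantified-basic α
  quantified-basic (fin x ∷ α)   = quantified-basic α

  quantified-block : ∀ ȳ β → quantified (∃* ȳ (basic (toBasic β))) ≡ ȳ
  quantified-block ȳ β = trans (quantified-∃* ȳ) (trans (cong (ȳ ++_) (quantified-basic β)) (++-identityʳ ȳ))

  -- `Ok S φ`: the free variables of φ lie in S, and every quantified variable
  -- exceeds all variables in scope at its quantifier.
  Ok : (Var → Set) → Formula → Set
  Ok S true             = ⊤
  Ok S false            = ⊤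
  Ok S (s ≐ t)          = ∀ {x} → x ∈ᵗ s ⊎ x ∈ᵗ t → S x
  Ok S (finite t)       = ∀ {x} → x ∈ᵗ t → S x
  Ok S (neg φ)          = Ok S φ
  Ok S (binary _ φ ψ)   = Ok S φ × Ok S ψ
  Ok S (quantify _ x φ) = (∀ {y} → S y → x ≻ y) × Ok (λ y → S y ⊎ y ≡ x) φ

  Ok-resp : ∀ φ {S S′} → (∀ {x} → S x → S′ x) → (∀ {x} → S′ x → S x) → Ok S φ → Ok S′ φ
  Ok-resp true             to from ok = tt
  Ok-resp false            to from ok = tt
  Ok-resp (s ≐ t)          to from ok = to ∘ ok
  Ok-resp (finite t)       to from ok = to ∘ ok
  Ok-resp (neg φ)          to from ok = Ok-resp φ to from ok
  Ok-resp (binary _ φ ψ)   to from (ok , ok′) = Ok-resp φ to from ok , Ok-resp ψ to from ok′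
  Ok-resp (quantify _ x φ) to from (x≻ , ok) =
    (x≻ ∘ from) , Ok-resp φ (Sum.map to id) (Sum.map from id) ok

  Ok-FV : ∀ φ {S x} → Ok S φ → x ∈FV φ → S x
  Ok-FV (s ≐ t)          ok x∈ = ok x∈
  Ok-FV (finite t)       ok x∈ = ok x∈
  Ok-FV (neg φ)          ok x∈ = Ok-FV φ ok x∈
  Ok-FV (binary _ φ ψ)   (ok , ok′) = [ Ok-FV φ ok , Ok-FV ψ ok′ ]′
  Ok-FV (quantify _ y φ) (_ , ok) (x≢y , x∈) = [ id , (λ x≡y → ⊥-elim (x≢y x≡y)) ]′ (Ok-FV φ ok x∈)

  Ok-quantified : ∀ φ {S x y} → Ok S φ → x ∈ quantified φ → S y → x ≻ y
  Ok-quantified (neg φ)          ok x∈ Sy = Ok-quantified φ ok x∈ Sy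
  Ok-quantified (binary _ φ ψ)   (ok , ok′) x∈ Sy with ∈-++⁻ (quantified φ) x∈
  ... | inj₁ x∈φ = Ok-quantified φ ok x∈φ Sy
  ... | inj₂ x∈ψ = Ok-quantified ψ ok′ x∈ψ Sy
  Ok-quantified (quantify _ x φ) (x≻ , ok) (here refl) Sy = x≻ Sy
  Ok-quantified (quantify _ x φ) (x≻ , ok) (there x∈)  Sy = Ok-quantified φ ok x∈ (inj₁ Sy)

  Ok-⊑ : ∀ {ψ φ S} → ψ ⊑ φ → Ok S φ → Σ (Var → Set) λ S′ → Ok S′ ψ
  Ok-⊑ self      ok       = _ , ok
  Ok-⊑ (neg s)   ok       = Ok-⊑ s ok
  Ok-⊑ (left s)  (ok , _) = Ok-⊑ s ok
  Ok-⊑ (right s) (_ , ok) = Ok-⊑ s ok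
  Ok-⊑ (body s)  (_ , ok) = Ok-⊑ s ok

  Ok⇒Discipline : ∀ {S φ} → Ok S φ → Sorted (quantified φ) → Discipline φ
  Ok⇒Discipline {S} {φ} ok sorted = record
    { distinct   = AllPairs.map (λ y≻x e → irrefl (sym e) y≻x) sorted
    ; bound≢free = λ x∈ x∈FV → irrefl refl (Ok-quantified φ ok x∈ (Ok-FV φ ok x∈FV))
    ; bound≻free = λ {ψ} ψ⊑φ y∈FV x∈ → let (_ , ok′) = Ok-⊑ ψ⊑φ ok in
                     Ok-quantified ψ ok′ x∈ (Ok-FV ψ ok′ y∈FV)
    }

  Ok-∃* : ∀ ȳ {S φ} → Sorted ȳ → (∀ {y z} → y ∈ ȳ → S z → y ≻ z) → Ok (λ z → S z ⊎ z ∈ ȳ) φ → Ok S (∃* ȳ φ)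
  Ok-∃* []      {φ = φ} _ _ ok = Ok-resp φ [ id , (λ ()) ]′ inj₁ ok
  Ok-∃* (y ∷ ȳ) {S} {φ} (p ∷ ps) ȳ≻ ok = ȳ≻ (here refl) ,
    Ok-∃* ȳ ps (λ { z∈ (inj₁ Sz) → ȳ≻ (there z∈) Sz ; z∈ (inj₂ refl) → All.lookup p z∈ })
      (Ok-resp φ
        (λ { (inj₁ Sz) → inj₁ (inj₁ Sz) ; (inj₂ (here e)) → inj₁ (inj₂ e) ; (inj₂ (there z∈)) → inj₂ z∈ })
        (λ { (inj₁ (inj₁ Sz)) → inj₁ Sz ; (inj₁ (inj₂ e)) → inj₂ (here e) ; (inj₂ z∈) → inj₂ (there z∈) }) ok)

  ∈ᵗ-apply : ∀ {f x} (x̄ : Vec Var (arity f)) → x ∈ᵗ apply f x̄ → x ∈ toList x̄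
  ∈ᵗ-apply x̄ (there x∈) = go x̄ x∈
    where
    go : ∀ {n x} (x̄ : Vec Var n) → VecAny.Any (x ∈ᵗ_) (Vec.map var x̄) → x ∈ toList x̄
    go (_ ∷ _) (VecAny.here here) = here refl
    go (_ ∷ x̄) (VecAny.there x∈)  = there (go x̄ x∈)

  Ok-basic : ∀ {S} α → (∀ {a} → a ∈ α → ∀ {x} → x ∈ nodes a → S x) → Ok S (basic (toBasic α))
  Ok-basic []      h = tt
  Ok-basic {S} (a ∷ α) h = one a (h (here refl)) , Ok-basic α (h ∘ there)
    where
    one : ∀ a → (∀ {x} → x ∈ nodes a → S x) → Ok S (atom (toAtom a))
    one (x ≃ y)        h (inj₁ here) = h (here refl)
    one (x ≃ y)        h (inj₂ here) = h (there (here refl))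
    one (x ≔ (f , xs)) h (inj₁ here) = h (here refl)
    one (x ≔ (f , xs)) h (inj₂ x∈)   = h (there (∈ᵗ-apply xs x∈))
    one (fin x)        h here        = h (here refl)

  FV-∃*⁺ : ∀ x̄ {φ x} → x ∈FV φ → x ∉ x̄ → x ∈FV ∃* x̄ φ
  FV-∃*⁺ []      x∈ _  = x∈
  FV-∃*⁺ (y ∷ x̄) x∈ x∉ = (x∉ ∘ here) , FV-∃*⁺ x̄ x∈ (x∉ ∘ there)

  FV-⋀⁺ : ∀ {φs φ x} → φ ∈ φs → x ∈FV φ → x ∈FV ⋀ φs
  FV-⋀⁺ (here refl) x∈ = inj₁ x∈
  FV-⋀⁺ (there φ∈)  x∈ = inj₂ (FV-⋀⁺ φ∈ x∈)

  FV-basic : ∀ {α a} → a ∈ α → subject a ∈FV basic α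
  FV-basic {a = a} a∈ = FV-⋀⁺ (∈-map⁺ atom a∈) (one a)
    where
    one : ∀ a → subject a ∈FV atom a
    one (x ≈ t)    = inj₁ here
    one (finite x) = here

  module _ (p : Formula) where

    initial : SolvedContext p
    initial = record
      { U = W p ; α = [] ; W⊆U = id ; U-sorted = freeVars-sorted p ; nodesα = λ () ; distinctα = λ ()
      ; orientedα = λ () ; flatα = λ () }

    block-reachable : ∀ {Γ : SolvedContext p} {β L} → SolvedContext.U Γ ⊆ L → (B : SolvedBlock p Γ β L) →
      AllReachable (SolvedBlock.ȳ B) (toBasic (SolvedBlock.β₁ B))
    block-reachable U⊆L B {y} y∈ with reachableβ y∈
      where open SolvedBlock B
    ... | u , u∈ , ε = ⊥-elim (irrefl refl (ȳ-above y∈ (U⊆L u∈)))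
      where open SolvedBlock B
    -- A nonempty path starts with an equation for `u`, so `u` occurs in the block and counts as one
    -- of its free variables. The empty path is impossible because `ȳ` lies above `U`.
    ... | u , u∈ , path@((t , u≈ , _) ◅ _) =
      u , FV-∃*⁺ ȳ (FV-basic u≈) (λ u∈ȳ → irrefl refl (ȳ-above u∈ȳ (U⊆L u∈))) , path
      where open SolvedBlock B

    block-solved : ∀ {Γ : SolvedContext p} {β L} → (B : SolvedBlock p Γ β L) →
      ∀ {α} → α ⊆ toBasic (SolvedBlock.β₁ B) → Solved α
    block-solved B α⊆ = record
      { distinct = λ a∈ b∈ e → atoms (∈-map⁻ toAtom (α⊆ a∈)) (∈-map⁻ toAtom (α⊆ b∈)) e
      ; oriented = λ x∈ → orient (∈-map⁻ toAtom (α⊆ x∈)) }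
      where
      open SolvedBlock B
      atoms : ∀ {a b} → (∃ λ c → c ∈ β₁ × a ≡ toAtom c) → (∃ λ c → c ∈ β₁ × b ≡ toAtom c) → subject a ≡ subject b → a ≡ b
      atoms (c , c∈ , refl) (d , d∈ , refl) e =
        cong toAtom (distinctβ c∈ d∈ (trans (sym (subject-toAtom c)) (trans e (subject-toAtom d))))
      orient : ∀ {x y} → (∃ λ c → c ∈ β₁ × x ≈ var y ≡ toAtom c) → x ≻ y
      orient (x ≃ y , c∈ , refl) = orientedβ c∈

    module Outer {α : Block∃ (FV p)} {L : List Var} (W⊆L : W p ⊆ L) (A : SolvedBlock p initial α L) where
      open SolvedBlock A public using () renaming
        ( ȳ to x̄ ; β₁ to α₁ ; ȳ-sorted to x̄-sorted ; ȳ-above to x̄-above ; nodesβ to nodesα₁ ; distinctβ to distinctα₁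
        ; orientedβ to orientedα₁ ; flatβ to flatα₁ ; correct to correctα₁ )

      Γ : SolvedContext p
      Γ = record
        { U = W p ++ x̄ ; α = α₁ ; W⊆U = ∈-++⁺ˡ
        ; U-sorted = AllPairs.++⁺ (freeVars-sorted p) x̄-sorted (All.tabulate λ w∈ → All.tabulate λ x∈ → x̄-above x∈ (W⊆L w∈))
        ; nodesα = nodesα₁ ; distinctα = distinctα₁ ; orientedα = orientedα₁ ; flatα = flatα₁ (λ ()) }

      U = W p ++ x̄

      -- Hides the exception that a block came from and the list above which it was named, so that
      -- membership alone yields the conditions on blocks.
      record Listed (b : Block) : Set₁ where
        field
          {source} : Block∃ (FV p)
          {lower}  : List Var
          U⊆lower  : U ⊆ lower
          solved   : SolvedBlock p Γ source lower
          is-block : b ≡ (SolvedBlock.ȳ solved , toBasic (SolvedBlock.β₁ solved))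

      exceptions : List Block → Formula
      exceptions bs = ⋀ (List.map (neg ∘ block) bs)

      record Blocks (βs : List (Block∃ (FV p))) (L : List Var) : Set₁ where
        field
          bs      : List Block
          listed  : ∀ {b} → b ∈ bs → Listed b
          sorted  : Sorted (quantified (exceptions bs))
          above   : Above L (quantified (exceptions bs))
          ok      : Ok (_∈ U) (exceptions bs)
          correct : ∀ 𝓜 (model : Model 𝓜) (v : Valuation 𝓜) → Solutions._⊨_ 𝓜 model v α₁ →
            Sat 𝓜 v (exceptions bs) ⟺ (∀ {β} → β ∈ βs → ¬ Correctness.⟦_⟧ᴮ 𝓜 model β (v ∘ FV.freeVar))

      blocks : ∀ βs L → U ⊆ L → Blocks βs L
      blocks [] L U⊆L = record
        { bs = [] ; listed = λ () ; sorted = [] ; above = λ () ; ok = tt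
        ; correct = λ _ _ _ _ → (λ _ ()) , λ _ → tt }
      blocks (β ∷ βs) L U⊆L with solveBlock p Γ β L U⊆L
      ... | inj₁ inconsistent = record
        { bs = bs ; listed = listed ; sorted = sorted ; above = above ; ok = ok
        ; correct = λ 𝓜 model v v⊨ → let (f , g) = correct 𝓜 model v v⊨ in
            (λ s → λ { (here refl) → inconsistent 𝓜 model v v⊨ ; (there β∈) → f s β∈ }) , λ h → g (h ∘ there) }
        where open Blocks (blocks βs L U⊆L)
      ... | inj₂ B = record
        { bs = (ȳ , toBasic β₁) ∷ bs
        ; listed = λ { (here refl) → record { U⊆lower = U⊆L ; solved = B ; is-block = refl } ; (there b∈) → listed b∈ }
        ; sorted = subst (λ ys → Sorted (ys ++ quantified (exceptions bs))) (sym (quantified-block ȳ β₁))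
            (AllPairs.++⁺ ȳ-sorted sorted (All.tabulate λ x∈ → All.tabulate λ y∈ → above y∈ (∈-++⁺ʳ L x∈)))
        ; above = λ y∈ l∈ → [ (λ y∈ȳ → ȳ-above (subst (_ ∈_) (quantified-block ȳ β₁) y∈ȳ) l∈)
                            , (λ y∈bs → above y∈bs (∈-++⁺ˡ l∈)) ]′ (∈-++⁻ (quantified (∃* ȳ (basic (toBasic β₁)))) y∈)
        ; ok = Ok-∃* ȳ ȳ-sorted (λ y∈ z∈ → ȳ-above y∈ (U⊆L z∈)) (Ok-basic β₁ λ a∈ x∈ → ∈-++⁻ U (nodesβ a∈ x∈)) , ok
        ; correct = λ 𝓜 model v v⊨ →
            let (f , g)   = correct 𝓜 model v v⊨
                (f₁ , g₁) = SolvedBlock.correct B 𝓜 model v v⊨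
                (f₂ , g₂) = Local.block-correct 𝓜 model {v} {U} {ȳ} {β₁} (λ y∈ u∈ → ȳ-above y∈ (U⊆L u∈)) nodesβ
            in (λ { (¬s , s) → λ { (here refl) t → ¬s (g₂ (g₁ t)) ; (there β∈) → f s β∈ } }) ,
               λ h → (h (here refl) ∘ f₁ ∘ f₂) , g (h ∘ there) }
        where
        open SolvedBlock B hiding (correct)
        -- The remaining exceptions are named above the names just used, so quantified variables
        -- increase from left to right through the whole conjunction.
        open Blocks (blocks βs (L ++ ȳ) (∈-++⁺ˡ ∘ U⊆L))

    record Disjunct (c : Conjunct (FV p)) (L : List Var) : Set₁ where
      field
        formula  : Formula
        explicit : ExplicitSolvedForm formula
        ok       : Ok (_∈ W p) formula
        sorted   : Sorted (quantified formula)
        above    : Above L (quantified formula)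
        correct  : ∀ 𝓜 (model : Model 𝓜) (ρ : Valuation 𝓜) →
          Sat 𝓜 ρ formula ⟺ Correctness.⟦_⟧ᶜ 𝓜 model c (ρ ∘ FV.freeVar)

    Unsatisfiable : Conjunct (FV p) → Set₁
    Unsatisfiable c = ∀ 𝓜 (model : Model 𝓜) (ρ : Valuation 𝓜) → ¬ Correctness.⟦_⟧ᶜ 𝓜 model c (ρ ∘ FV.freeVar)

    disjunct : ∀ c L → W p ⊆ L → Unsatisfiable c ⊎ Disjunct c L
    disjunct (α , βs) L W⊆L with solveBlock p initial α L W⊆L
    ... | inj₁ inconsistent = inj₁ λ { 𝓜 model ρ (s , _) → inconsistent 𝓜 model ρ [] s }
    ... | inj₂ A = decide em
      where
      open Outer W⊆L A
      open Blocks (blocks βs (L ++ x̄) λ u∈ → [ ∈-++⁺ˡ ∘ W⊆L , ∈-++⁺ʳ L ]′ (∈-++⁻ (W p) u∈))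
        renaming (sorted to bs-sorted; above to bs-above; ok to bs-ok; correct to bs-correct)

      formula = nested x̄ (toBasic α₁) bs

      quantified-formula : quantified formula ≡ x̄ ++ quantified (exceptions bs)
      quantified-formula = trans (quantified-∃* x̄)
        (cong (λ ys → x̄ ++ ys ++ quantified (exceptions bs)) (quantified-basic α₁))

      sorted : Sorted (quantified formula)
      sorted = subst Sorted (sym quantified-formula)
        (AllPairs.++⁺ x̄-sorted bs-sorted (All.tabulate λ x∈ → All.tabulate λ y∈ → bs-above y∈ (∈-++⁺ʳ L x∈)))

      above : Above L (quantified formula)
      above y∈ l∈ with ∈-++⁻ x̄ (subst (_ ∈_) quantified-formula y∈)
      ... | inj₁ y∈x̄ = x̄-above y∈x̄ l∈
      ... | inj₂ y∈b = bs-above y∈b (∈-++⁺ˡ l∈)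

      ok : Ok (_∈ W p) formula
      ok = Ok-∃* x̄ x̄-sorted (λ x∈ z∈ → x̄-above x∈ (W⊆L z∈))
        ( Ok-basic α₁ (λ a∈ x∈ → ∈-++⁻ (W p) (nodesα₁ a∈ x∈))
        , Ok-resp (exceptions bs) (∈-++⁻ (W p)) [ ∈-++⁺ˡ , ∈-++⁺ʳ (W p) ]′ bs-ok )

      module _ (𝓜 : Structure) (model : Model 𝓜) (ρ : Valuation 𝓜) where
        open Coincidence 𝓜
        open Solutions 𝓜 model
        open Correctness 𝓜 model
        open Local 𝓜 model

        correct-to : Sat 𝓜 ρ formula → ⟦ α , βs ⟧ᶜ (ρ ∘ FV.freeVar)
        correct-to s with ∃*-elim x̄ s
        ... | v , v≡ρ , t , ts = proj₁ (correctα₁ 𝓜 model ρ []) (v , (λ u∈ → v≡ρ (W∉x̄ u∈)) , v⊨α₁) ,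
          λ β∈ u → proj₁ (bs-correct 𝓜 model v v⊨α₁) ts β∈ (block-cong (λ x → sym (v≡ρ (W∉x̄ (freeVar∈W p x)))) u)
          where
          v⊨α₁ = proj₁ (basic-correct α₁) t
          W∉x̄ : ∀ {u} → u ∈ W p → u ∉ x̄
          W∉x̄ u∈ u∈x̄ = irrefl refl (x̄-above u∈x̄ (W⊆L u∈))

        solution : ⟦ α , βs ⟧ᶜ (ρ ∘ FV.freeVar) → ∃ λ σ → (∀ {z} → z ∉ x̄ → σ z ≡ ρ z) × σ ⊨ α₁ × Sat 𝓜 σ (exceptions bs)
        solution (s , ss) with proj₂ (correctα₁ 𝓜 model ρ []) s
        ... | w , w≡ρ , w⊨α₁ with override {U = W p} (λ x∈ w∈ → x̄-above x∈ (W⊆L w∈)) nodesα₁ w≡ρ w⊨α₁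
        ...   | σ , σ≡ρ , σ⊨α₁ = σ , σ≡ρ , σ⊨α₁ , proj₂ (bs-correct 𝓜 model σ σ⊨α₁)
          λ β∈ u → ss β∈ (block-cong (λ x → σ≡ρ (λ x∈ → irrefl refl (x̄-above x∈ (W⊆L (freeVar∈W p x))))) u)

        correct-from : ⟦ α , βs ⟧ᶜ (ρ ∘ FV.freeVar) → Sat 𝓜 ρ formula
        correct-from s with solution s
        ... | σ , σ≡ρ , σ⊨α₁ , t = ∃*-intro x̄ σ σ≡ρ (proj₂ (basic-correct α₁) σ⊨α₁ , t)

        -- Such an exception holds wherever `α₁` does, with the current values of `ȳ` as witnesses,
        -- so its negation can never be satisfied together with `α₁`.
        improper-false : ∀ {ȳ β} → (ȳ , β) ∈ bs → β ⊆ toBasic α₁ → ¬ ⟦ α , βs ⟧ᶜ (ρ ∘ FV.freeVar)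
        improper-false {ȳ} {β} b∈ β⊆ s with solution s
        ... | σ , σ≡ρ , σ⊨α₁ , t = ⋀-elim t (∈-map⁺ (neg ∘ block) b∈)
          (∃*-intro ȳ σ (λ _ → refl) (⋀-intro _ λ φ∈ → one (∈-map⁻ atom φ∈)))
          where
          one : ∀ {φ} → (∃ λ a → a ∈ β × φ ≡ atom a) → Sat 𝓜 σ φ
          one (a , a∈ , refl) = ⋀-elim (proj₂ (basic-correct α₁) σ⊨α₁) (∈-map⁺ atom (β⊆ a∈))

      Improper : Block → Set
      Improper (_ , β) = β ⊆ toBasic α₁

      decide : Dec (∃ λ b → b ∈ bs × Improper b) → Unsatisfiable (α , βs) ⊎ Disjunct (α , βs) L
      decide (yes (_ , b∈ , improper)) = inj₁ λ 𝓜 model ρ → improper-false 𝓜 model ρ b∈ improper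
      decide (no proper) = inj₂ record
        { formula = formula
        ; explicit = record
          { x̄ = x̄ ; α = toBasic α₁ ; bs = bs ; shape = refl
          ; discipline = Ok⇒Discipline {_∈ W p} ok sorted
          ; solvedα = block-solved A id
          ; solvedβ = λ b∈ → solvedβ (listed b∈)
          ; solvedα′β = λ b∈ → solvedα′β (listed b∈)
          ; reachableα = block-reachable W⊆L A
          ; reachableβ = λ b∈ → reachableβ (listed b∈)
          ; finiteCovered = λ u∈ b∈ → inj₂ (finiteCovered u∈ (listed b∈))
          ; properβ = λ b∈ → properβ b∈ em }
        ; ok = ok ; sorted = sorted ; above = above
        ; correct = λ 𝓜 model ρ → correct-to 𝓜 model ρ , correct-from 𝓜 model ρ }
        where
        solvedβ : ∀ {ȳ β} → Listed (ȳ , β) → Solved β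
        solvedβ record { solved = B ; is-block = refl } = block-solved B id

        reachableβ : ∀ {ȳ β} → Listed (ȳ , β) → AllReachable ȳ β
        reachableβ record { U⊆lower = U⊆ ; solved = B ; is-block = refl } = block-reachable U⊆ B

        solvedα′β : ∀ {ȳ β} → Listed (ȳ , β) → Solved (equations (toBasic α₁) ++ β)
        solvedα′β record { solved = B ; is-block = refl } = block-solved B λ a∈ →
          [ toBasic-⊆ (SolvedBlock.extendsα B) ∘ equations-toBasic α₁ , id ]′ (∈-++⁻ (equations (toBasic α₁)) a∈)

        finiteCovered : ∀ {u ȳ β} → finite u ∈ toBasic α₁ → Listed (ȳ , β) →
          ∀ {v} → Reach (toBasic α₁ ++ β) u v → ¬ (v isLhsIn (toBasic α₁ ++ β)) → finite v ∈ β
        finiteCovered u∈ record { solved = B ; is-block = refl } path ¬lhs with ∈-map⁻ toAtom u∈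
        ... | fin _ , u∈α , refl = SolvedBlock.coveredβ B u∈α (within path)
                (λ (t , v∈) → ¬lhs (t , ∈-++⁺ʳ (toBasic α₁) v∈))
          where
          -- The equations of `α₁` reappear in the solved exception, so every path in the
          -- conjunction already runs inside it.
          within : ∀ {u v} → Reach (toBasic α₁ ++ toBasic (SolvedBlock.β₁ B)) u v → Reach (toBasic (SolvedBlock.β₁ B)) u v
          within ε = ε
          within ((t , u∈ , v∈) ◅ path) = (t , [ toBasic-⊆ (SolvedBlock.extendsα B) ∘ ≈∈equationPart α₁ , id ]′
            (∈-++⁻ (toBasic α₁) u∈) , v∈) ◅ within path

        properβ : ∀ {ȳ β} → (ȳ , β) ∈ bs → Dec (∃ λ a → a ∈ β × a ∉ toBasic α₁) → ∃ λ a → a ∈ β × a ∉ toBasic α₁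
        properβ b∈ (yes a)  = a
        properβ {β = β} b∈ (no ¬a) = ⊥-elim (proper (_ , b∈ , λ {a} a∈ → member a a∈ em))
          where
          member : ∀ a → a ∈ β → Dec (a ∈ toBasic α₁) → a ∈ toBasic α₁
          member a a∈ (yes a∈α) = a∈α
          member a a∈ (no a∉α)  = ⊥-elim (¬a (a , a∈ , a∉α))

    record Disjunction (d : DNF (FV p)) (L : List Var) : Set₁ where
      field
        ds       : List Formula
        explicit : All ExplicitSolvedForm ds
        ok       : Ok (_∈ W p) (⋁ ds)
        sorted   : Sorted (quantified (⋁ ds))
        above    : Above L (quantified (⋁ ds))
        correct  : ∀ 𝓜 (model : Model 𝓜) (ρ : Valuation 𝓜) →
          Sat 𝓜 ρ (⋁ ds) ⟺ Correctness.⟦_⟧ᴰ 𝓜 model d (ρ ∘ FV.freeVar)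

    disjunction : ∀ d L → W p ⊆ L → Disjunction d L
    disjunction [] L _ = record
      { ds = [] ; explicit = [] ; ok = tt ; sorted = [] ; above = λ ()
      ; correct = λ _ _ _ → (λ ()) , λ { (_ , () , _) } }
    disjunction (c ∷ d) L W⊆L with disjunct c L W⊆L
    ... | inj₁ unsat = record
      { ds = ds ; explicit = explicit ; ok = ok ; sorted = sorted ; above = above
      ; correct = λ 𝓜 model ρ → let (f , g) = correct 𝓜 model ρ in
          (λ s → let (c′ , c∈ , t) = f s in c′ , there c∈ , t) ,
          λ { (_ , here refl , t) → ⊥-elim (unsat 𝓜 model ρ t) ; (c′ , there c∈ , t) → g (c′ , c∈ , t) } }
      where open Disjunction (disjunction d L W⊆L)
    ... | inj₂ D = record
      { ds = D.formula ∷ ds ; explicit = D.explicit ∷ explicit ; ok = D.ok , ok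
      ; sorted = AllPairs.++⁺ D.sorted sorted (All.tabulate λ x∈ → All.tabulate λ y∈ → above y∈ (∈-++⁺ʳ L x∈))
      ; above = λ y∈ l∈ → [ (λ y∈D → D.above y∈D l∈) , (λ y∈ds → above y∈ds (∈-++⁺ˡ l∈)) ]′ (∈-++⁻ (quantified D.formula) y∈)
      ; correct = λ 𝓜 model ρ → let (f , g) = correct 𝓜 model ρ ; (f₁ , g₁) = D.correct 𝓜 model ρ in
          [ (λ s → c , here refl , f₁ s) , (λ s → let (c′ , c∈ , t) = f s in c′ , there c∈ , t) ]′ ,
          λ { (_ , here refl , t) → inj₁ (g₁ t) ; (c′ , there c∈ , t) → inj₂ (g (c′ , c∈ , t)) } }
      where
      module D = Disjunct D
      open Disjunction (disjunction d (L ++ quantified D.formula) (∈-++⁺ˡ ∘ W⊆L))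

  -- Closed solved forms and the final case distinction

  neg-injective : ∀ {φ ψ : Formula} → _≡_ {A = Formula} (neg φ) (neg ψ) → φ ≡ ψ
  neg-injective refl = refl

  -- Reachability starts at free variables, so without these nothing is quantified and no atom
  -- occurs; an exception would contribute an atom by properness. What remains is the empty
  -- conjunction, true in every structure.
  closed-explicit-true : ∀ {φ} → ExplicitSolvedForm φ → (∀ x → ¬ (x ∈FV φ)) → ∀ 𝓜 ρ → Sat 𝓜 ρ φ
  closed-explicit-true {φ} E closed 𝓜 ρ =
    go x̄ α bs (neg-injective shape) reachableα reachableβ properβ
    where
    open GeneralSolved E
    go : ∀ x̄ α bs → φ ≡ nested x̄ α bs → AllReachable x̄ α → (∀ {ȳ β} → (ȳ , β) ∈ bs → AllReachable ȳ β) →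
      (∀ {ȳ β} → (ȳ , β) ∈ bs → ∃ λ a → a ∈ β × a ∉ α) → Sat 𝓜 ρ φ
    go (x ∷ x̄) α bs refl reach _ _ with reach (here refl)
    ... | y , y∈ , _ = ⊥-elim (closed y (widen (x ∷ x̄) y∈))
      where
      widen : ∀ x̄ {y} → y ∈FV ∃* x̄ (basic α) → y ∈FV nested x̄ α bs
      widen []      y∈         = inj₁ y∈
      widen (_ ∷ x̄) (y≢ , y∈) = y≢ , widen x̄ y∈
    go [] (a ∷ α) bs refl _ _ _ = ⊥-elim (closed _ (inj₁ (FV-basic {a ∷ α} (here refl))))
    go [] [] [] refl _ _ _ = tt , tt
    go [] [] ((y ∷ ȳ , β) ∷ bs) refl _ reach _ with reach (here refl) (here refl)
    ... | z , z∈ , _ = ⊥-elim (closed z (inj₂ (inj₁ z∈)))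
    go [] [] (([] , β) ∷ bs) refl _ _ proper with proper (here refl)
    ... | a , a∈ , _ = ⊥-elim (closed _ (inj₂ (inj₁ (FV-basic a∈))))

  explicit-solution : ∀ p →
    (p ≡ᵀ true) ⊎ (p ≡ᵀ false) ⊎
    Σ Formula λ φ →
      (p ≡ᵀ φ) × Discipline φ × (∀ x → x ∈FV φ → x ∈FV p) × ∃ (λ x → x ∈FV φ) ×
      ¬ (φ ≡ᵀ true) × ¬ (φ ≡ᵀ false) ×
      Σ (List Formula) λ ds → φ ≡ ⋁ ds × All ExplicitSolvedForm ds
  explicit-solution p = decide em em em
    where
    open Disjunction (disjunction p (dnf p) (W p) id)
    φ = ⋁ ds

    equivalent : p ≡ᵀ φ
    equivalent 𝓜 model ρ with Correctness.dnf-correct 𝓜 model p ρ | correct 𝓜 model ρ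
    ... | f , g | f₁ , g₁ = g₁ ∘ f , g ∘ f₁

    via : ∀ ψ → φ ≡ᵀ ψ → p ≡ᵀ ψ
    via ψ φ≡ψ 𝓜 model ρ with equivalent 𝓜 model ρ | φ≡ψ 𝓜 model ρ
    ... | f , g | f₁ , g₁ = f₁ ∘ f , g ∘ g₁

    closed-trivial : (∀ x → ¬ (x ∈FV φ)) → (φ ≡ᵀ true) ⊎ (φ ≡ᵀ false)
    closed-trivial = go ds explicit
      where
      go : ∀ ds → All ExplicitSolvedForm ds → (∀ x → ¬ (x ∈FV ⋁ ds)) → (⋁ ds ≡ᵀ true) ⊎ (⋁ ds ≡ᵀ false)
      go []       _       _      = inj₂ λ _ _ _ → id , id
      go (d ∷ ds) (E ∷ _) closed =
        inj₁ λ 𝓜 _ ρ → _ , λ _ → inj₁ (closed-explicit-true E (λ x → closed x ∘ inj₁) 𝓜 ρ)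

    decide : Dec (p ≡ᵀ true) → Dec (p ≡ᵀ false) → Dec (∃ λ x → x ∈FV φ) → _
    decide (yes p≡true) _ _ = inj₁ p≡true
    decide (no _) (yes p≡false) _ = inj₂ (inj₁ p≡false)
    decide (no p≢true) (no p≢false) (no closed) =
      [ (λ φ≡ → ⊥-elim (p≢true (via true φ≡))) , (λ φ≡ → ⊥-elim (p≢false (via false φ≡))) ]′
        (closed-trivial λ x x∈ → closed (x , x∈))
    decide (no p≢true) (no p≢false) (yes free) = inj₂ (inj₂
      (φ , equivalent , Ok⇒Discipline {_∈ W p} ok sorted , (λ x x∈ → ∈-freeVars⁻ p (Ok-FV φ ok x∈)) , free ,
       (p≢true ∘ via true) , (p≢false ∘ via false) , ds , refl , explicit))

theorem4p7p1 : (∀ {ℓ} → ExcludedMiddle ℓ) →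
    (𝓕 : Signature) (𝓥 : Variables) →
    let open FirstOrder 𝓕 𝓥 in
    (p : Formula) →
    (p ≡ᵀ true) ⊎
    (p ≡ᵀ false) ⊎
    Σ Formula (λ φ →
    (p ≡ᵀ φ) ×
    Discipline φ ×
    (∀ x → x ∈FV φ → x ∈FV p) ×
    ∃ (λ x → x ∈FV φ) ×
    ¬ (φ ≡ᵀ true) ×
    ¬ (φ ≡ᵀ false) ×
    Σ (List Formula) (λ ds → φ ≡ ⋁ ds × All ExplicitSolvedForm ds))
theorem4p7p1 em 𝓕 𝓥 = Development.explicit-solution em 𝓕 𝓥
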